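{- There exists a function $f:[0,\infty)\to\mathbb{R}$ with $f(x)\to 0$ as $x\to\infty$ such that for every finite simple graph $G$, \[ \Gamma(G) \leq \frac{\bigl(\mu_1(G)+f(\mu_1(G))\bigr)^2}{2} + 1, \] where $\mu_1(G)$ is the largest root of the matching polynomial of $G$ and $\Gamma(G)$ is the Grundy number of $G$.
   Context: For a graph $G$ on $n$ vertices, the matching polynomial is $\mu_G(x)=\sum_{M}(-1)^{|M|}x^{n-2|M|}$, the sum over all matchings $M\subseteq E(G)$ (including the empty matching); all its roots are real and $\mu_1(G)$ denotes the largest one. Given an ordering $(x_1,\dots,x_n)$ of $V(G)$, the first-fit coloring algorithm colors $x_i$ with the smallest positive integer not used on the neighbors of $x_i$ among $x_1,\dots,x_{i-1}$. The Grundy number $\Gamma(G)$ is the largest number of colors used by the first-fit algorithm over all vertex orderings. -}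

module Defs where

open import Data.Fin as Fin using (Fin)
import Data.Fin.Properties as Fin
open import Data.List using (List; []; _∷_; _++_; map; foldr; filter; length; lookup; concatMap; allFin; cartesianProduct; deduplicate)
open import Data.List.Extrema.Nat using (max)
open import Data.List.Membership.DecPropositional using () renaming (_∈?_ to member?)
open import Data.List.Membership.Propositional.Properties using (∈-lookup)
open import Data.List.Relation.Unary.All as All using (All; []; _∷_)
open import Data.List.Relation.Unary.All.Properties using (all-filter; filter⁺; ++⁺; map⁺)
open import Data.List.Relation.Unary.AllPairs as AllPairs using (AllPairs; []; _∷_; allPairs?)
open import Data.List.Relation.Unary.Unique.Propositional using (Unique)
import Data.List.Relation.Unary.Unique.DecPropositional as DecUnique
open import Data.Nat as ℕ using (ℕ; zero; suc)
import Data.Nat.Properties as ℕ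
import Data.Integer as ℤ
open import Data.Product using (Σ; ∃; _×_; _,_; proj₁; proj₂)
open import Data.Rational as ℚ using (ℚ; 0ℚ; 1ℚ; ½)
import Data.Rational.Properties as ℚ
open import Data.Rational.Solver using (module +-*-Solver)
open import Data.Sum using (inj₁; inj₂)
open import Function using (_on_)
open import Level using (0ℓ)
open import Relation.Binary using (Rel; Decidable; Symmetric; Irreflexive)
open import Relation.Binary.PropositionalEquality using (_≡_; _≢_; refl; sym; trans; cong; cong₂; subst; subst₂)
open import Relation.Nullary using (contradiction)
open import Relation.Nullary.Decidable using (_×-dec_; ¬?; does)
open import Data.Bool using (if_then_else_)

-- Reals are Cauchy sequences of rationals taken up to _≈_; all operations
-- act pointwise.

IsCauchy : (ℕ → ℚ) → Set
IsCauchy a = ∀ ε → 0ℚ ℚ.< ε → ∃ λ N → ∀ m n → N ℕ.≤ m → N ℕ.≤ n → ℚ.∣ a m ℚ.- a n ∣ ℚ.< ε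

record ℝ : Set where
  constructor mkℝ
  field
    seq    : ℕ → ℚ
    cauchy : IsCauchy seq

open ℝ public

infix 4 _≈_ _≤_ _<_

_≈_ : Rel ℝ 0ℓ
x ≈ y = ∀ ε → 0ℚ ℚ.< ε → ∃ λ N → ∀ n → N ℕ.≤ n → ℚ.∣ seq x n ℚ.- seq y n ∣ ℚ.< ε

_≤_ : Rel ℝ 0ℓ
x ≤ y = ∀ ε → 0ℚ ℚ.< ε → ∃ λ N → ∀ n → N ℕ.≤ n → seq x n ℚ.≤ seq y n ℚ.+ ε

_<_ : Rel ℝ 0ℓ
x < y = ∃ λ ε → 0ℚ ℚ.< ε × ∃ λ N → ∀ n → N ℕ.≤ n → seq x n ℚ.+ ε ℚ.≤ seq y n

private
  open +-*-Solver

  sub-add : ∀ p q → p ≡ (p ℚ.- q) ℚ.+ q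
  sub-add = solve 2 (λ p q → p := (p :- q) :+ q) refl

  add-sub : ∀ p q → (p ℚ.+ q) ℚ.- q ≡ p
  add-sub = solve 2 (λ p q → (p :+ q) :- q := p) refl

  neg-sub : ∀ p q → q ℚ.- p ≡ ℚ.- (p ℚ.- q)
  neg-sub = solve 2 (λ p q → q :- p := :- (p :- q)) refl

  sub-sum : ∀ p q r s → (p ℚ.+ q) ℚ.- (r ℚ.+ s) ≡ (p ℚ.- r) ℚ.+ (q ℚ.- s)
  sub-sum = solve 4 (λ p q r s → (p :+ q) :- (r :+ s) := (p :- r) :+ (q :- s)) refl

  sub-product : ∀ p q r s → p ℚ.* q ℚ.- r ℚ.* s ≡ p ℚ.* (q ℚ.- s) ℚ.+ s ℚ.* (p ℚ.- r)
  sub-product = solve 4 (λ p q r s → p :* q :- r :* s := p :* (q :- s) :+ s :* (p :- r)) refl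

  ∣p∣≤q : ∀ {p q} → p ℚ.≤ q → ℚ.- p ℚ.≤ q → ℚ.∣ p ∣ ℚ.≤ q
  ∣p∣≤q {p} {q} a b with ℚ.∣p∣≡p∨∣p∣≡-p p
  ... | inj₁ e = subst (ℚ._≤ q) (sym e) a
  ... | inj₂ e = subst (ℚ._≤ q) (sym e) b

  ∣∣-sub : ∀ p q → ℚ.∣ p ∣ ℚ.- ℚ.∣ q ∣ ℚ.≤ ℚ.∣ p ℚ.- q ∣
  ∣∣-sub p q = begin
    ℚ.∣ p ∣ ℚ.- ℚ.∣ q ∣
      ≡⟨ cong (λ t → ℚ.∣ t ∣ ℚ.- ℚ.∣ q ∣) (sub-add p q) ⟩
    ℚ.∣ (p ℚ.- q) ℚ.+ q ∣ ℚ.- ℚ.∣ q ∣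
      ≤⟨ ℚ.+-monoˡ-≤ (ℚ.- ℚ.∣ q ∣) (ℚ.∣p+q∣≤∣p∣+∣q∣ (p ℚ.- q) q) ⟩
    (ℚ.∣ p ℚ.- q ∣ ℚ.+ ℚ.∣ q ∣) ℚ.- ℚ.∣ q ∣
      ≡⟨ add-sub ℚ.∣ p ℚ.- q ∣ ℚ.∣ q ∣ ⟩
    ℚ.∣ p ℚ.- q ∣ ∎
    where open ℚ.≤-Reasoning

  ∣-∣-comm : ∀ p q → ℚ.∣ p ℚ.- q ∣ ≡ ℚ.∣ q ℚ.- p ∣
  ∣-∣-comm p q = trans (cong ℚ.∣_∣ (neg-sub q p)) (ℚ.∣-p∣≡∣p∣ (q ℚ.- p))

  reverse-triangle : ∀ p q → ℚ.∣ ℚ.∣ p ∣ ℚ.- ℚ.∣ q ∣ ∣ ℚ.≤ ℚ.∣ p ℚ.- q ∣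
  reverse-triangle p q = ∣p∣≤q (∣∣-sub p q)
    (subst₂ ℚ._≤_ (neg-sub ℚ.∣ p ∣ ℚ.∣ q ∣) (∣-∣-comm q p) (∣∣-sub q p))

  half-pos : ∀ {ε} → 0ℚ ℚ.< ε → 0ℚ ℚ.< ½ ℚ.* ε
  half-pos {ε} 0<ε = subst (ℚ._< ½ ℚ.* ε) (ℚ.*-zeroʳ ½) (ℚ.*-monoʳ-<-pos ½ 0<ε)

  half+half : ∀ ε → ½ ℚ.* ε ℚ.+ ½ ℚ.* ε ≡ ε
  half+half ε = trans (sym (ℚ.*-distribʳ-+ ε ½ ½)) (ℚ.*-identityˡ ε)

  const-cauchy : ∀ q → IsCauchy (λ _ → q)
  const-cauchy q ε 0<ε = 0 , λ _ _ _ _ → subst (λ t → ℚ.∣ t ∣ ℚ.< ε) (sym (ℚ.+-inverseʳ q)) 0<ε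

  +-cauchy : ∀ {a b} → IsCauchy a → IsCauchy b → IsCauchy (λ n → a n ℚ.+ b n)
  +-cauchy {a} {b} ca cb ε 0<ε with ca (½ ℚ.* ε) (half-pos 0<ε) | cb (½ ℚ.* ε) (half-pos 0<ε)
  ... | N , hN | M , hM = N ℕ.⊔ M , λ m n m≥ n≥ → begin-strict
    ℚ.∣ (a m ℚ.+ b m) ℚ.- (a n ℚ.+ b n) ∣
      ≡⟨ cong ℚ.∣_∣ (sub-sum (a m) (b m) (a n) (b n)) ⟩
    ℚ.∣ (a m ℚ.- a n) ℚ.+ (b m ℚ.- b n) ∣
      ≤⟨ ℚ.∣p+q∣≤∣p∣+∣q∣ (a m ℚ.- a n) (b m ℚ.- b n) ⟩
    ℚ.∣ a m ℚ.- a n ∣ ℚ.+ ℚ.∣ b m ℚ.- b n ∣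
      <⟨ ℚ.+-mono-< (hN m n (ℕ.m⊔n≤o⇒m≤o N M m≥) (ℕ.m⊔n≤o⇒m≤o N M n≥))
                    (hM m n (ℕ.m⊔n≤o⇒n≤o N M m≥) (ℕ.m⊔n≤o⇒n≤o N M n≥)) ⟩
    ½ ℚ.* ε ℚ.+ ½ ℚ.* ε
      ≡⟨ half+half ε ⟩
    ε ∎
    where open ℚ.≤-Reasoning

  neg-cauchy : ∀ {a} → IsCauchy a → IsCauchy (λ n → ℚ.- a n)
  neg-cauchy {a} ca ε 0<ε with ca ε 0<ε
  ... | N , hN = N , λ m n m≥ n≥ → subst (ℚ._< ε)
    (trans (sym (ℚ.∣-p∣≡∣p∣ (a m ℚ.- a n))) (cong ℚ.∣_∣ (ℚ.neg-distrib-+ (a m) (ℚ.- a n))))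
    (hN m n m≥ n≥)

  abs-cauchy : ∀ {a} → IsCauchy a → IsCauchy (λ n → ℚ.∣ a n ∣)
  abs-cauchy {a} ca ε 0<ε with ca ε 0<ε
  ... | N , hN = N , λ m n m≥ n≥ → ℚ.≤-<-trans (reverse-triangle (a m) (a n)) (hN m n m≥ n≥)

  bounded : ∀ {a} → IsCauchy a → ∃ λ B → 0ℚ ℚ.< B × ∃ λ N → ∀ n → N ℕ.≤ n → ℚ.∣ a n ∣ ℚ.≤ B
  bounded {a} ca with ca 1ℚ (ℚ.positive⁻¹ 1ℚ)
  ... | N , hN = ℚ.∣ a N ∣ ℚ.+ 1ℚ , ℚ.+-mono-≤-< (ℚ.0≤∣p∣ (a N)) (ℚ.positive⁻¹ 1ℚ) , N , λ n n≥ → begin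
    ℚ.∣ a n ∣
      ≡⟨ cong ℚ.∣_∣ (trans (sub-add (a n) (a N)) (ℚ.+-comm (a n ℚ.- a N) (a N))) ⟩
    ℚ.∣ a N ℚ.+ (a n ℚ.- a N) ∣
      ≤⟨ ℚ.∣p+q∣≤∣p∣+∣q∣ (a N) (a n ℚ.- a N) ⟩
    ℚ.∣ a N ∣ ℚ.+ ℚ.∣ a n ℚ.- a N ∣
      ≤⟨ ℚ.+-monoʳ-≤ ℚ.∣ a N ∣ (ℚ.<⇒≤ (hN n N n≥ ℕ.≤-refl)) ⟩
    ℚ.∣ a N ∣ ℚ.+ 1ℚ ∎
    where open ℚ.≤-Reasoning

  *-mono-bound : ∀ {p A q δ} → 0ℚ ℚ.< A → 0ℚ ℚ.≤ q → p ℚ.≤ A → q ℚ.< δ → p ℚ.* q ℚ.< A ℚ.* δ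
  *-mono-bound {p} {A} {q} {δ} 0<A 0≤q p≤A q<δ = ℚ.≤-<-trans
    (ℚ.*-monoʳ-≤-nonNeg q {{ℚ.nonNegative 0≤q}} p≤A)
    (ℚ.*-monoʳ-<-pos A {{ℚ.positive 0<A}} q<δ)

  split-ε : ∀ C → 0ℚ ℚ.< C → ∀ ε → 0ℚ ℚ.< ε → ∃ λ δ → 0ℚ ℚ.< δ × C ℚ.* δ ≡ ε
  split-ε C 0<C ε 0<ε = inv ℚ.* ε , 0<δ , C*δ≡ε
    where
    instance
      C-pos : ℚ.Positive C
      C-pos = ℚ.positive 0<C
      C-nonZero : ℚ.NonZero C
      C-nonZero = ℚ.pos⇒nonZero C
    inv : ℚ
    inv = ℚ.1/ C
    0<δ : 0ℚ ℚ.< inv ℚ.* ε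
    0<δ = subst (ℚ._< inv ℚ.* ε) (ℚ.*-zeroʳ inv) (ℚ.*-monoʳ-<-pos inv {{ℚ.1/pos⇒pos C}} 0<ε)
    C*δ≡ε : C ℚ.* (inv ℚ.* ε) ≡ ε
    C*δ≡ε = trans (sym (ℚ.*-assoc C inv ε)) (trans (cong (ℚ._* ε) (ℚ.*-inverseʳ C)) (ℚ.*-identityˡ ε))

  product-bound : ∀ p q r s A B δ → 0ℚ ℚ.< A → 0ℚ ℚ.< B →
                  ℚ.∣ p ∣ ℚ.≤ A → ℚ.∣ s ∣ ℚ.≤ B → ℚ.∣ p ℚ.- r ∣ ℚ.< δ → ℚ.∣ q ℚ.- s ∣ ℚ.< δ →
                  ℚ.∣ p ℚ.* q ℚ.- r ℚ.* s ∣ ℚ.< (A ℚ.+ B) ℚ.* δ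
  product-bound p q r s A B δ 0<A 0<B p≤A s≤B p-r q-s = begin-strict
    ℚ.∣ p ℚ.* q ℚ.- r ℚ.* s ∣
      ≡⟨ cong ℚ.∣_∣ (sub-product p q r s) ⟩
    ℚ.∣ p ℚ.* (q ℚ.- s) ℚ.+ s ℚ.* (p ℚ.- r) ∣
      ≤⟨ ℚ.∣p+q∣≤∣p∣+∣q∣ (p ℚ.* (q ℚ.- s)) (s ℚ.* (p ℚ.- r)) ⟩
    ℚ.∣ p ℚ.* (q ℚ.- s) ∣ ℚ.+ ℚ.∣ s ℚ.* (p ℚ.- r) ∣
      ≡⟨ cong₂ ℚ._+_ (ℚ.∣p*q∣≡∣p∣*∣q∣ p (q ℚ.- s)) (ℚ.∣p*q∣≡∣p∣*∣q∣ s (p ℚ.- r)) ⟩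
    ℚ.∣ p ∣ ℚ.* ℚ.∣ q ℚ.- s ∣ ℚ.+ ℚ.∣ s ∣ ℚ.* ℚ.∣ p ℚ.- r ∣
      <⟨ ℚ.+-mono-< (*-mono-bound 0<A (ℚ.0≤∣p∣ (q ℚ.- s)) p≤A q-s) (*-mono-bound 0<B (ℚ.0≤∣p∣ (p ℚ.- r)) s≤B p-r) ⟩
    A ℚ.* δ ℚ.+ B ℚ.* δ
      ≡⟨ sym (ℚ.*-distribʳ-+ δ A B) ⟩
    (A ℚ.+ B) ℚ.* δ ∎
    where open ℚ.≤-Reasoning

  *-cauchy : ∀ {a b} → IsCauchy a → IsCauchy b → IsCauchy (λ n → a n ℚ.* b n)
  *-cauchy {a} {b} ca cb ε 0<ε =
    let A , 0<A , K , hA = bounded {a} ca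
        B , 0<B , L , hB = bounded {b} cb
        δ , 0<δ , Cδ≡ε   = split-ε (A ℚ.+ B) (ℚ.+-mono-< 0<A 0<B) ε 0<ε
        N , hN = ca δ 0<δ
        M , hM = cb δ 0<δ
    in (K ℕ.⊔ L) ℕ.⊔ (N ℕ.⊔ M) , λ m n m≥ n≥ →
    let m≥KL = ℕ.m⊔n≤o⇒m≤o (K ℕ.⊔ L) (N ℕ.⊔ M) m≥
        n≥KL = ℕ.m⊔n≤o⇒m≤o (K ℕ.⊔ L) (N ℕ.⊔ M) n≥
        m≥NM = ℕ.m⊔n≤o⇒n≤o (K ℕ.⊔ L) (N ℕ.⊔ M) m≥
        n≥NM = ℕ.m⊔n≤o⇒n≤o (K ℕ.⊔ L) (N ℕ.⊔ M) n≥
    in subst (ℚ.∣ a m ℚ.* b m ℚ.- a n ℚ.* b n ∣ ℚ.<_) Cδ≡ε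
         (product-bound (a m) (b m) (a n) (b n) A B δ 0<A 0<B
           (hA m (ℕ.m⊔n≤o⇒m≤o K L m≥KL))
           (hB n (ℕ.m⊔n≤o⇒n≤o K L n≥KL))
           (hN m n (ℕ.m⊔n≤o⇒m≤o N M m≥NM) (ℕ.m⊔n≤o⇒m≤o N M n≥NM))
           (hM m n (ℕ.m⊔n≤o⇒n≤o N M m≥NM) (ℕ.m⊔n≤o⇒n≤o N M n≥NM)))

infix  8 -_
infixr 8 _^_
infixl 7 _*_
infixl 6 _+_

fromℚ : ℚ → ℝ
fromℚ q = mkℝ (λ _ → q) (const-cauchy q)

fromℕ : ℕ → ℝ
fromℕ n = fromℚ (ℤ.+ n ℚ./ 1)

0ℝ 1ℝ : ℝ
0ℝ = fromℚ 0ℚ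
1ℝ = fromℚ 1ℚ

_+_ _*_ : ℝ → ℝ → ℝ
x + y = mkℝ (λ n → seq x n ℚ.+ seq y n) (+-cauchy {seq x} {seq y} (cauchy x) (cauchy y))
x * y = mkℝ (λ n → seq x n ℚ.* seq y n) (*-cauchy {seq x} {seq y} (cauchy x) (cauchy y))

-_ ∣_∣ : ℝ → ℝ
- x = mkℝ (λ n → ℚ.- seq x n) (neg-cauchy {seq x} (cauchy x))
∣ x ∣ = mkℝ (λ n → ℚ.∣ seq x n ∣) (abs-cauchy {seq x} (cauchy x))

_^_ : ℝ → ℕ → ℝ
x ^ zero  = 1ℝ
x ^ suc k = x * x ^ k

sum : List ℝ → ℝ
sum = foldr _+_ 0ℝ

ℝ≥0 : Set
ℝ≥0 = Σ ℝ (0ℝ ≤_)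

_≈₊_ : Rel ℝ≥0 0ℓ
_≈₊_ = _≈_ on proj₁

VanishesAtInfinity : (ℝ≥0 → ℝ) → Set
VanishesAtInfinity f =
  ∀ ε → 0ℝ < ε → ∃ λ K → ∀ (x : ℝ≥0) → K ≤ proj₁ x → ∣ f x ∣ < ε

IsLargestRoot : (ℝ → ℝ) → ℝ → Set
IsLargestRoot p r = p r ≈ 0ℝ × (∀ s → p s ≈ 0ℝ → s ≤ r)

record Graph (n : ℕ) : Set₁ where
  field
    Adj    : Rel (Fin n) 0ℓ
    adj?   : Decidable Adj
    symm   : Symmetric Adj
    irrefl : Irreflexive _≡_ Adj

Edge : ℕ → Set
Edge n = Fin n × Fin n

-- Each undirected edge {u , v} occurs exactly once, as the pair with u < v.
edges : ∀ {n} → Graph n → List (Edge n)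
edges {n} G = filter (λ (u , v) → (u Fin.<? v) ×-dec Graph.adj? G u v) (cartesianProduct (allFin n) (allFin n))

DisjointEdges : ∀ {n} → Rel (Edge n) 0ℓ
DisjointEdges (u , v) (w , z) = (u ≢ w × u ≢ z) × (v ≢ w × v ≢ z)

disjointEdges? : ∀ {n} → Decidable (DisjointEdges {n})
disjointEdges? (u , v) (w , z) =
  (¬? (u Fin.≟ w) ×-dec ¬? (u Fin.≟ z)) ×-dec (¬? (v Fin.≟ w) ×-dec ¬? (v Fin.≟ z))

sublists : ∀ {A : Set} → List A → List (List A)
sublists []       = [] ∷ []
sublists (x ∷ xs) = sublists xs ++ map (x ∷_) (sublists xs)

-- `edges G` has no repetitions, so its sublists are the subsets of E(G).
matchings : ∀ {n} → Graph n → List (List (Edge n))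
matchings G = filter (allPairs? disjointEdges?) (sublists (edges G))

matchingTerm : ∀ {n} → ℝ → List (Edge n) → ℝ
matchingTerm {n} x M = (- 1ℝ) ^ length M * x ^ (n ℕ.∸ 2 ℕ.* length M)

matchingPolynomial : ∀ {n} → Graph n → ℝ → ℝ
matchingPolynomial {n} G x = sum (map (matchingTerm {n} x) (matchings G))

IsLargestMatchingRoot : ∀ {n} → Graph n → ℝ → Set
IsLargestMatchingRoot G = IsLargestRoot (matchingPolynomial G)

searchUnused : List ℕ → ℕ → ℕ → ℕ
searchUnused cs zero    c = c
searchUnused cs (suc k) c = if does (member? ℕ._≟_ c cs) then searchUnused cs k (suc c) else c

-- The smallest positive integer not in cs.  If 1 , … , length cs all lie in
-- cs then they exhaust it, so `length cs` membership tests suffice.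
smallestUnused : List ℕ → ℕ
smallestUnused cs = searchUnused cs (length cs) 1

neighbourColours : ∀ {n} → Graph n → Fin n → List (Fin n × ℕ) → List ℕ
neighbourColours G x coloured = map proj₂ (filter (λ (y , _) → Graph.adj? G x y) coloured)

firstFitFrom : ∀ {n} → Graph n → List (Fin n × ℕ) → List (Fin n) → List (Fin n × ℕ)
firstFitFrom G coloured []       = coloured
firstFitFrom G coloured (x ∷ xs) =
  firstFitFrom G ((x , smallestUnused (neighbourColours G x coloured)) ∷ coloured) xs

firstFit : ∀ {n} → Graph n → List (Fin n) → List (Fin n × ℕ)
firstFit G = firstFitFrom G []

coloursUsed : ∀ {n} → Graph n → List (Fin n) → ℕ
coloursUsed G xs = length (deduplicate ℕ._≟_ (map proj₂ (firstFit G xs)))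

words : ∀ {A : Set} → List A → ℕ → List (List A)
words as zero    = [] ∷ []
words as (suc k) = concatMap (λ a → map (a ∷_) (words as k)) as

-- Repetition-free words of length n in the n vertices.
orderings : ∀ n → List (List (Fin n))
orderings n = filter (DecUnique.unique? Fin._≟_) (words (allFin n) n)

Γ : ∀ {n} → Graph n → ℕ
Γ {n} G = max 0 (map (coloursUsed G) (orderings n))

-- μ_G(- x) = (- 1)ⁿ μ_G(x), so the largest root of μ_G lies in [0,∞).

private
  lookup-injective : ∀ {A : Set} {xs : List A} → Unique xs → ∀ i j → lookup xs i ≡ lookup xs j → i ≡ j
  lookup-injective (_  ∷ _)  Fin.zero    Fin.zero    _ = refl
  lookup-injective {xs = _ ∷ xs} (x∉ ∷ _) Fin.zero (Fin.suc j) e = contradiction e (All.lookup x∉ (∈-lookup {xs = xs} j))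
  lookup-injective {xs = _ ∷ xs} (x∉ ∷ _) (Fin.suc i) Fin.zero e = contradiction (sym e) (All.lookup x∉ (∈-lookup {xs = xs} i))
  lookup-injective (_  ∷ xs!) (Fin.suc i) (Fin.suc j) e = cong Fin.suc (lookup-injective xs! i j e)

  endpoints : ∀ {n} → List (Edge n) → List (Fin n)
  endpoints []            = []
  endpoints ((u , v) ∷ M) = u ∷ v ∷ endpoints M

  length-endpoints : ∀ {n} (M : List (Edge n)) → length (endpoints M) ≡ 2 ℕ.* length M
  length-endpoints []      = refl
  length-endpoints (_ ∷ M) = trans (cong (2 ℕ.+_) (length-endpoints M)) (sym (ℕ.*-suc 2 (length M)))

  endpoints-fresh : ∀ {n} {u v : Fin n} {M} → All (DisjointEdges (u , v)) M →
                    All (u ≢_) (endpoints M) × All (v ≢_) (endpoints M)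
  endpoints-fresh [] = [] , []
  endpoints-fresh (((a , b) , (c , d)) ∷ ds) with endpoints-fresh ds
  ... | us , vs = a ∷ b ∷ us , c ∷ d ∷ vs

  Loopless : ∀ {n} → Edge n → Set
  Loopless (u , v) = u ≢ v

  endpoints-unique : ∀ {n} {M : List (Edge n)} → All Loopless M → AllPairs DisjointEdges M → Unique (endpoints M)
  endpoints-unique []       []       = []
  endpoints-unique (l ∷ ls) (d ∷ ds) with endpoints-fresh d
  ... | us , vs = (l ∷ us) ∷ vs ∷ endpoints-unique ls ds

  sublists-all : ∀ {A : Set} {P : A → Set} {xs} → All P xs → All (All P) (sublists xs)
  sublists-all []       = [] ∷ []
  sublists-all (p ∷ ps) = ++⁺ (sublists-all ps) (map⁺ (All.map (p ∷_) (sublists-all ps)))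

  edges-loopless : ∀ {n} (G : Graph n) → All Loopless (edges G)
  edges-loopless {n} G = All.map (λ {e} (u<v , _) → Fin.<⇒≢ u<v)
    (all-filter (λ (u , v) → (u Fin.<? v) ×-dec Graph.adj? G u v) (cartesianProduct (allFin n) (allFin n)))

  matching-size : ∀ {n} (G : Graph n) → All (λ M → 2 ℕ.* length M ℕ.≤ n) (matchings G)
  matching-size {n} G = All.zipWith (λ {M} → size M) (loopless , disjoint)
    where
    loopless : All (All Loopless) (matchings G)
    loopless = filter⁺ (allPairs? disjointEdges?) (sublists-all (edges-loopless G))
    disjoint : All (AllPairs DisjointEdges) (matchings G)
    disjoint = all-filter (allPairs? disjointEdges?) (sublists (edges G))
    size : ∀ M → All Loopless M × AllPairs DisjointEdges M → 2 ℕ.* length M ℕ.≤ n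
    size M (ls , ds) = subst (ℕ._≤ n) (length-endpoints M)
      (Fin.injective⇒≤ (λ {i} {j} → lookup-injective (endpoints-unique ls ds) i j))

  sign : ℕ → ℚ
  sign zero    = 1ℚ
  sign (suc k) = ℚ.- sign k

  neg-neg-* : ∀ p q r → (ℚ.- q) ℚ.* (p ℚ.* r) ≡ (ℚ.- p) ℚ.* (q ℚ.* r)
  neg-neg-* = solve 3 (λ p q r → (:- q) :* (p :* r) := (:- p) :* (q :* r)) refl

  *-left-comm : ∀ p q r → p ℚ.* (q ℚ.* r) ≡ q ℚ.* (p ℚ.* r)
  *-left-comm = solve 3 (λ p q r → p :* (q :* r) := q :* (p :* r)) refl

  neg-involutive : ∀ p → ℚ.- (ℚ.- p) ≡ p
  neg-involutive = solve 1 (λ p → :- (:- p) := p) refl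

  sign-even : ∀ a b → sign (2 ℕ.* a ℕ.+ b) ≡ sign b
  sign-even zero    b = refl
  sign-even (suc a) b rewrite ℕ.+-suc a (a ℕ.+ 0) = trans (neg-involutive (sign (2 ℕ.* a ℕ.+ b))) (sign-even a b)

  sign-∸ : ∀ a n → 2 ℕ.* a ℕ.≤ n → sign (n ℕ.∸ 2 ℕ.* a) ≡ sign n
  sign-∸ a n 2a≤n = trans (sym (sign-even a _)) (cong sign (ℕ.m+[n∸m]≡n 2a≤n))

  ∣sign∣ : ∀ k → ℚ.∣ sign k ∣ ≡ 1ℚ
  ∣sign∣ zero    = refl
  ∣sign∣ (suc k) = trans (ℚ.∣-p∣≡∣p∣ (sign k)) (∣sign∣ k)

  neg-^ : ∀ x k m → seq ((- x) ^ k) m ≡ sign k ℚ.* seq (x ^ k) m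
  neg-^ x zero    m = refl
  neg-^ x (suc k) m = trans (cong ((ℚ.- seq x m) ℚ.*_) (neg-^ x k m))
    (neg-neg-* (sign k) (seq x m) (seq (x ^ k) m))

  neg-sum : ∀ {n} x (Ms : List (List (Edge n))) → All (λ M → 2 ℕ.* length M ℕ.≤ n) Ms → ∀ m →
            seq (sum (map (matchingTerm {n} (- x)) Ms)) m ≡ sign n ℚ.* seq (sum (map (matchingTerm {n} x) Ms)) m
  neg-sum {n} x []       []       m = sym (ℚ.*-zeroʳ (sign n))
  neg-sum {n} x (M ∷ Ms) (l ∷ ls) m = trans
    (cong₂ ℚ._+_ term (neg-sum x Ms ls m))
    (sym (ℚ.*-distribˡ-+ (sign n) (seq (matchingTerm {n} x M) m) (seq (sum (map (matchingTerm {n} x) Ms)) m)))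
    where
    k = n ℕ.∸ 2 ℕ.* length M
    c = seq ((- 1ℝ) ^ length M) m
    term : c ℚ.* seq ((- x) ^ k) m ≡ sign n ℚ.* (c ℚ.* seq (x ^ k) m)
    term = trans (cong (c ℚ.*_) (trans (neg-^ x k m) (cong (ℚ._* seq (x ^ k) m) (sign-∸ (length M) n l))))
      (*-left-comm c (sign n) (seq (x ^ k) m))

  ∣p-0∣ : ∀ p → ℚ.∣ p ℚ.- 0ℚ ∣ ≡ ℚ.∣ p ∣
  ∣p-0∣ p = cong ℚ.∣_∣ (ℚ.+-identityʳ p)

  neg-root : ∀ {n} (G : Graph n) x → matchingPolynomial G x ≈ 0ℝ → matchingPolynomial G (- x) ≈ 0ℝ
  neg-root {n} G x root ε 0<ε = proj₁ (root ε 0<ε) , λ m m≥ →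
    subst (ℚ._< ε) (sym (same m)) (proj₂ (root ε 0<ε) m m≥)
    where
    same : ∀ m → ℚ.∣ seq (matchingPolynomial G (- x)) m ℚ.- 0ℚ ∣ ≡ ℚ.∣ seq (matchingPolynomial G x) m ℚ.- 0ℚ ∣
    same m = let p = seq (matchingPolynomial G x) m in
      trans (∣p-0∣ (seq (matchingPolynomial G (- x)) m))
      (trans (cong ℚ.∣_∣ (neg-sum x (matchings G) (matching-size G) m))
      (trans (ℚ.∣p*q∣≡∣p∣*∣q∣ (sign n) p)
      (trans (cong (ℚ._* ℚ.∣ p ∣) (∣sign∣ n))
      (trans (ℚ.*-identityˡ ℚ.∣ p ∣) (sym (∣p-0∣ p))))))

  -p≤p+ε⇒0≤p+ε : ∀ p ε → 0ℚ ℚ.< ε → ℚ.- p ℚ.≤ p ℚ.+ ε → 0ℚ ℚ.≤ p ℚ.+ ε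
  -p≤p+ε⇒0≤p+ε p ε 0<ε h with ℚ.≤-total 0ℚ p
  ... | inj₁ 0≤p = ℚ.+-mono-≤ 0≤p (ℚ.<⇒≤ 0<ε)
  ... | inj₂ p≤0 = ℚ.≤-trans (ℚ.neg-antimono-≤ p≤0) h

largestMatchingRoot-nonNegative : ∀ {n} (G : Graph n) {r} → IsLargestMatchingRoot G r → 0ℝ ≤ r
largestMatchingRoot-nonNegative G {r} (root , largest) ε 0<ε =
  proj₁ -r≤r , λ m m≥ → -p≤p+ε⇒0≤p+ε (seq r m) ε 0<ε (proj₂ -r≤r m m≥)
  where
  -r≤r : ∃ λ N → ∀ m → N ℕ.≤ m → ℚ.- seq r m ℚ.≤ seq r m ℚ.+ ε
  -r≤r = largest (- r) (neg-root G r root) ε 0<ε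

{-# OPTIONS --safe #-}
module Submission where

-- Suppose x > μ₁(G).  Then μ_H(x) > 0 for every induced subgraph H of G: otherwise
-- bisect between a point where some μ_H fails to be positive and a large point;
-- the limit is a root of μ_G that is at least x, because adding a vertex to a
-- subgraph whose polynomial is small only multiplies it by a bounded factor.
-- Hence the ratios μ_H / μ_{H − v} are positive.  Following paths of decreasing
-- colours in a Grundy colouring, the ratio at a vertex of colour c + 1 is at most
-- r_c, where r_0 = x and r_{c+1} = r_c − 1/r_c (the ratios of the binomial tree),
-- so r_0 , … , r_m are positive for m = Γ(G) − 1.  As r_c² drops by 2 − 1/r_c² at each step,
-- m ≤ x² and 2m ≤ x² + H_m with H_m the harmonic number.  Finally
-- f(x) = 4 Σ_i 2ⁱ / (4ⁱ + x) tends to 0 and satisfies 2 x f(x) ≥ H_m: the summand with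
-- 16ⁱ ≤ m < 16ⁱ⁺¹ suffices.

open import Data.Nat using (ℕ)
open import Data.Product using (Σ; _×_; _,_)
open import Data.Rational using (½)
open import Function.Definitions using (Congruent)
open import Defs

open import Data.Bool using (if_then_else_)
open import Data.Fin as Fin using (Fin)
import Data.Fin.Properties as Fin
import Data.Integer as ℤ
import Data.Integer.Properties as ℤ
open import Data.List using (List; []; _∷_; _++_; map; filter; length; allFin; cartesianProduct; deduplicate)
open import Data.List.Extrema.Nat using (argmax-sel)
open import Data.List.Membership.DecPropositional using () renaming (_∈?_ to member?)
open import Data.List.Membership.Propositional using (_∈_)
open import Data.List.Membership.Propositional.Properties using (∈-map⁺; ∈-map⁻; ∈-filter⁻; ∈-allFin; ∈-deduplicate⁻; ∈-lookup)
import Data.List as List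
import Data.List.Properties as List
open import Data.List.Relation.Binary.Permutation.Propositional using (_↭_; refl; prep; swap; ↭-sym) renaming (trans to ↭-trans)
open import Data.List.Relation.Binary.Permutation.Propositional.Properties using (↭-length; drop-∷; ∈-resp-↭; ++⁺ˡ; shift)
open import Data.List.Relation.Unary.All as All using (All; []; _∷_)
import Data.List.Relation.Unary.All.Properties as All
open import Data.List.Relation.Unary.AllPairs as AllPairs using (AllPairs; []; _∷_; allPairs?)
import Data.List.Relation.Unary.AllPairs.Properties as AllPairs
open import Data.List.Relation.Unary.Any using (here; there)
open import Data.List.Relation.Unary.Unique.Propositional using (Unique)
open import Data.List.Relation.Unary.Unique.Propositional.Properties using (allFin⁺)
open import Data.List.Relation.Unary.Unique.DecPropositional using (unique?)
import Data.List.Relation.Unary.Unique.DecPropositional.Properties as DecUnique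
import Data.Nat as ℕ
open import Data.Nat using (zero; suc)
import Data.Nat.Coprimality as Coprime
import Data.Nat.DivMod as ℕ
import Data.Nat.Properties as ℕ
open import Data.Product using (∃; proj₁; proj₂)
import Data.Rational as ℚ
open import Data.Rational using (ℚ; 0ℚ; 1ℚ)
import Data.Rational.Properties as ℚ
open import Data.Rational.Solver using (module +-*-Solver)
open import Data.Sum using (_⊎_; inj₁; inj₂)
open import Function using (_∘_; id)
open import Relation.Binary.Definitions using (tri<; tri≈; tri>)
open import Relation.Binary.PropositionalEquality using (_≡_; _≢_; refl; sym; trans; cong; cong₂; subst; subst₂; module ≡-Reasoning)
open import Relation.Nullary using (¬_; Dec; yes; no; contradiction)
open import Relation.Nullary.Decidable using (_×-dec_; does)
open import Relation.Unary using (Decidable)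

open +-*-Solver

-- Rational arithmetic

-- `IsLargestMatchingRoot` only bounds the real roots from above, and signs of reals are
-- undecidable. As real operations act termwise, each term of `matchingPolynomial G y` is an exact
-- rational value of the polynomial, so signs are decided at rational points. The combinatorial
-- argument runs at a rational `y` slightly above an approximation of `μ₁`, and a Lipschitz estimate
-- carries the result back to `μ₁`. The recursion for `r` comes from `Φ(v ∷ S) / Φ(S) = x − Σ_{u ~
-- v} Φ(S − u) / Φ(S)`: a vertex of colour `c +
-- 1` has a neighbour of each colour `j` from 1 to `c`, each takes away at least `1 /
-- r_{j−1}`, and these reciprocals telescope. Then `(x + f)² ≥ x² + 2 x f ≥ x² + H_m ≥
-- 2m`. The error `H_m / (2x)` would be of order `log x /
-- x`, but `f` has to be a function of the real `x` alone, compatible with `_≈_`. A series of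
-- Lipschitz rational functions with one summand for each scale of `m` provides this, at the price
-- of the slower decay `x^(−1/2)`.

<⇒≱ : ∀ {p q} → p ℚ.< q → ¬ (q ℚ.≤ p)
<⇒≱ p<q q≤p = ℚ.<-irrefl refl (ℚ.<-≤-trans p<q q≤p)

-- Splits an inequality into a ring identity for the solver and a sign check on `d`. Most estimates
-- below are certified in this way, with `d` written as a sum of visibly nonnegative products.
≤-by-diff : ∀ {p q d} → q ℚ.- p ≡ d → 0ℚ ℚ.≤ d → p ℚ.≤ q
≤-by-diff {p} {q} {d} eq 0≤d = subst₂ ℚ._≤_ (ℚ.+-identityˡ p)
  (solve 2 (λ p q → (q :- p) :+ p := q) refl p q)
  (ℚ.+-monoˡ-≤ p (subst (0ℚ ℚ.≤_) (sym eq) 0≤d))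

<-by-diff : ∀ {p q d} → q ℚ.- p ≡ d → 0ℚ ℚ.< d → p ℚ.< q
<-by-diff {p} {q} {d} eq 0<d = subst₂ ℚ._<_ (ℚ.+-identityˡ p)
  (solve 2 (λ p q → (q :- p) :+ p := q) refl p q)
  (ℚ.+-monoˡ-< p (subst (0ℚ ℚ.<_) (sym eq) 0<d))

diff-nonNeg : ∀ {p q} → p ℚ.≤ q → 0ℚ ℚ.≤ q ℚ.- p
diff-nonNeg {p} {q} p≤q = subst (ℚ._≤ q ℚ.- p) (ℚ.+-inverseʳ p) (ℚ.+-monoˡ-≤ (ℚ.- p) p≤q)

diff-pos : ∀ {p q} → p ℚ.< q → 0ℚ ℚ.< q ℚ.- p
diff-pos {p} {q} p<q = subst (ℚ._< q ℚ.- p) (ℚ.+-inverseʳ p) (ℚ.+-monoˡ-< (ℚ.- p) p<q)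

+-nonNeg : ∀ {p q} → 0ℚ ℚ.≤ p → 0ℚ ℚ.≤ q → 0ℚ ℚ.≤ p ℚ.+ q
+-nonNeg = ℚ.+-mono-≤

+-pos : ∀ {p q} → 0ℚ ℚ.< p → 0ℚ ℚ.≤ q → 0ℚ ℚ.< p ℚ.+ q
+-pos = ℚ.+-mono-<-≤

*-nonNeg : ∀ {p q} → 0ℚ ℚ.≤ p → 0ℚ ℚ.≤ q → 0ℚ ℚ.≤ p ℚ.* q
*-nonNeg {p} {q} 0≤p 0≤q = ℚ.nonNegative⁻¹ _
  {{ℚ.nonNeg*nonNeg⇒nonNeg p {{ℚ.nonNegative 0≤p}} q {{ℚ.nonNegative 0≤q}}}}

*-pos : ∀ {p q} → 0ℚ ℚ.< p → 0ℚ ℚ.< q → 0ℚ ℚ.< p ℚ.* q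
*-pos {p} {q} 0<p 0<q = ℚ.positive⁻¹ _
  {{ℚ.pos*pos⇒pos p {{ℚ.positive 0<p}} q {{ℚ.positive 0<q}}}}

square-nonNeg : ∀ p → 0ℚ ℚ.≤ p ℚ.* p
square-nonNeg p with ℚ.≤-total 0ℚ p
... | inj₁ 0≤p = *-nonNeg 0≤p 0≤p
... | inj₂ p≤0 = subst (0ℚ ℚ.≤_) (solve 1 (λ p → (:- p) :* (:- p) := p :* p) refl p)
  (*-nonNeg (ℚ.neg-antimono-≤ p≤0) (ℚ.neg-antimono-≤ p≤0))

*-monoʳ : ∀ {p q r} → 0ℚ ℚ.≤ r → p ℚ.≤ q → r ℚ.* p ℚ.≤ r ℚ.* q
*-monoʳ {r = r} 0≤r = ℚ.*-monoˡ-≤-nonNeg r {{ℚ.nonNegative 0≤r}}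

*-monoˡ : ∀ {p q r} → 0ℚ ℚ.≤ r → p ℚ.≤ q → p ℚ.* r ℚ.≤ q ℚ.* r
*-monoˡ {r = r} 0≤r = ℚ.*-monoʳ-≤-nonNeg r {{ℚ.nonNegative 0≤r}}

*-mono : ∀ {p q r s} → 0ℚ ℚ.≤ p → 0ℚ ℚ.≤ s → p ℚ.≤ q → r ℚ.≤ s → p ℚ.* r ℚ.≤ q ℚ.* s
*-mono 0≤p 0≤s p≤q r≤s = ℚ.≤-trans (*-monoʳ 0≤p r≤s) (*-monoˡ 0≤s p≤q)

*-cancelˡ : ∀ {p q r} → 0ℚ ℚ.< r → r ℚ.* p ℚ.≤ r ℚ.* q → p ℚ.≤ q
*-cancelˡ {r = r} 0<r = ℚ.*-cancelˡ-≤-pos r {{ℚ.positive 0<r}}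

pos-cancelʳ : ∀ {p q} → 0ℚ ℚ.< p ℚ.* q → 0ℚ ℚ.≤ q → 0ℚ ℚ.< p
pos-cancelʳ {p} {q} 0<pq 0≤q = ℚ.≰⇒> λ p≤0 →
  <⇒≱ 0<pq (subst (p ℚ.* q ℚ.≤_) (ℚ.*-zeroˡ q) (*-monoˡ 0≤q p≤0))

square-cancel-≤ : ∀ {p q} → 0ℚ ℚ.≤ q → p ℚ.* p ℚ.≤ q ℚ.* q → p ℚ.≤ q
square-cancel-≤ {p} {q} 0≤q pp≤qq = ℚ.≮⇒≥ λ q<p → <⇒≱
  (<-by-diff (solve 2 (λ p q → p :* p :- q :* q := (p :+ q) :* (p :- q)) refl p q)
    (*-pos (+-pos (ℚ.≤-<-trans 0≤q q<p) 0≤q) (diff-pos q<p)))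
  pp≤qq

0≤1 : 0ℚ ℚ.≤ 1ℚ
0≤1 = ℚ.nonNegative⁻¹ 1ℚ

0<1 : 0ℚ ℚ.< 1ℚ
0<1 = ℚ.positive⁻¹ 1ℚ

∣-∣-bound : ∀ {p q} → p ℚ.≤ q → ℚ.- p ℚ.≤ q → ℚ.∣ p ∣ ℚ.≤ q
∣-∣-bound {p} {q} p≤q -p≤q with ℚ.∣p∣≡p∨∣p∣≡-p p
... | inj₁ e = subst (ℚ._≤ q) (sym e) p≤q
... | inj₂ e = subst (ℚ._≤ q) (sym e) -p≤q

p≤∣p∣ : ∀ p → p ℚ.≤ ℚ.∣ p ∣
p≤∣p∣ p with ℚ.≤-total 0ℚ p
... | inj₁ 0≤p = ℚ.≤-reflexive (sym (ℚ.0≤p⇒∣p∣≡p 0≤p))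
... | inj₂ p≤0 = ℚ.≤-trans p≤0 (ℚ.0≤∣p∣ p)

∣p-q∣≡∣q-p∣ : ∀ p q → ℚ.∣ p ℚ.- q ∣ ≡ ℚ.∣ q ℚ.- p ∣
∣p-q∣≡∣q-p∣ p q = trans (cong ℚ.∣_∣ (solve 2 (λ p q → p :- q := :- (q :- p)) refl p q)) (ℚ.∣-p∣≡∣p∣ (q ℚ.- p))

triangle : ∀ p q r → ℚ.∣ p ℚ.- r ∣ ℚ.≤ ℚ.∣ p ℚ.- q ∣ ℚ.+ ℚ.∣ q ℚ.- r ∣
triangle p q r = subst (λ t → ℚ.∣ t ∣ ℚ.≤ ℚ.∣ p ℚ.- q ∣ ℚ.+ ℚ.∣ q ℚ.- r ∣)
  (solve 3 (λ p q r → (p :- q) :+ (q :- r) := p :- r) refl p q r)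
  (ℚ.∣p+q∣≤∣p∣+∣q∣ (p ℚ.- q) (q ℚ.- r))

∣∣p∣-∣q∣∣≤∣p-q∣ : ∀ p q → ℚ.∣ ℚ.∣ p ∣ ℚ.- ℚ.∣ q ∣ ∣ ℚ.≤ ℚ.∣ p ℚ.- q ∣
∣∣p∣-∣q∣∣≤∣p-q∣ p q = ∣-∣-bound (lemma p q)
  (subst₂ ℚ._≤_ (solve 2 (λ a b → b :- a := :- (a :- b)) refl ℚ.∣ p ∣ ℚ.∣ q ∣) (∣p-q∣≡∣q-p∣ q p) (lemma q p))
  where
  lemma : ∀ p q → ℚ.∣ p ∣ ℚ.- ℚ.∣ q ∣ ℚ.≤ ℚ.∣ p ℚ.- q ∣
  lemma p q = ≤-by-diff
    (solve 3 (λ a b c → c :- (a :- b) := (c :+ b) :- a) refl ℚ.∣ p ∣ ℚ.∣ q ∣ ℚ.∣ p ℚ.- q ∣)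
    (diff-nonNeg (subst (λ t → ℚ.∣ t ∣ ℚ.≤ ℚ.∣ p ℚ.- q ∣ ℚ.+ ℚ.∣ q ∣)
      (solve 2 (λ p q → (p :- q) :+ q := p) refl p q) (ℚ.∣p+q∣≤∣p∣+∣q∣ (p ℚ.- q) q)))

∣-∣-between : ∀ {l h p q} → l ℚ.≤ p → p ℚ.≤ h → l ℚ.≤ q → q ℚ.≤ h → ℚ.∣ p ℚ.- q ∣ ℚ.≤ h ℚ.- l
∣-∣-between {l} {h} {p} {q} l≤p p≤h l≤q q≤h = ∣-∣-bound
  (≤-by-diff (solve 4 (λ l h p q → (h :- l) :- (p :- q) := (h :- p) :+ (q :- l)) refl l h p q)
    (+-nonNeg (diff-nonNeg p≤h) (diff-nonNeg l≤q)))
  (≤-by-diff (solve 4 (λ l h p q → (h :- l) :- (:- (p :- q)) := (h :- q) :+ (p :- l)) refl l h p q)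
    (+-nonNeg (diff-nonNeg q≤h) (diff-nonNeg l≤p)))

-- The inverse is extended by the junk value inv 0 = 0.
inv : ℚ → ℚ
inv q with q ℚ.≟ 0ℚ
... | yes _  = 0ℚ
... | no q≢0 = ℚ.1/_ q {{ℚ.≢-nonZero q≢0}}

*-inv : ∀ {q} → 0ℚ ℚ.< q → q ℚ.* inv q ≡ 1ℚ
*-inv {q} 0<q with q ℚ.≟ 0ℚ
... | yes q≡0 = contradiction (sym q≡0) (ℚ.<⇒≢ 0<q)
... | no  q≢0 = ℚ.*-inverseʳ q {{ℚ.≢-nonZero q≢0}}

inv-pos : ∀ {q} → 0ℚ ℚ.< q → 0ℚ ℚ.< inv q
inv-pos {q} 0<q = pos-cancelʳ
  (subst (0ℚ ℚ.<_) (trans (sym (*-inv 0<q)) (ℚ.*-comm q (inv q))) 0<1) (ℚ.<⇒≤ 0<q)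

inv-upper : ∀ {p q} → 0ℚ ℚ.< q → 1ℚ ℚ.≤ q ℚ.* p → inv q ℚ.≤ p
inv-upper {p} {q} 0<q h = *-cancelˡ 0<q (subst (ℚ._≤ q ℚ.* p) (sym (*-inv 0<q)) h)

inv-lower : ∀ {p q} → 0ℚ ℚ.< q → q ℚ.* p ℚ.≤ 1ℚ → p ℚ.≤ inv q
inv-lower {p} {q} 0<q h = *-cancelˡ 0<q (subst (q ℚ.* p ℚ.≤_) (sym (*-inv 0<q)) h)

-- Recursive, so that `nat (suc n)` unfolds to the shape `con 1ℚ :+ k` handled by the ring solver;
-- `/1≡nat` links it to `fromℕ`.
nat : ℕ → ℚ
nat zero    = 0ℚ
nat (suc n) = 1ℚ ℚ.+ nat n

2ℚ 4ℚ 8ℚ 9ℚ : ℚ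
2ℚ = nat 2
4ℚ = nat 4
8ℚ = nat 8
9ℚ = nat 9

nat-nonNeg : ∀ n → 0ℚ ℚ.≤ nat n
nat-nonNeg zero    = ℚ.≤-refl
nat-nonNeg (suc n) = +-nonNeg 0≤1 (nat-nonNeg n)

nat-pos : ∀ n → 0ℚ ℚ.< nat (suc n)
nat-pos n = +-pos 0<1 (nat-nonNeg n)

1≤nat-suc : ∀ n → 1ℚ ℚ.≤ nat (suc n)
1≤nat-suc n = ≤-by-diff (solve 1 (λ k → (con 1ℚ :+ k) :- con 1ℚ := k) refl (nat n)) (nat-nonNeg n)

nat-+ : ∀ m n → nat (m ℕ.+ n) ≡ nat m ℚ.+ nat n
nat-+ zero    n = sym (ℚ.+-identityˡ (nat n))
nat-+ (suc m) n = trans (cong (1ℚ ℚ.+_) (nat-+ m n)) (sym (ℚ.+-assoc 1ℚ (nat m) (nat n)))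

nat-mono : ∀ {m n} → m ℕ.≤ n → nat m ℚ.≤ nat n
nat-mono {n = n} ℕ.z≤n   = nat-nonNeg n
nat-mono     (ℕ.s≤s m≤n) = ℚ.+-monoʳ-≤ 1ℚ (nat-mono m≤n)

integer/1 : ∀ z → z ℚ./ 1 ≡ ℚ.mkℚ z 0 (Coprime.sym (Coprime.1-coprimeTo ℤ.∣ z ∣))
integer/1 z = ℚ.↥p/↧p≡p (ℚ.mkℚ z 0 (Coprime.sym (Coprime.1-coprimeTo ℤ.∣ z ∣)))

/1≡nat : ∀ n → (ℤ.+ n) ℚ./ 1 ≡ nat n
/1≡nat zero    = refl
/1≡nat (suc n) = sym (trans (cong (1ℚ ℚ.+_) (trans (sym (/1≡nat n)) (integer/1 (ℤ.+ n))))
  (ℚ./-cong {q₁ = 1} {q₂ = 1} (cong (λ z → ℤ.1ℤ ℤ.+ z) (ℤ.*-identityʳ (ℤ.+ n))) refl))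

archimedean : ∀ q → ∃ λ N → q ℚ.≤ nat N
archimedean q@(ℚ.mkℚ n d _) = ℤ.∣ n ∣ , subst (q ℚ.≤_)
  (trans (sym (integer/1 (ℤ.+ ℤ.∣ n ∣))) (/1≡nat ℤ.∣ n ∣))
  (ℚ.*≤* (bound n))
  where
  bound : ∀ n → n ℤ.* ℤ.1ℤ ℤ.≤ (ℤ.+ ℤ.∣ n ∣) ℤ.* (ℤ.+ suc d)
  bound (ℤ.+ m) = subst₂ ℤ._≤_ (ℤ.pos-* m 1) (ℤ.pos-* m (suc d))
    (ℤ.+≤+ (ℕ.*-monoʳ-≤ m (ℕ.s≤s ℕ.z≤n)))
  bound ℤ.-[1+ m ] = ℤ.-≤+

pow : ℚ → ℕ → ℚ
pow q zero    = 1ℚ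
pow q (suc k) = q ℚ.* pow q k

pow-pos : ∀ {q} → 0ℚ ℚ.< q → ∀ k → 0ℚ ℚ.< pow q k
pow-pos 0<q zero    = 0<1
pow-pos 0<q (suc k) = *-pos 0<q (pow-pos 0<q k)

2^ ½^ : ℕ → ℚ
2^ = pow 2ℚ
½^ = pow ½

2^-pos : ∀ i → 0ℚ ℚ.< 2^ i
2^-pos = pow-pos (nat-pos 1)

½^-pos : ∀ i → 0ℚ ℚ.< ½^ i
½^-pos = pow-pos (ℚ.positive⁻¹ ½)

2^*½^ : ∀ i → 2^ i ℚ.* ½^ i ≡ 1ℚ
2^*½^ zero    = refl
2^*½^ (suc i) = trans
  (solve 2 (λ a b → (con 2ℚ :* a) :* (con ½ :* b) := a :* b) refl (2^ i) (½^ i)) (2^*½^ i)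

1≤2^ : ∀ i → 1ℚ ℚ.≤ 2^ i
1≤2^ zero    = ℚ.≤-refl
1≤2^ (suc i) = ≤-by-diff (solve 1 (λ a → con 2ℚ :* a :- con 1ℚ := (a :- con 1ℚ) :+ a) refl (2^ i))
  (+-nonNeg (diff-nonNeg (1≤2^ i)) (ℚ.<⇒≤ (2^-pos i)))

1+i≤2^i : ∀ i → nat (suc i) ℚ.≤ 2^ i
1+i≤2^i zero    = ℚ.≤-refl
1+i≤2^i (suc i) = ≤-by-diff
  (solve 2 (λ a n → con 2ℚ :* a :- (con 1ℚ :+ n) := (a :- n) :+ (a :- con 1ℚ)) refl (2^ i) (nat (suc i)))
  (+-nonNeg (diff-nonNeg (1+i≤2^i i)) (diff-nonNeg (1≤2^ i)))

½^≤1 : ∀ i → ½^ i ℚ.≤ 1ℚ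
½^≤1 i = subst (½^ i ℚ.≤_) (2^*½^ i)
  (subst (ℚ._≤ 2^ i ℚ.* ½^ i) (ℚ.*-identityˡ (½^ i)) (*-monoˡ (ℚ.<⇒≤ (½^-pos i)) (1≤2^ i)))

-- Any `N ≥ C / ε` works, because `2^ n ≥ n + 1`.
½^-small : ∀ C ε → 0ℚ ℚ.< ε → ∃ λ N → ∀ n → N ℕ.≤ n → C ℚ.* ½^ n ℚ.< ε
½^-small C ε 0<ε = N , λ n N≤n → begin-strict
  C ℚ.* ½^ n
    ≤⟨ *-monoˡ (ℚ.<⇒≤ (½^-pos n)) C≤εN ⟩
  (ε ℚ.* nat N) ℚ.* ½^ n
    <⟨ <-by-diff (solve 3 (λ e n h → e :* (con 1ℚ :+ n) :* h :- e :* n :* h := e :* h) refl ε (nat N) (½^ n))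
         (*-pos 0<ε (½^-pos n)) ⟩
  (ε ℚ.* nat (suc N)) ℚ.* ½^ n
    ≤⟨ *-monoˡ (ℚ.<⇒≤ (½^-pos n)) (*-monoʳ (ℚ.<⇒≤ 0<ε)
         (ℚ.≤-trans (nat-mono (ℕ.s≤s N≤n)) (1+i≤2^i n))) ⟩
  (ε ℚ.* 2^ n) ℚ.* ½^ n
    ≡⟨ trans (ℚ.*-assoc ε (2^ n) (½^ n)) (trans (cong (ε ℚ.*_) (2^*½^ n)) (ℚ.*-identityʳ ε)) ⟩
  ε ∎
  where
  open ℚ.≤-Reasoning
  N = proj₁ (archimedean (inv ε ℚ.* C))
  C≤εN : C ℚ.≤ ε ℚ.* nat N
  C≤εN = subst (ℚ._≤ ε ℚ.* nat N)
    (trans (sym (ℚ.*-assoc ε (inv ε) C)) (trans (cong (ℚ._* C) (*-inv 0<ε)) (ℚ.*-identityˡ C)))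
    (*-monoʳ (ℚ.<⇒≤ 0<ε) (proj₂ (archimedean (inv ε ℚ.* C))))

-- Matching polynomials of vertex lists

-- `Pick u T S` means that `T` is `S` with one occurrence of `u` deleted and the order kept.
-- Deletion of a vertex becomes a relation on which one can recurse.
data Pick {A : Set} : A → List A → List A → Set where
  here  : ∀ {x xs} → Pick x xs (x ∷ xs)
  there : ∀ {x y xs ys} → Pick y ys xs → Pick y (x ∷ ys) (x ∷ xs)

module _ {A : Set} where

  pick-↭ : ∀ {u : A} {T S} → Pick u T S → S ↭ u ∷ T
  pick-↭ here      = refl
  pick-↭ {u} (there {x} p) = ↭-trans (prep x (pick-↭ p)) (swap x u refl)

  pick-length : ∀ {u : A} {T S} → Pick u T S → length S ≡ suc (length T)
  pick-length p = ↭-length (pick-↭ p)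

  ∈⇒pick : ∀ {u : A} {S} → u ∈ S → ∃ λ T → Pick u T S
  ∈⇒pick (here refl) = _ , here
  ∈⇒pick (there u∈S) = _ , there (proj₂ (∈⇒pick u∈S))

  pick⇒∈ : ∀ {u : A} {T S} → Pick u T S → u ∈ S
  pick⇒∈ p = ∈-resp-↭ (↭-sym (pick-↭ p)) (here refl)

  pick-∈ : ∀ {u x : A} {T S} → Pick u T S → x ∈ S → x ≢ u → x ∈ T
  pick-∈ p x∈S x≢u with ∈-resp-↭ (pick-↭ p) x∈S
  ... | here x≡u  = contradiction x≡u x≢u
  ... | there x∈T = x∈T

  -- The shape of the sum in the vertex recurrence `μ(G) = x μ(G − v) − Σ_{u ~ v} μ(G − v − u)`: a
  -- summand may depend on the chosen element and on what remains.
  Σpick : (A → List A → ℚ) → List A → ℚ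
  Σpick f []       = 0ℚ
  Σpick f (x ∷ xs) = f x xs ℚ.+ Σpick (λ y ys → f y (x ∷ ys)) xs

  Σpick-cong : ∀ {f g} S → (∀ {u T} → Pick u T S → f u T ≡ g u T) → Σpick f S ≡ Σpick g S
  Σpick-cong []      eq = refl
  Σpick-cong (x ∷ S) eq = cong₂ ℚ._+_ (eq here) (Σpick-cong S (eq ∘ there))

  Σpick-+ : ∀ f g S → Σpick (λ u T → f u T ℚ.+ g u T) S ≡ Σpick f S ℚ.+ Σpick g S
  Σpick-+ f g []      = refl
  Σpick-+ f g (x ∷ S) = trans (cong (f x S ℚ.+ g x S ℚ.+_) (Σpick-+ _ _ S))
    (solve 4 (λ a b c d → (a :+ b) :+ (c :+ d) := (a :+ c) :+ (b :+ d)) refl (f x S) (g x S) _ _)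

  Σpick-* : ∀ c f S → Σpick (λ u T → c ℚ.* f u T) S ≡ c ℚ.* Σpick f S
  Σpick-* c f []      = sym (ℚ.*-zeroʳ c)
  Σpick-* c f (x ∷ S) = trans (cong (c ℚ.* f x S ℚ.+_) (Σpick-* c _ S))
    (sym (ℚ.*-distribˡ-+ c (f x S) _))

  Σpick-mono : ∀ {f g} S → (∀ {u T} → Pick u T S → f u T ℚ.≤ g u T) → Σpick f S ℚ.≤ Σpick g S
  Σpick-mono []      le = ℚ.≤-refl
  Σpick-mono (x ∷ S) le = ℚ.+-mono-≤ (le here) (Σpick-mono S (le ∘ there))

  Σpick-nonNeg : ∀ {f} S → (∀ {u T} → Pick u T S → 0ℚ ℚ.≤ f u T) → 0ℚ ℚ.≤ Σpick f S
  Σpick-nonNeg []      le = ℚ.≤-refl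
  Σpick-nonNeg (x ∷ S) le = +-nonNeg (le here) (Σpick-nonNeg S (le ∘ there))

  Σpick-≥term : ∀ {f u T S} → (∀ {u T} → Pick u T S → 0ℚ ℚ.≤ f u T) → Pick u T S → f u T ℚ.≤ Σpick f S
  Σpick-≥term {f} le (here {x} {xs}) = subst (ℚ._≤ Σpick f (x ∷ xs)) (ℚ.+-identityʳ (f x xs))
    (ℚ.+-monoʳ-≤ (f x xs) (Σpick-nonNeg xs (le ∘ there)))
  Σpick-≥term {f} le (there {x} {u} {xs} {T} p) = subst (ℚ._≤ Σpick f (x ∷ xs)) (ℚ.+-identityˡ (f u (x ∷ T)))
    (ℚ.+-mono-≤ (le here) (Σpick-≥term (le ∘ there) p))

  Σpick-≤length : ∀ {f c} S → (∀ {u T} → Pick u T S → f u T ℚ.≤ c) → Σpick f S ℚ.≤ nat (length S) ℚ.* c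
  Σpick-≤length {c = c} []      le = ℚ.≤-reflexive (sym (ℚ.*-zeroˡ c))
  Σpick-≤length {f} {c} (x ∷ S) le = subst (Σpick f (x ∷ S) ℚ.≤_)
    (solve 2 (λ n c → c :+ n :* c := (con 1ℚ :+ n) :* c) refl (nat (length S)) c)
    (ℚ.+-mono-≤ (le here) (Σpick-≤length S (le ∘ there)))

  Σpick-abs : ∀ {f c} S → (∀ {u T} → Pick u T S → ℚ.∣ f u T ∣ ℚ.≤ c) →
    ℚ.∣ Σpick f S ∣ ℚ.≤ nat (length S) ℚ.* c
  Σpick-abs {c = c} []      le = ℚ.≤-reflexive (sym (ℚ.*-zeroˡ c))
  Σpick-abs {f} {c} (x ∷ S) le = ℚ.≤-trans (ℚ.∣p+q∣≤∣p∣+∣q∣ (f x S) _) (subst (ℚ.∣ f x S ∣ ℚ.+ ℚ.∣ Σpick (λ u T → f u (x ∷ T)) S ∣ ℚ.≤_)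
    (solve 2 (λ n c → c :+ n :* c := (con 1ℚ :+ n) :* c) refl (nat (length S)) c)
    (ℚ.+-mono-≤ (le here) (Σpick-abs S (le ∘ there))))

  -- Both sides run over ordered pairs of distinct positions. In the induction, the pairs with the
  -- head in first place on one side meet those with it in second place on the other.
  Σpick-swap : ∀ (F : A → A → List A → ℚ) S →
    Σpick (λ u T → Σpick (λ v R → F u v R) T) S ≡ Σpick (λ u T → Σpick (λ v R → F v u R) T) S
  Σpick-swap F []      = refl
  Σpick-swap F (x ∷ S) = begin
    Σpick (F x) S ℚ.+ Σpick (λ u T → F u x T ℚ.+ Σpick (λ v R → F u v (x ∷ R)) T) S
      ≡⟨ cong (Σpick (F x) S ℚ.+_) (Σpick-+ _ _ S) ⟩
    Σpick (F x) S ℚ.+ (Σpick (λ u T → F u x T) S ℚ.+ Σpick (λ u T → Σpick (λ v R → F u v (x ∷ R)) T) S)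
      ≡⟨ cong (λ z → Σpick (F x) S ℚ.+ (Σpick (λ u T → F u x T) S ℚ.+ z)) (Σpick-swap (λ u v R → F u v (x ∷ R)) S) ⟩
    Σpick (F x) S ℚ.+ (Σpick (λ u T → F u x T) S ℚ.+ Σpick (λ u T → Σpick (λ v R → F v u (x ∷ R)) T) S)
      ≡⟨ solve 3 (λ a b c → a :+ (b :+ c) := b :+ (a :+ c)) refl (Σpick (F x) S) (Σpick (λ u T → F u x T) S) _ ⟩
    Σpick (λ u T → F u x T) S ℚ.+ (Σpick (F x) S ℚ.+ Σpick (λ u T → Σpick (λ v R → F v u (x ∷ R)) T) S)
      ≡⟨ cong (Σpick (λ u T → F u x T) S ℚ.+_) (sym (Σpick-+ _ _ S)) ⟩
    Σpick (λ u T → F u x T) S ℚ.+ Σpick (λ u T → F x u T ℚ.+ Σpick (λ v R → F v u (x ∷ R)) T) S ∎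
    where open ≡-Reasoning

  -- Invariance of `f` is asked only on lists shorter than `m`: in the application `f` contains `Φ`
  -- of the remaining list, whose invariance is itself being proved by induction on length.
  Σpick-↭ : ∀ m {f S S′} → length S ℕ.≤ m →
    (∀ u {T T′} → length T ℕ.< m → T ↭ T′ → f u T ≡ f u T′) → S ↭ S′ → Σpick f S ≡ Σpick f S′
  Σpick-↭ m l resp refl = refl
  Σpick-↭ (suc m) (ℕ.s≤s l) resp (prep x p) = cong₂ ℚ._+_ (resp x (ℕ.s≤s l) p)
    (Σpick-↭ m l (λ u l′ q → resp u (ℕ.s≤s l′) (prep x q)) p)
  Σpick-↭ (suc (suc m)) {f} (ℕ.s≤s (ℕ.s≤s l)) resp (swap {S} {S′} x y p) = begin
    f x (y ∷ S) ℚ.+ (f y (x ∷ S) ℚ.+ Σpick (λ u T → f u (x ∷ y ∷ T)) S)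
      ≡⟨ cong₂ ℚ._+_ (resp x (ℕ.s≤s (ℕ.s≤s l)) (prep y p)) (cong₂ ℚ._+_ (resp y (ℕ.s≤s (ℕ.s≤s l)) (prep x p)) rest) ⟩
    f x (y ∷ S′) ℚ.+ (f y (x ∷ S′) ℚ.+ Σpick (λ u T → f u (y ∷ x ∷ T)) S′)
      ≡⟨ solve 3 (λ a b c → a :+ (b :+ c) := b :+ (a :+ c)) refl (f x (y ∷ S′)) (f y (x ∷ S′)) _ ⟩
    f y (x ∷ S′) ℚ.+ (f x (y ∷ S′) ℚ.+ Σpick (λ u T → f u (y ∷ x ∷ T)) S′) ∎
    where
    open ≡-Reasoning
    rest : Σpick (λ u T → f u (x ∷ y ∷ T)) S ≡ Σpick (λ u T → f u (y ∷ x ∷ T)) S′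
    rest = trans
      (Σpick-cong S λ {u} pk → resp u
        (ℕ.s≤s (ℕ.s≤s (ℕ.≤-trans (ℕ.≤-reflexive (sym (pick-length pk))) l)))
        (swap x y refl))
      (Σpick-↭ m l (λ u l′ q → resp u (ℕ.s≤s (ℕ.s≤s l′)) (prep y (prep x q))) p)
  Σpick-↭ m l resp (↭-trans p q) = trans (Σpick-↭ m l resp p)
    (Σpick-↭ m (ℕ.≤-trans (ℕ.≤-reflexive (sym (↭-length p))) l) resp q)

module MatchingPolynomial {A : Set} (w : A → A → ℚ) where

  -- The first argument is fuel; at least length S of it is needed.
  Φ′ : ℕ → ℚ → List A → ℚ
  Φ′ _       x []      = 1ℚ
  Φ′ zero    x (_ ∷ _) = 0ℚ
  Φ′ (suc k) x (v ∷ S) = x ℚ.* Φ′ k x S ℚ.- Σpick (λ u T → w v u ℚ.* Φ′ k x T) S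

  -- The matching polynomial with edge weights `w`, expanded at the head vertex, which is either
  -- unmatched or matched to some later `u`.
  Φ : ℚ → List A → ℚ
  Φ x S = Φ′ (length S) x S

  Φ′-fuel : ∀ k l x S → length S ℕ.≤ k → length S ℕ.≤ l → Φ′ k x S ≡ Φ′ l x S
  Φ′-fuel k       l       x []      _           _           = refl
  Φ′-fuel (suc k) (suc l) x (v ∷ S) (ℕ.s≤s S≤k) (ℕ.s≤s S≤l) = cong₂ (λ a b → x ℚ.* a ℚ.- b)
    (Φ′-fuel k l x S S≤k S≤l)
    (Σpick-cong S λ {u} {T} p → cong (w v u ℚ.*_)
      (Φ′-fuel k l x T (ℕ.≤-trans (smaller p) S≤k) (ℕ.≤-trans (smaller p) S≤l)))
    where
    smaller : ∀ {u T} → Pick u T S → length T ℕ.≤ length S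
    smaller p = ℕ.≤-trans (ℕ.n≤1+n _) (ℕ.≤-reflexive (sym (pick-length p)))

  Φ-∷ : ∀ x v S → Φ x (v ∷ S) ≡ x ℚ.* Φ x S ℚ.- Σpick (λ u T → w v u ℚ.* Φ x T) S
  Φ-∷ x v S = cong (λ z → x ℚ.* Φ x S ℚ.- z) (Σpick-cong S λ {u} {T} p → cong (w v u ℚ.*_)
    (Φ′-fuel (length S) (length T) x T
      (ℕ.≤-trans (ℕ.n≤1+n _) (ℕ.≤-reflexive (sym (pick-length p)))) ℕ.≤-refl))

  -- Two expansions make the symmetry in `v` and `u` visible: apart from `w v u` and the double sum
  -- over ordered pairs, exchanging the two vertices only permutes the summands.
  Φ-∷∷ : ∀ x v u S → Φ x (v ∷ u ∷ S) ≡
    (((x ℚ.* (x ℚ.* Φ x S) ℚ.- w v u ℚ.* Φ x S)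
      ℚ.- x ℚ.* Σpick (λ a T → w v a ℚ.* Φ x T) S) ℚ.- x ℚ.* Σpick (λ a T → w u a ℚ.* Φ x T) S)
      ℚ.+ Σpick (λ a T → Σpick (λ b R → (w v a ℚ.* w u b) ℚ.* Φ x R) T) S
  Φ-∷∷ x v u S = begin
    Φ x (v ∷ u ∷ S)
      ≡⟨ Φ-∷ x v (u ∷ S) ⟩
    x ℚ.* Φ x (u ∷ S) ℚ.- (w v u ℚ.* Φ x S ℚ.+ Σpick (λ a T → w v a ℚ.* Φ x (u ∷ T)) S)
      ≡⟨ cong₂ (λ y z → x ℚ.* y ℚ.- (w v u ℚ.* Φ x S ℚ.+ z)) (Φ-∷ x u S) inner ⟩
    x ℚ.* (x ℚ.* Φ x S ℚ.- D) ℚ.- (w v u ℚ.* Φ x S ℚ.+ (x ℚ.* C ℚ.+ (ℚ.- 1ℚ) ℚ.* E))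
      ≡⟨ solve 6 (λ x p c d e q → x :* (x :* p :- d) :- (q :* p :+ (x :* c :+ (:- con 1ℚ) :* e))
           := (((x :* (x :* p) :- q :* p) :- x :* c) :- x :* d) :+ e) refl x (Φ x S) C D E (w v u) ⟩
    (((x ℚ.* (x ℚ.* Φ x S) ℚ.- w v u ℚ.* Φ x S) ℚ.- x ℚ.* C) ℚ.- x ℚ.* D) ℚ.+ E ∎
    where
    open ≡-Reasoning
    C = Σpick (λ a T → w v a ℚ.* Φ x T) S
    D = Σpick (λ a T → w u a ℚ.* Φ x T) S
    E = Σpick (λ a T → Σpick (λ b R → (w v a ℚ.* w u b) ℚ.* Φ x R) T) S
    term : ∀ a T → w v a ℚ.* Φ x (u ∷ T) ≡
      x ℚ.* (w v a ℚ.* Φ x T) ℚ.+ (ℚ.- 1ℚ) ℚ.* Σpick (λ b R → (w v a ℚ.* w u b) ℚ.* Φ x R) T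
    term a T = trans (cong (w v a ℚ.*_) (Φ-∷ x u T)) (trans
      (solve 4 (λ c x p s → c :* (x :* p :- s) := x :* (c :* p) :+ (:- con 1ℚ) :* (c :* s))
        refl (w v a) x (Φ x T) (Σpick (λ b R → w u b ℚ.* Φ x R) T))
      (cong (λ z → x ℚ.* (w v a ℚ.* Φ x T) ℚ.+ (ℚ.- 1ℚ) ℚ.* z)
        (trans (sym (Σpick-* (w v a) _ T)) (Σpick-cong T λ {b} {R} _ → sym (ℚ.*-assoc (w v a) (w u b) (Φ x R))))))
    inner : Σpick (λ a T → w v a ℚ.* Φ x (u ∷ T)) S ≡ x ℚ.* C ℚ.+ (ℚ.- 1ℚ) ℚ.* E
    inner = trans (Σpick-cong S λ {a} {T} _ → term a T) (trans (Σpick-+ _ _ S)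
      (cong₂ ℚ._+_ (Σpick-* x _ S) (Σpick-* (ℚ.- 1ℚ) _ S)))

  module _ (w-sym : ∀ u v → w u v ≡ w v u) where

    Φ-swap : ∀ x v u S → Φ x (v ∷ u ∷ S) ≡ Φ x (u ∷ v ∷ S)
    Φ-swap x v u S = begin
      Φ x (v ∷ u ∷ S)
        ≡⟨ Φ-∷∷ x v u S ⟩
      (((x ℚ.* (x ℚ.* Φ x S) ℚ.- w v u ℚ.* Φ x S) ℚ.- x ℚ.* C) ℚ.- x ℚ.* D) ℚ.+ E v u
        ≡⟨ cong₂ (λ y z → (((x ℚ.* (x ℚ.* Φ x S) ℚ.- y ℚ.* Φ x S) ℚ.- x ℚ.* C) ℚ.- x ℚ.* D) ℚ.+ z) (w-sym v u) E-swap ⟩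
      (((x ℚ.* (x ℚ.* Φ x S) ℚ.- w u v ℚ.* Φ x S) ℚ.- x ℚ.* C) ℚ.- x ℚ.* D) ℚ.+ E u v
        ≡⟨ solve 4 (λ a c d e → ((a :- c) :- d) :+ e := ((a :- d) :- c) :+ e) refl
             (x ℚ.* (x ℚ.* Φ x S) ℚ.- w u v ℚ.* Φ x S) (x ℚ.* C) (x ℚ.* D) (E u v) ⟩
      (((x ℚ.* (x ℚ.* Φ x S) ℚ.- w u v ℚ.* Φ x S) ℚ.- x ℚ.* D) ℚ.- x ℚ.* C) ℚ.+ E u v
        ≡⟨ sym (Φ-∷∷ x u v S) ⟩
      Φ x (u ∷ v ∷ S) ∎
      where
      open ≡-Reasoning
      C = Σpick (λ a T → w v a ℚ.* Φ x T) S
      D = Σpick (λ a T → w u a ℚ.* Φ x T) S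
      E : A → A → ℚ
      E v u = Σpick (λ a T → Σpick (λ b R → (w v a ℚ.* w u b) ℚ.* Φ x R) T) S
      E-swap : E v u ≡ E u v
      E-swap = trans (Σpick-swap (λ a b R → (w v a ℚ.* w u b) ℚ.* Φ x R) S)
        (Σpick-cong S λ {a} {T} _ → Σpick-cong T λ {b} {R} _ → cong (ℚ._* Φ x R) (ℚ.*-comm (w v b) (w u a)))

    -- The recursion is on `m` for `prep` and `swap`, since the expansion there asks for invariance
    -- under arbitrary permutations of the remaining lists, and on the derivation for `↭-trans`.
    Φ-↭′ : ∀ m x {S S′} → length S ℕ.≤ m → S ↭ S′ → Φ x S ≡ Φ x S′
    Φ-∷-↭ : ∀ m x v {S S′} → length S ℕ.≤ m → S ↭ S′ → Φ x (v ∷ S) ≡ Φ x (v ∷ S′)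

    Φ-∷-↭ m x v {S} {S′} l p = begin
      Φ x (v ∷ S)
        ≡⟨ Φ-∷ x v S ⟩
      x ℚ.* Φ x S ℚ.- Σpick (λ u T → w v u ℚ.* Φ x T) S
        ≡⟨ cong₂ (λ a b → x ℚ.* a ℚ.- b) (Φ-↭′ m x l p)
             (Σpick-↭ m l (λ u l′ q → cong (w v u ℚ.*_) (Φ-↭′ m x (ℕ.<⇒≤ l′) q)) p) ⟩
      x ℚ.* Φ x S′ ℚ.- Σpick (λ u T → w v u ℚ.* Φ x T) S′
        ≡⟨ sym (Φ-∷ x v S′) ⟩
      Φ x (v ∷ S′) ∎
      where open ≡-Reasoning

    Φ-↭′ m x l refl = refl
    Φ-↭′ (suc m) x (ℕ.s≤s l) (prep v p) = Φ-∷-↭ m x v l p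
    Φ-↭′ (suc (suc m)) x (ℕ.s≤s (ℕ.s≤s l)) (swap {S} {S′} v u p) =
      trans (Φ-swap x v u S) (Φ-∷-↭ (suc m) x u (ℕ.s≤s l) (prep v p))
    Φ-↭′ m x l (↭-trans p q) = trans (Φ-↭′ m x l p)
      (Φ-↭′ m x (ℕ.≤-trans (ℕ.≤-reflexive (sym (↭-length p))) l) q)

    Φ-↭ : ∀ x {S S′} → S ↭ S′ → Φ x S ≡ Φ x S′
    Φ-↭ x {S} = Φ-↭′ (length S) x ℕ.≤-refl

-- The matching polynomial as a sum over sublists of edges

-- Only the sizes of the matchings enter, so adding one edge to all of them is the shift `g ∘ suc`.
total : ∀ {B : Set} → (ℕ → ℚ) → List (List B) → ℚ
total g []       = 0ℚ
total g (M ∷ Ms) = g (length M) ℚ.+ total g Ms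

module _ {B : Set} where

  total-++ : ∀ g (Ms Ns : List (List B)) → total g (Ms ++ Ns) ≡ total g Ms ℚ.+ total g Ns
  total-++ g []       Ns = sym (ℚ.+-identityˡ (total g Ns))
  total-++ g (M ∷ Ms) Ns = trans (cong (g (length M) ℚ.+_) (total-++ g Ms Ns))
    (sym (ℚ.+-assoc (g (length M)) (total g Ms) (total g Ns)))

  total-map-∷ : ∀ g (e : B) Ms → total g (map (e ∷_) Ms) ≡ total (g ∘ suc) Ms
  total-map-∷ g e []       = refl
  total-map-∷ g e (M ∷ Ms) = cong (g (suc (length M)) ℚ.+_) (total-map-∷ g e Ms)

  total-cong : ∀ {g h} → (∀ i → g i ≡ h i) → (Ms : List (List B)) → total g Ms ≡ total h Ms
  total-cong eq []       = refl
  total-cong eq (M ∷ Ms) = cong₂ ℚ._+_ (eq (length M)) (total-cong eq Ms)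

  total-* : ∀ c g (Ms : List (List B)) → total (λ i → c ℚ.* g i) Ms ≡ c ℚ.* total g Ms
  total-* c g []       = sym (ℚ.*-zeroʳ c)
  total-* c g (M ∷ Ms) = trans (cong (c ℚ.* g (length M) ℚ.+_) (total-* c g Ms))
    (sym (ℚ.*-distribˡ-+ c (g (length M)) (total g Ms)))

  filter-map-∷-none : ∀ {P : B → Set} (P? : Decidable P) {a} → ¬ P a → ∀ X →
    filter (All.all? P?) (map (a ∷_) X) ≡ []
  filter-map-∷-none P? {a} ¬Pa X = List.filter-none (All.all? P?)
    (All.map⁺ (All.universal (λ _ ps → ¬Pa (All.head ps)) X))

  filter-map-∷-all : ∀ {P : B → Set} (P? : Decidable P) {a} → P a → ∀ X →
    filter (All.all? P?) (map (a ∷_) X) ≡ map (a ∷_) (filter (All.all? P?) X)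
  filter-map-∷-all P? Pa []      = refl
  filter-map-∷-all P? {a} Pa (M ∷ X) = by-cases (All.all? P? M)
    where
    by-cases : Dec (All _ M) → filter (All.all? P?) (map (a ∷_) (M ∷ X)) ≡ map (a ∷_) (filter (All.all? P?) (M ∷ X))
    by-cases (yes ps) = trans (List.filter-accept (All.all? P?) (Pa ∷ ps))
      (trans (cong ((a ∷ M) ∷_) (filter-map-∷-all P? Pa X))
        (cong (map (a ∷_)) (sym (List.filter-accept (All.all? P?) ps))))
    by-cases (no ¬ps) = trans (List.filter-reject (All.all? P?) (¬ps ∘ All.tail))
      (trans (filter-map-∷-all P? Pa X) (cong (map (a ∷_)) (sym (List.filter-reject (All.all? P?) ¬ps))))

  sublists-filter : ∀ {P : B → Set} (P? : Decidable P) xs →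
    filter (All.all? P?) (sublists xs) ≡ sublists (filter P? xs)
  sublists-filter P? []       = refl
  sublists-filter P? (x ∷ xs) with P? x
  ... | yes Px = trans (List.filter-++ (All.all? P?) (sublists xs) _)
    (cong₂ _++_ (sublists-filter P? xs)
      (trans (filter-map-∷-all P? Px (sublists xs)) (cong (map (x ∷_)) (sublists-filter P? xs))))
  ... | no ¬Px = trans (List.filter-++ (All.all? P?) (sublists xs) _)
    (trans (cong₂ _++_ (sublists-filter P? xs) (filter-map-∷-none P? ¬Px (sublists xs)))
      (List.++-identityʳ (sublists (filter P? xs))))

matchingWeight : ℕ → ℚ → ℕ → ℚ
matchingWeight k q i = pow (ℚ.- 1ℚ) i ℚ.* pow q (k ℕ.∸ 2 ℕ.* i)

matchingWeight-suc : ∀ k q i → matchingWeight (2 ℕ.+ k) q (suc i) ≡ (ℚ.- 1ℚ) ℚ.* matchingWeight k q i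
matchingWeight-suc k q i rewrite ℕ.+-suc i (i ℕ.+ 0) =
  ℚ.*-assoc (ℚ.- 1ℚ) (pow (ℚ.- 1ℚ) i) (pow q (k ℕ.∸ 2 ℕ.* i))

module _ {n : ℕ} where

  matchingsOf : List (Edge n) → List (List (Edge n))
  matchingsOf E = filter (allPairs? disjointEdges?) (sublists E)

  filter-allPairs-∷ : ∀ e (X : List (List (Edge n))) →
    filter (allPairs? disjointEdges?) (map (e ∷_) X) ≡
    map (e ∷_) (filter (allPairs? disjointEdges?) (filter (All.all? (disjointEdges? e)) X))
  filter-allPairs-∷ e []      = refl
  filter-allPairs-∷ e (M ∷ X) = by-cases (All.all? (disjointEdges? e) M) (allPairs? disjointEdges? M)
    where
    M? = allPairs? (disjointEdges? {n})
    D? = All.all? (disjointEdges? e)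
    by-cases : Dec (All (DisjointEdges e) M) → Dec (AllPairs DisjointEdges M) →
      filter M? (map (e ∷_) (M ∷ X)) ≡ map (e ∷_) (filter M? (filter D? (M ∷ X)))
    by-cases (no ¬d) _ = trans (List.filter-reject M? (¬d ∘ AllPairs.head))
      (trans (filter-allPairs-∷ e X) (cong (map (e ∷_) ∘ filter M?) (sym (List.filter-reject D? ¬d))))
    by-cases (yes d) (no ¬ds) = trans (List.filter-reject M? (¬ds ∘ AllPairs.tail))
      (trans (filter-allPairs-∷ e X) (cong (map (e ∷_))
        (sym (trans (cong (filter M?) (List.filter-accept D? d)) (List.filter-reject M? ¬ds)))))
    by-cases (yes d) (yes ds) = trans (List.filter-accept M? (d ∷ ds))
      (trans (cong ((e ∷ M) ∷_) (filter-allPairs-∷ e X)) (cong (map (e ∷_))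
        (sym (trans (cong (filter M?) (List.filter-accept D? d)) (List.filter-accept M? ds)))))

  matchingsOf-∷ : ∀ e E → matchingsOf (e ∷ E) ≡ matchingsOf E ++ map (e ∷_) (matchingsOf (filter (disjointEdges? e) E))
  matchingsOf-∷ e E = trans (List.filter-++ (allPairs? disjointEdges?) (sublists E) _)
    (cong (matchingsOf E ++_) (trans (filter-allPairs-∷ e (sublists E))
      (cong (map (e ∷_) ∘ filter (allPairs? disjointEdges?)) (sublists-filter (disjointEdges? e) E))))

  weight : (ℕ → ℚ) → List (Edge n) → ℚ
  weight g E = total g (matchingsOf E)

  -- The edge recurrence `μ(G) = μ(G − e) − μ(G − both ends of e)`, with sign and exponent hidden in
  -- `g`.
  weight-∷ : ∀ g e E → weight g (e ∷ E) ≡ weight g E ℚ.+ weight (g ∘ suc) (filter (disjointEdges? e) E)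
  weight-∷ g e E = trans (cong (total g) (matchingsOf-∷ e E)) (trans (total-++ g (matchingsOf E) _)
    (cong (weight g E ℚ.+_) (total-map-∷ g e (matchingsOf (filter (disjointEdges? e) E)))))

  Σlist : (Fin n → ℚ) → List (Fin n) → ℚ
  Σlist F []       = 0ℚ
  Σlist F (u ∷ us) = F u ℚ.+ Σlist F us

  -- Edges at `v` meet pairwise, so a matching contains at most one of them. Iterating the edge
  -- recurrence along the star turns it into the vertex recurrence.
  weight-star : ∀ g v us E → weight g (map (v ,_) us ++ E) ≡
    weight g E ℚ.+ Σlist (λ u → weight (g ∘ suc) (filter (disjointEdges? (v , u)) E)) us
  weight-star g v []       E = sym (ℚ.+-identityʳ (weight g E))
  weight-star g v (u ∷ us) E = begin
    weight g ((v , u) ∷ map (v ,_) us ++ E)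
      ≡⟨ weight-∷ g (v , u) (map (v ,_) us ++ E) ⟩
    weight g (map (v ,_) us ++ E) ℚ.+ weight (g ∘ suc) (filter (disjointEdges? (v , u)) (map (v ,_) us ++ E))
      ≡⟨ cong₂ (λ a b → a ℚ.+ weight (g ∘ suc) b) (weight-star g v us E)
           (trans (List.filter-++ (disjointEdges? (v , u)) (map (v ,_) us) E)
             (cong (_++ filter (disjointEdges? (v , u)) E)
               (List.filter-none (disjointEdges? (v , u))
                 (All.map⁺ (All.universal (λ _ d → proj₁ (proj₁ d) refl) us))))) ⟩
    (weight g E ℚ.+ rest) ℚ.+ first
      ≡⟨ solve 3 (λ a b c → (a :+ b) :+ c := a :+ (c :+ b)) refl (weight g E) rest first ⟩
    weight g E ℚ.+ (first ℚ.+ rest) ∎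
    where
    open ≡-Reasoning
    F : Fin n → ℚ
    F u = weight (g ∘ suc) (filter (disjointEdges? (v , u)) E)
    first = F u
    rest  = Σlist F us

-- The matching polynomial of a graph through the vertex recurrence

module GraphPolynomial {n : ℕ} (G : Graph n) where

  open Graph G

  adjacency : Fin n → Fin n → ℚ
  adjacency v u = if does (adj? v u) then 1ℚ else 0ℚ

  adjacency-1 : ∀ {v u} → Adj v u → adjacency v u ≡ 1ℚ
  adjacency-1 {v} {u} a with adj? v u
  ... | yes _ = refl
  ... | no ¬a = contradiction a ¬a

  adjacency-nonNeg : ∀ v u → 0ℚ ℚ.≤ adjacency v u
  adjacency-nonNeg v u with adj? v u
  ... | yes _ = 0≤1
  ... | no _  = ℚ.≤-refl

  adjacency-≤1 : ∀ v u → adjacency v u ℚ.≤ 1ℚ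
  adjacency-≤1 v u with adj? v u
  ... | yes _ = ℚ.≤-refl
  ... | no _  = 0≤1

  adjacency-sym : ∀ v u → adjacency v u ≡ adjacency u v
  adjacency-sym v u with adj? v u | adj? u v
  ... | yes _ | yes _ = refl
  ... | no _  | no _  = refl
  ... | yes a | no ¬a = contradiction (symm a) ¬a
  ... | no ¬a | yes a = contradiction (symm a) ¬a

  open MatchingPolynomial adjacency public

  -- Edges are grouped by the endpoint that comes first in the list, which puts the star of the head
  -- vertex in front, as `weight-star` expects.
  edgesOf : List (Fin n) → List (Edge n)
  edgesOf []      = []
  edgesOf (v ∷ S) = map (v ,_) (filter (adj? v) S) ++ edgesOf S

  edgesOf-All : ∀ {P : Fin n → Set} {S} → All P S → All (λ (a , b) → P a × P b) (edgesOf S)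
  edgesOf-All []        = []
  edgesOf-All {S = v ∷ S} (p ∷ ps) = All.++⁺ (All.map⁺ (All.map (p ,_) (All.filter⁺ (adj? v) ps))) (edgesOf-All ps)

  filter-star : ∀ {v u a T S} → Pick u T S → Unique S → All (v ≢_) S → a ≢ v → a ≢ u →
    filter (disjointEdges? (v , u)) (map (a ,_) (filter (adj? a) S)) ≡ map (a ,_) (filter (adj? a) T)
  filter-star {v} {u} {a} {T} here (u∉T ∷ _) (_ ∷ v∉T) a≢v a≢u with adj? a u
  ... | no _  = List.filter-all (disjointEdges? (v , u)) (All.map⁺ (All.filter⁺ (adj? a)
        (All.zipWith (λ (v≢b , u≢b) → (a≢v ∘ sym , v≢b) , (a≢u ∘ sym , u≢b)) (v∉T , u∉T))))
  ... | yes _ = trans (List.filter-reject (disjointEdges? (v , u)) (λ d → proj₂ (proj₂ d) refl))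
      (List.filter-all (disjointEdges? (v , u)) (All.map⁺ (All.filter⁺ (adj? a)
        (All.zipWith (λ (v≢b , u≢b) → (a≢v ∘ sym , v≢b) , (a≢u ∘ sym , u≢b)) (v∉T , u∉T)))))
  filter-star {v} {u} {a} (there {b} p) (b∉S ∷ S!) (v≢b ∷ v∉S) a≢v a≢u with adj? a b
  ... | no _  = filter-star p S! v∉S a≢v a≢u
  ... | yes _ = trans (List.filter-accept (disjointEdges? (v , u))
        ((a≢v ∘ sym , v≢b) , (a≢u ∘ sym , λ u≡b → All.lookup b∉S (pick⇒∈ p) (sym u≡b))))
      (cong ((a , b) ∷_) (filter-star p S! v∉S a≢v a≢u))

  filter-edgesOf : ∀ {v u T S} → Pick u T S → Unique S → All (v ≢_) S →
    filter (disjointEdges? (v , u)) (edgesOf S) ≡ edgesOf T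
  filter-edgesOf {v} {u} {T} here (u∉T ∷ _) (v≢u ∷ v∉T) = trans
    (List.filter-++ (disjointEdges? (v , u)) (map (u ,_) (filter (adj? u) T)) (edgesOf T))
    (cong₂ _++_
      (List.filter-none (disjointEdges? (v , u))
        (All.map⁺ (All.universal (λ _ d → proj₁ (proj₂ d) refl) (filter (adj? u) T))))
      (List.filter-all (disjointEdges? (v , u))
        (All.zipWith id (edgesOf-All v∉T , edgesOf-All u∉T))))
  filter-edgesOf {v} {u} (there {a} {xs = S} p) (a∉S ∷ S!) (v≢a ∷ v∉S) = trans
    (List.filter-++ (disjointEdges? (v , u)) (map (a ,_) (filter (adj? a) S)) (edgesOf S))
    (cong₂ _++_ (filter-star p S! v∉S (v≢a ∘ sym) (All.lookup a∉S (pick⇒∈ p))) (filter-edgesOf p S! v∉S))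

  Σlist-adjacent : ∀ F v S → Σlist F (filter (adj? v) S) ≡ Σpick (λ u _ → adjacency v u ℚ.* F u) S
  Σlist-adjacent F v []      = refl
  Σlist-adjacent F v (u ∷ S) with adj? v u
  ... | yes _ = cong₂ ℚ._+_ (sym (ℚ.*-identityˡ (F u))) (Σlist-adjacent F v S)
  ... | no _  = trans (Σlist-adjacent F v S) (trans (sym (ℚ.+-identityˡ _))
    (cong (ℚ._+ Σpick (λ u _ → adjacency v u ℚ.* F u) S) (sym (ℚ.*-zeroˡ (F u)))))

  -- The spare power x ^ a absorbs the isolated vertices left behind by
  -- deletions, so that truncated subtraction never matters.
  weight-edgesOf : ∀ m a x S → length S ℕ.≤ m → Unique S →
    weight (matchingWeight (a ℕ.+ length S) x) (edgesOf S) ≡ pow x a ℚ.* Φ x S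
  weight-edgesOf m a x [] _ _ rewrite ℕ.+-identityʳ a =
    solve 1 (λ p → con 1ℚ :* p :+ con 0ℚ := p :* con 1ℚ) refl (pow x a)
  weight-edgesOf (suc m) a x (v ∷ S) (ℕ.s≤s l) (v∉S ∷ S!) = begin
    weight g (map (v ,_) (filter (adj? v) S) ++ edgesOf S)
      ≡⟨ weight-star g v (filter (adj? v) S) (edgesOf S) ⟩
    weight g (edgesOf S) ℚ.+ Σlist F (filter (adj? v) S)
      ≡⟨ cong₂ ℚ._+_ deleted (trans (Σlist-adjacent F v S) matched) ⟩
    (x ℚ.* pow x a) ℚ.* Φ x S ℚ.+ (ℚ.- pow x a) ℚ.* Σpick (λ u T → adjacency v u ℚ.* Φ x T) S
      ≡⟨ solve 4 (λ x p f s → (x :* p) :* f :+ (:- p) :* s := p :* (x :* f :- s)) refl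
           x (pow x a) (Φ x S) (Σpick (λ u T → adjacency v u ℚ.* Φ x T) S) ⟩
    pow x a ℚ.* (x ℚ.* Φ x S ℚ.- Σpick (λ u T → adjacency v u ℚ.* Φ x T) S)
      ≡⟨ cong (pow x a ℚ.*_) (sym (Φ-∷ x v S)) ⟩
    pow x a ℚ.* Φ x (v ∷ S) ∎
    where
    open ≡-Reasoning
    g = matchingWeight (a ℕ.+ suc (length S)) x
    F : Fin n → ℚ
    F u = weight (g ∘ suc) (filter (disjointEdges? (v , u)) (edgesOf S))
    deleted : weight g (edgesOf S) ≡ (x ℚ.* pow x a) ℚ.* Φ x S
    deleted = trans (cong (λ k → weight (matchingWeight k x) (edgesOf S)) (ℕ.+-suc a (length S)))
      (weight-edgesOf m (suc a) x S l S!)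
    unique-pick : ∀ {u T S} → Pick u T S → Unique S → Unique T
    unique-pick here      (_ ∷ T!)   = T!
    unique-pick (there p) (b∉S ∷ S!) = All.tabulate (λ {c} c∈T → All.lookup b∉S (∈-resp-↭ (↭-sym (pick-↭ p)) (there c∈T)))
      ∷ unique-pick p S!
    vertices : ∀ {u T} → Pick u T S → a ℕ.+ suc (length S) ≡ 2 ℕ.+ (a ℕ.+ length T)
    vertices {T = T} p = trans (cong (λ k → a ℕ.+ suc k) (pick-length p))
      (trans (ℕ.+-suc a (suc (length T))) (cong suc (ℕ.+-suc a (length T))))
    F-pick : ∀ {u T} → Pick u T S → F u ≡ (ℚ.- 1ℚ) ℚ.* (pow x a ℚ.* Φ x T)
    F-pick {u} {T} p = begin
      weight (g ∘ suc) (filter (disjointEdges? (v , u)) (edgesOf S))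
        ≡⟨ cong (weight (g ∘ suc)) (filter-edgesOf p S! v∉S) ⟩
      weight (g ∘ suc) (edgesOf T)
        ≡⟨ total-cong (λ i → trans (cong (λ k → matchingWeight k x (suc i)) (vertices p))
             (matchingWeight-suc (a ℕ.+ length T) x i)) (matchingsOf (edgesOf T)) ⟩
      weight (λ i → (ℚ.- 1ℚ) ℚ.* matchingWeight (a ℕ.+ length T) x i) (edgesOf T)
        ≡⟨ total-* (ℚ.- 1ℚ) (matchingWeight (a ℕ.+ length T) x) (matchingsOf (edgesOf T)) ⟩
      (ℚ.- 1ℚ) ℚ.* weight (matchingWeight (a ℕ.+ length T) x) (edgesOf T)
        ≡⟨ cong ((ℚ.- 1ℚ) ℚ.*_) (weight-edgesOf m a x T
             (ℕ.≤-trans (ℕ.≤-trans (ℕ.n≤1+n _) (ℕ.≤-reflexive (sym (pick-length p)))) l) (unique-pick p S!)) ⟩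
      (ℚ.- 1ℚ) ℚ.* (pow x a ℚ.* Φ x T) ∎
    matched : Σpick (λ u _ → adjacency v u ℚ.* F u) S ≡ (ℚ.- pow x a) ℚ.* Σpick (λ u T → adjacency v u ℚ.* Φ x T) S
    matched = trans (Σpick-cong S λ {u} {T} p → trans (cong (adjacency v u ℚ.*_) (F-pick p))
        (solve 3 (λ c p f → c :* ((:- con 1ℚ) :* (p :* f)) := (:- p) :* (c :* f)) refl (adjacency v u) (pow x a) (Φ x T)))
      (Σpick-* (ℚ.- pow x a) _ S)

  -- Recursion consumes the first factor of the product and leaves the second whole. `pre` collects
  -- the vertices already passed; they lie below all remaining ones and so contribute no pair.
  filter-increasing : ∀ pre S → All (λ b → All (b Fin.<_) S) pre → AllPairs Fin._<_ S →
    filter (λ (u , v) → (u Fin.<? v) ×-dec adj? u v) (cartesianProduct S (pre ++ S)) ≡ edgesOf S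
  filter-increasing pre []      _   _          = refl
  filter-increasing pre (a ∷ S) pre< (a< ∷ S<) = trans
    (List.filter-++ E? (map (a ,_) (pre ++ a ∷ S)) (cartesianProduct S (pre ++ a ∷ S)))
    (cong₂ _++_ star rest)
    where
    E? : Decidable (λ ((u , v) : Edge n) → u Fin.< v × Adj u v)
    E? (u , v) = (u Fin.<? v) ×-dec adj? u v
    later : ∀ T → All (a Fin.<_) T → filter E? (map (a ,_) T) ≡ map (a ,_) (filter (adj? a) T)
    later []      []         = refl
    later (b ∷ T) (a<b ∷ a<) = by-cases (adj? a b)
      where
      by-cases : Dec (Adj a b) → filter E? (map (a ,_) (b ∷ T)) ≡ map (a ,_) (filter (adj? a) (b ∷ T))
      by-cases (yes ab) = trans (List.filter-accept E? (a<b , ab))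
        (trans (cong ((a , b) ∷_) (later T a<)) (cong (map (a ,_)) (sym (List.filter-accept (adj? a) ab))))
      by-cases (no ¬ab) = trans (List.filter-reject E? (¬ab ∘ proj₂))
        (trans (later T a<) (cong (map (a ,_)) (sym (List.filter-reject (adj? a) ¬ab))))
    star : filter E? (map (a ,_) (pre ++ a ∷ S)) ≡ map (a ,_) (filter (adj? a) S)
    star = begin
      filter E? (map (a ,_) (pre ++ a ∷ S))
        ≡⟨ cong (filter E?) (List.map-++ (a ,_) pre (a ∷ S)) ⟩
      filter E? (map (a ,_) pre ++ (a , a) ∷ map (a ,_) S)
        ≡⟨ List.filter-++ E? (map (a ,_) pre) _ ⟩
      filter E? (map (a ,_) pre) ++ filter E? ((a , a) ∷ map (a ,_) S)
        ≡⟨ cong₂ _++_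
             (List.filter-none E? (All.map⁺ (All.map (λ b< (a<b , _) → Fin.<-asym a<b (All.head b<)) pre<)))
             (List.filter-reject E? {a , a} {map (a ,_) S} (λ (a<a , _) → Fin.<-irrefl {x = a} refl a<a)) ⟩
      filter E? (map (a ,_) S)
        ≡⟨ later S a< ⟩
      map (a ,_) (filter (adj? a) S) ∎
      where open ≡-Reasoning
    rest : filter E? (cartesianProduct S (pre ++ a ∷ S)) ≡ edgesOf S
    rest = trans (cong (filter E? ∘ cartesianProduct S) (sym (List.++-assoc pre (a ∷ []) S)))
      (filter-increasing (pre ++ a ∷ []) S (All.++⁺ (All.map All.tail pre<) (a< ∷ [])) S<)

  edges≡edgesOf : edges G ≡ edgesOf (allFin n)
  edges≡edgesOf = filter-increasing [] (allFin n) [] (AllPairs.tabulate⁺-< id)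

  seq-^ : ∀ y k j → seq (y ^ k) j ≡ pow (seq y j) k
  seq-^ y zero    j = refl
  seq-^ y (suc k) j = cong (seq y j ℚ.*_) (seq-^ y k j)

  seq-sum : ∀ y j Ms → seq (sum (map (matchingTerm {n} y) Ms)) j ≡ total (matchingWeight n (seq y j)) Ms
  seq-sum y j []       = refl
  seq-sum y j (M ∷ Ms) = cong₂ ℚ._+_
    (cong₂ ℚ._*_ (seq-^ (- 1ℝ) (length M) j) (seq-^ y (n ℕ.∸ 2 ℕ.* length M) j))
    (seq-sum y j Ms)

  -- The bridge from reals to rationals: sums and products of reals act on each term separately, so
  -- the identity is exact at every index and needs no limit.
  seq-matchingPolynomial : ∀ y j → seq (matchingPolynomial G y) j ≡ Φ (seq y j) (allFin n)
  seq-matchingPolynomial y j = begin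
    seq (matchingPolynomial G y) j
      ≡⟨ seq-sum y j (matchings G) ⟩
    weight (matchingWeight n x) (edges G)
      ≡⟨ cong₂ (λ k E → weight (matchingWeight k x) E) (sym (List.length-tabulate id)) edges≡edgesOf ⟩
    weight (matchingWeight (length (allFin n)) x) (edgesOf (allFin n))
      ≡⟨ weight-edgesOf (length (allFin n)) 0 x (allFin n) ℕ.≤-refl (allFin⁺ n) ⟩
    1ℚ ℚ.* Φ x (allFin n)
      ≡⟨ ℚ.*-identityˡ _ ⟩
    Φ x (allFin n) ∎
    where
    open ≡-Reasoning
    x = seq y j

-- Positivity beyond the largest root

module Positivity {n : ℕ} (G : Graph n) where

  open Graph G
  open GraphPolynomial G public

  Φ-perm : ∀ x {S T} → S ↭ T → Φ x S ≡ Φ x T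
  Φ-perm = Φ-↭ adjacency-sym

  -- Up to reordering, `T` runs over the vertex sets of the induced subgraphs within `S`, and `R`
  -- holds the deleted vertices. `Failing` is the opposite in a form that carries a witness.
  Positive : ℚ → List (Fin n) → Set
  Positive x S = ∀ R T → S ↭ R ++ T → 0ℚ ℚ.< Φ x T

  Failing : ℚ → List (Fin n) → Set
  Failing x S = ∃ λ R → ∃ λ T → S ↭ R ++ T × Φ x T ℚ.≤ 0ℚ

  positive-self : ∀ {x S} → Positive x S → 0ℚ ℚ.< Φ x S
  positive-self {S = S} pos = pos [] S refl

  positive-tail : ∀ {x u S T} → S ↭ u ∷ T → Positive x S → Positive x T
  positive-tail {u = u} p pos R T q = pos (u ∷ R) T (↭-trans p (prep u q))

  positive-∷ : ∀ {x S} → 0ℚ ℚ.< Φ x S → (∀ {u T} → Pick u T S → Positive x T) → Positive x S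
  positive-∷ {x} {S} 0<Φ picks []      T p = subst (0ℚ ℚ.<_) (Φ-perm x p) 0<Φ
  positive-∷ {x} {S} 0<Φ picks (u ∷ R) T p = picks pk R T (drop-∷ (↭-trans (↭-sym (pick-↭ pk)) p))
    where pk = proj₂ (∈⇒pick (∈-resp-↭ (↭-sym p) (here refl)))

  failing-∷ : ∀ {x u S T} → S ↭ u ∷ T → Failing x T → Failing x S
  failing-∷ {u = u} p (R , T , q , le) = u ∷ R , T , ↭-trans p (prep u q) , le

  all-or-some : ∀ {P Q : List (Fin n) → Set} S → (∀ {u T} → Pick u T S → P T ⊎ Q T) →
    (∀ {u T} → Pick u T S → P T) ⊎ (∃ λ u → ∃ λ T → Pick u T S × Q T)
  all-or-some []      dec = inj₁ λ ()
  all-or-some {P} {Q} (x ∷ S) dec with dec here | all-or-some {P ∘ (x ∷_)} {Q ∘ (x ∷_)} S (dec ∘ there)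
  ... | inj₂ q | _                     = inj₂ (x , S , here , q)
  ... | inj₁ _ | inj₂ (u , T , pk , q) = inj₂ (u , x ∷ T , there pk , q)
  ... | inj₁ p | inj₁ ps               = inj₁ λ { here → p ; (there pk) → ps pk }

  -- Signs of rationals are decidable, and every proper induced subgraph starts with the deletion of
  -- one vertex. This dichotomy lets the bisection choose a half.
  positive-or-failing′ : ∀ m x S → length S ℕ.≤ m → Positive x S ⊎ Failing x S
  positive-or-failing′ m x S l with ℚ.<-cmp 0ℚ (Φ x S) | all-or-some S (smaller m l)
    where
    smaller : ∀ m → length S ℕ.≤ m → ∀ {u T} → Pick u T S → Positive x T ⊎ Failing x T
    smaller (suc m) l {T = T} pk = positive-or-failing′ m x T
      (ℕ.s≤s⁻¹ (ℕ.≤-trans (ℕ.≤-reflexive (sym (pick-length pk))) l))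
    smaller zero l pk = contradiction (ℕ.≤-trans (ℕ.≤-reflexive (sym (pick-length pk))) l) λ ()
  ... | tri≈ _ e _ | _ = inj₂ ([] , S , refl , ℚ.≤-reflexive (sym e))
  ... | tri> _ _ g | _ = inj₂ ([] , S , refl , ℚ.<⇒≤ g)
  ... | tri< 0<Φ _ _ | inj₁ all = inj₁ (positive-∷ 0<Φ all)
  ... | tri< _ _ _ | inj₂ (u , T , pk , fail) = inj₂ (failing-∷ (pick-↭ pk) fail)

  abstract
    positive-or-failing : ∀ x S → Positive x S ⊎ Failing x S
    positive-or-failing x S = positive-or-failing′ (length S) x S ℕ.≤-refl

  not-both : ∀ {x S} → Positive x S → ¬ Failing x S
  not-both pos (R , T , p , le) = <⇒≱ (pos R T p) le

  -- By induction each of the `length T` summands in the expansion at `u` is at most `Φ x T`, so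
  -- `Φ x (u ∷ T) ≥ (x − length T) Φ x T`, and `x ≥ length T + 1`. Monotonicity is carried along for
  -- every deleted vertex because this step uses it for all of them.
  growth : ∀ m x S → length S ℕ.≤ m → nat m ℚ.≤ x →
    0ℚ ℚ.< Φ x S × (∀ {u T} → Pick u T S → Φ x T ℚ.≤ Φ x S)
  growth m x [] _ _ = 0<1 , λ ()
  growth (suc m) x (v ∷ S) (ℕ.s≤s l) m≤x =
    ℚ.<-≤-trans (proj₁ (growth m x S l m≤x′)) (step here) , step
    where
    m≤x′ : nat m ℚ.≤ x
    m≤x′ = ℚ.≤-trans (nat-mono (ℕ.n≤1+n m)) m≤x
    step : ∀ {u T} → Pick u T (v ∷ S) → Φ x T ℚ.≤ Φ x (v ∷ S)
    step {u} {T} pk = subst (Φ x T ℚ.≤_) (sym (trans (Φ-perm x (pick-↭ pk)) (Φ-∷ x u T)))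
      (≤-by-diff
        (solve 4 (λ x p s k → (x :* p :- s) :- p := (x :- (con 1ℚ :+ k)) :* p :+ (k :* p :- s)) refl
          x (Φ x T) (Σpick (λ a R → adjacency u a ℚ.* Φ x R) T) (nat (length T)))
        (+-nonNeg
          (*-nonNeg (diff-nonNeg (ℚ.≤-trans (nat-mono (ℕ.s≤s l′)) m≤x)) (ℚ.<⇒≤ (proj₁ IH)))
          (diff-nonNeg (Σpick-≤length T λ {a} {R} pk′ → ℚ.≤-trans
            (*-mono (adjacency-nonNeg u a) (ℚ.<⇒≤ (proj₁ IH)) (adjacency-≤1 u a) (proj₂ IH pk′))
            (ℚ.≤-reflexive (ℚ.*-identityˡ (Φ x T)))))))
      where
      l′ : length T ℕ.≤ m
      l′ = ℕ.≤-trans (ℕ.≤-reflexive (sym (ℕ.suc-injective (pick-length pk)))) l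
      IH = growth m x T l′ m≤x′

  positive-large : ∀ x S → nat (length S) ℚ.≤ x → Positive x S
  positive-large x S S≤x R T p = proj₁ (growth (length S) x T
    (ℕ.≤-trans (ℕ.m≤n+m (length T) (length R)) (ℕ.≤-reflexive
      (trans (sym (List.length-++ R)) (sym (↭-length p))))) S≤x)

  adjacency-* : ∀ v u {p c} → ℚ.∣ p ∣ ℚ.≤ c → ℚ.∣ adjacency v u ℚ.* p ∣ ℚ.≤ c
  adjacency-* v u {p} {c} le = ℚ.≤-trans (ℚ.≤-reflexive (trans (ℚ.∣p*q∣≡∣p∣*∣q∣ (adjacency v u) p)
      (cong (ℚ._* ℚ.∣ p ∣) (ℚ.0≤p⇒∣p∣≡p (adjacency-nonNeg v u)))))
    (ℚ.≤-trans (*-monoˡ (ℚ.0≤∣p∣ p) (adjacency-≤1 v u)) (subst (ℚ._≤ c) (sym (ℚ.*-identityˡ ℚ.∣ p ∣)) le))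

-- Bounds and Lipschitz constants on an interval

module Interval {n : ℕ} (G : Graph n) (B : ℚ) (0≤B : 0ℚ ℚ.≤ B) where

  open Positivity G

  -- Uniform over lists of length at most `m` and arguments in `[0 , B]`. Both recurrences are read
  -- off from the expansion at the head; the added 1 in `bound` covers the empty list.
  bound lipschitz : ℕ → ℚ
  bound zero    = 1ℚ
  bound (suc m) = 1ℚ ℚ.+ (B ℚ.+ nat m) ℚ.* bound m
  lipschitz zero    = 0ℚ
  lipschitz (suc m) = bound m ℚ.+ (B ℚ.+ nat m) ℚ.* lipschitz m

  bound-nonNeg : ∀ m → 0ℚ ℚ.≤ bound m
  bound-nonNeg zero    = 0≤1
  bound-nonNeg (suc m) = +-nonNeg 0≤1 (*-nonNeg (+-nonNeg 0≤B (nat-nonNeg m)) (bound-nonNeg m))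

  lipschitz-nonNeg : ∀ m → 0ℚ ℚ.≤ lipschitz m
  lipschitz-nonNeg zero    = ℚ.≤-refl
  lipschitz-nonNeg (suc m) = +-nonNeg (bound-nonNeg m) (*-nonNeg (+-nonNeg 0≤B (nat-nonNeg m)) (lipschitz-nonNeg m))

  picked : ∀ {m u T} (S : List (Fin n)) → length S ℕ.≤ m → Pick u T S → length T ℕ.≤ m
  picked S l pk = ℕ.≤-trans (ℕ.n≤1+n _) (ℕ.≤-trans (ℕ.≤-reflexive (sym (pick-length pk))) l)

  Φ-bound : ∀ m x S → length S ℕ.≤ m → 0ℚ ℚ.≤ x → x ℚ.≤ B → ℚ.∣ Φ x S ∣ ℚ.≤ bound m
  Φ-bound zero    x [] _ _ _ = ℚ.≤-refl
  Φ-bound (suc m) x [] _ _ _ = ≤-by-diff (solve 1 (λ p → (con 1ℚ :+ p) :- con 1ℚ := p) refl _)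
    (*-nonNeg (+-nonNeg 0≤B (nat-nonNeg m)) (bound-nonNeg m))
  Φ-bound (suc m) x (v ∷ S) (ℕ.s≤s l) 0≤x x≤B = begin
    ℚ.∣ Φ x (v ∷ S) ∣
      ≡⟨ cong ℚ.∣_∣ (Φ-∷ x v S) ⟩
    ℚ.∣ x ℚ.* Φ x S ℚ.- s ∣
      ≤⟨ ℚ.∣p-q∣≤∣p∣+∣q∣ (x ℚ.* Φ x S) s ⟩
    ℚ.∣ x ℚ.* Φ x S ∣ ℚ.+ ℚ.∣ s ∣
      ≤⟨ ℚ.+-mono-≤
           (subst (ℚ._≤ B ℚ.* bound m) (sym (trans (ℚ.∣p*q∣≡∣p∣*∣q∣ x (Φ x S)) (cong (ℚ._* ℚ.∣ Φ x S ∣) (ℚ.0≤p⇒∣p∣≡p 0≤x))))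
             (*-mono 0≤x (bound-nonNeg m) x≤B (Φ-bound m x S l 0≤x x≤B)))
           (Σpick-abs S λ {u} {T} pk → adjacency-* v u (Φ-bound m x T (picked S l pk) 0≤x x≤B)) ⟩
    B ℚ.* bound m ℚ.+ nat (length S) ℚ.* bound m
      ≤⟨ ℚ.+-monoʳ-≤ (B ℚ.* bound m) (*-monoˡ (bound-nonNeg m) (nat-mono l)) ⟩
    B ℚ.* bound m ℚ.+ nat m ℚ.* bound m
      ≤⟨ ≤-by-diff (solve 3 (λ b k c → (con 1ℚ :+ (b :+ k) :* c) :- (b :* c :+ k :* c) := con 1ℚ) refl B (nat m) (bound m)) 0≤1 ⟩
    bound (suc m) ∎
    where
    open ℚ.≤-Reasoning
    s = Σpick (λ u T → adjacency v u ℚ.* Φ x T) S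

  Φ-lipschitz : ∀ m a b S → length S ℕ.≤ m → 0ℚ ℚ.≤ a → a ℚ.≤ b → b ℚ.≤ B →
    ℚ.∣ Φ b S ℚ.- Φ a S ∣ ℚ.≤ lipschitz m ℚ.* (b ℚ.- a)
  Φ-lipschitz m a b [] _ _ a≤b _ = *-nonNeg (lipschitz-nonNeg m) (diff-nonNeg a≤b)
  Φ-lipschitz (suc m) a b (v ∷ S) (ℕ.s≤s l) 0≤a a≤b b≤B = begin
    ℚ.∣ Φ b (v ∷ S) ℚ.- Φ a (v ∷ S) ∣
      ≡⟨ cong ℚ.∣_∣ split ⟩
    ℚ.∣ (b ℚ.* (Φ b S ℚ.- Φ a S) ℚ.+ (b ℚ.- a) ℚ.* Φ a S) ℚ.- s ∣
      ≤⟨ ℚ.≤-trans (ℚ.∣p-q∣≤∣p∣+∣q∣ (b ℚ.* (Φ b S ℚ.- Φ a S) ℚ.+ (b ℚ.- a) ℚ.* Φ a S) s) (ℚ.+-monoˡ-≤ ℚ.∣ s ∣ (ℚ.∣p+q∣≤∣p∣+∣q∣ (b ℚ.* (Φ b S ℚ.- Φ a S)) ((b ℚ.- a) ℚ.* Φ a S))) ⟩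
    (ℚ.∣ b ℚ.* (Φ b S ℚ.- Φ a S) ∣ ℚ.+ ℚ.∣ (b ℚ.- a) ℚ.* Φ a S ∣) ℚ.+ ℚ.∣ s ∣
      ≤⟨ ℚ.+-mono-≤ (ℚ.+-mono-≤
           (subst (ℚ._≤ B ℚ.* (L ℚ.* δ)) (sym (trans (ℚ.∣p*q∣≡∣p∣*∣q∣ b _) (cong (ℚ._* ℚ.∣ Φ b S ℚ.- Φ a S ∣) (ℚ.0≤p⇒∣p∣≡p 0≤b))))
             (*-mono 0≤b 0≤Lδ b≤B (Φ-lipschitz m a b S l 0≤a a≤b b≤B)))
           (subst (ℚ._≤ δ ℚ.* bound m) (sym (trans (ℚ.∣p*q∣≡∣p∣*∣q∣ δ (Φ a S)) (cong (ℚ._* ℚ.∣ Φ a S ∣) (ℚ.0≤p⇒∣p∣≡p 0≤δ))))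
             (*-monoʳ 0≤δ (Φ-bound m a S l 0≤a (ℚ.≤-trans a≤b b≤B)))))
           (ℚ.≤-trans
             (Σpick-abs S λ {u} {T} pk → adjacency-* v u (Φ-lipschitz m a b T (picked S l pk) 0≤a a≤b b≤B))
             (*-monoˡ 0≤Lδ (nat-mono l))) ⟩
    (B ℚ.* (L ℚ.* δ) ℚ.+ δ ℚ.* bound m) ℚ.+ nat m ℚ.* (L ℚ.* δ)
      ≡⟨ solve 5 (λ b l d k c → (b :* (l :* d) :+ d :* c) :+ k :* (l :* d) := (c :+ (b :+ k) :* l) :* d) refl B L δ (nat m) (bound m) ⟩
    lipschitz (suc m) ℚ.* δ ∎
    where
    open ℚ.≤-Reasoning
    L = lipschitz m
    δ = b ℚ.- a
    s = Σpick (λ u T → adjacency v u ℚ.* (Φ b T ℚ.- Φ a T)) S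
    0≤b : 0ℚ ℚ.≤ b
    0≤b = ℚ.≤-trans 0≤a a≤b
    0≤δ : 0ℚ ℚ.≤ δ
    0≤δ = diff-nonNeg a≤b
    0≤Lδ : 0ℚ ℚ.≤ L ℚ.* δ
    0≤Lδ = *-nonNeg (lipschitz-nonNeg m) 0≤δ
    s-split : s ≡ Σpick (λ u T → adjacency v u ℚ.* Φ b T) S ℚ.+ (ℚ.- 1ℚ) ℚ.* Σpick (λ u T → adjacency v u ℚ.* Φ a T) S
    s-split = trans (Σpick-cong S λ {u} {T} _ →
        solve 3 (λ w p q → w :* (p :- q) := w :* p :+ (:- con 1ℚ) :* (w :* q)) refl (adjacency v u) (Φ b T) (Φ a T))
      (trans (Σpick-+ _ _ S) (cong (Σpick (λ u T → adjacency v u ℚ.* Φ b T) S ℚ.+_) (Σpick-* (ℚ.- 1ℚ) _ S)))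
    split : Φ b (v ∷ S) ℚ.- Φ a (v ∷ S) ≡ (b ℚ.* (Φ b S ℚ.- Φ a S) ℚ.+ (b ℚ.- a) ℚ.* Φ a S) ℚ.- s
    split = trans (cong₂ ℚ._-_ (Φ-∷ b v S) (Φ-∷ a v S)) (trans
      (solve 6 (λ a b p q s t → (b :* p :- s) :- (a :* q :- t) :=
        (b :* (p :- q) :+ (b :- a) :* q) :- (s :+ (:- con 1ℚ) :* t)) refl a b (Φ b S) (Φ a S)
        (Σpick (λ u T → adjacency v u ℚ.* Φ b T) S) (Σpick (λ u T → adjacency v u ℚ.* Φ a T) S))
      (cong (λ z → (b ℚ.* (Φ b S ℚ.- Φ a S) ℚ.+ (b ℚ.- a) ℚ.* Φ a S) ℚ.- z) (sym s-split)))

  -- Positivity at `b` makes the sum subtracted in each expansion nonnegative, so every added vertex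
  -- costs at most the factor `b ≤ B`.
  Φ-++ : ∀ {b c} → 0ℚ ℚ.≤ b → b ℚ.≤ B → ∀ R T → Positive b (R ++ T) → Φ b T ℚ.≤ c → Φ b (R ++ T) ℚ.≤ pow B (length R) ℚ.* c
  Φ-++ {c = c} 0≤b b≤B []      T pos le = subst (_ ℚ.≤_) (sym (ℚ.*-identityˡ c)) le
  Φ-++ {b} {c} 0≤b b≤B (u ∷ R) T pos le = begin
    Φ b (u ∷ R ++ T)
      ≡⟨ Φ-∷ b u (R ++ T) ⟩
    b ℚ.* Φ b (R ++ T) ℚ.- s
      ≤⟨ ≤-by-diff (solve 2 (λ p s → p :- (p :- s) := s) refl (b ℚ.* Φ b (R ++ T)) s)
           (Σpick-nonNeg (R ++ T) λ {a} {X} pk → *-nonNeg (adjacency-nonNeg u a)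
             (ℚ.<⇒≤ (positive-self (positive-tail (pick-↭ pk) pos′)))) ⟩
    b ℚ.* Φ b (R ++ T)
      ≤⟨ *-monoˡ (ℚ.<⇒≤ (positive-self pos′)) b≤B ⟩
    B ℚ.* Φ b (R ++ T)
      ≤⟨ *-monoʳ 0≤B (Φ-++ 0≤b b≤B R T pos′ le) ⟩
    B ℚ.* (pow B (length R) ℚ.* c)
      ≡⟨ sym (ℚ.*-assoc B (pow B (length R)) c) ⟩
    pow B (suc (length R)) ℚ.* c ∎
    where
    open ℚ.≤-Reasoning
    s = Σpick (λ a X → adjacency u a ℚ.* Φ b X) (R ++ T)
    pos′ : Positive b (R ++ T)
    pos′ = positive-tail refl pos

  pow-mono : 1ℚ ℚ.≤ B → ∀ {i j} → i ℕ.≤ j → pow B i ℚ.≤ pow B j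
  pow-mono 1≤B {j = zero}  ℕ.z≤n = ℚ.≤-refl
  pow-mono 1≤B {j = suc j} ℕ.z≤n = ℚ.≤-trans (pow-mono 1≤B {j = j} ℕ.z≤n)
    (subst (ℚ._≤ B ℚ.* pow B j) (ℚ.*-identityˡ (pow B j))
      (*-monoˡ (ℚ.<⇒≤ (pow-pos (ℚ.<-≤-trans 0<1 1≤B) j)) 1≤B))
  pow-mono 1≤B (ℕ.s≤s i≤j) = *-monoʳ 0≤B (pow-mono 1≤B i≤j)

  -- If an induced subgraph fails at a, the whole polynomial is small at b:
  -- adding a vertex multiplies it by at most b.
  Φ-small : 1ℚ ℚ.≤ B → ∀ {a b} S → 0ℚ ℚ.≤ a → a ℚ.≤ b → b ℚ.≤ B → Failing a S → Positive b S →
    Φ b S ℚ.≤ (pow B (length S) ℚ.* lipschitz (length S)) ℚ.* (b ℚ.- a)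
  Φ-small 1≤B {a} {b} S 0≤a a≤b b≤B (R , T , p , Φ≤0) pos = begin
    Φ b S
      ≡⟨ Φ-perm b p ⟩
    Φ b (R ++ T)
      ≤⟨ Φ-++ (ℚ.≤-trans 0≤a a≤b) b≤B R T (λ R′ T′ q → pos R′ T′ (↭-trans p q)) ΦT≤ ⟩
    pow B (length R) ℚ.* (lipschitz (length S) ℚ.* (b ℚ.- a))
      ≤⟨ *-monoˡ (*-nonNeg (lipschitz-nonNeg (length S)) (diff-nonNeg a≤b)) (pow-mono 1≤B R≤S) ⟩
    pow B (length S) ℚ.* (lipschitz (length S) ℚ.* (b ℚ.- a))
      ≡⟨ sym (ℚ.*-assoc (pow B (length S)) (lipschitz (length S)) (b ℚ.- a)) ⟩
    (pow B (length S) ℚ.* lipschitz (length S)) ℚ.* (b ℚ.- a) ∎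
    where
    open ℚ.≤-Reasoning
    S≡R+T : length S ≡ length R ℕ.+ length T
    S≡R+T = trans (↭-length p) (List.length-++ R)
    R≤S : length R ℕ.≤ length S
    R≤S = ℕ.≤-trans (ℕ.m≤m+n (length R) (length T)) (ℕ.≤-reflexive (sym S≡R+T))
    T≤S : length T ℕ.≤ length S
    T≤S = ℕ.≤-trans (ℕ.m≤n+m (length T) (length R)) (ℕ.≤-reflexive (sym S≡R+T))
    ΦT≤ : Φ b T ℚ.≤ lipschitz (length S) ℚ.* (b ℚ.- a)
    -- Since `Φ a T ≤ 0`, the value at `b` is at most the increment from `a` to `b`.
    ΦT≤ = ℚ.≤-trans (≤-by-diff (solve 2 (λ p q → (p :- q) :- p := :- q) refl (Φ b T) (Φ a T)) (ℚ.neg-antimono-≤ Φ≤0))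
      (ℚ.≤-trans (p≤∣p∣ (Φ b T ℚ.- Φ a T)) (Φ-lipschitz (length S) a b T T≤S 0≤a a≤b b≤B))

-- Bisection from a failing point to a root

module Bisection {n : ℕ} (G : Graph n) (V : List (Fin n)) (B : ℚ) (1≤B : 1ℚ ℚ.≤ B)
  (positive-B : ∀ {x} → B ℚ.≤ x → Positivity.Positive G x V)
  (y : ℚ) (0≤y : 0ℚ ℚ.≤ y) (failing : Positivity.Failing G y V) where

  open Positivity G

  open Interval G B (ℚ.≤-trans 0≤1 1≤B)

  -- The bisected alternative concerns all induced subgraphs at once: `Φ x V` alone may be positive
  -- at both ends. The failing subgraph may change from one bracket to the next.
  record Bracket : Set where
    field
      lo hi  : ℚ
      y≤lo   : y ℚ.≤ lo
      lo≤hi  : lo ℚ.≤ hi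
      hi≤B   : hi ℚ.≤ B
      lo-fails : Failing lo V
      hi-pos   : Positive hi V

  open Bracket

  initial : Bracket
  initial = record
    { lo = y ; hi = B ; y≤lo = ℚ.≤-refl ; hi≤B = ℚ.≤-refl ; lo-fails = failing
    ; lo≤hi  = ℚ.≮⇒≥ λ B<y → not-both (positive-B (ℚ.<⇒≤ B<y)) failing
    ; hi-pos = positive-B ℚ.≤-refl }

  mid : Bracket → ℚ
  mid b = ½ ℚ.* (lo b ℚ.+ hi b)

  lo≤mid : ∀ b → lo b ℚ.≤ mid b
  lo≤mid b = ≤-by-diff (solve 2 (λ l h → con ½ :* (l :+ h) :- l := con ½ :* (h :- l)) refl (lo b) (hi b))
    (*-nonNeg (ℚ.nonNegative⁻¹ ½) (diff-nonNeg (lo≤hi b)))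

  mid≤hi : ∀ b → mid b ℚ.≤ hi b
  mid≤hi b = ≤-by-diff (solve 2 (λ l h → h :- con ½ :* (l :+ h) := con ½ :* (h :- l)) refl (lo b) (hi b))
    (*-nonNeg (ℚ.nonNegative⁻¹ ½) (diff-nonNeg (lo≤hi b)))

  refine : ∀ b → Positive (mid b) V ⊎ Failing (mid b) V → Bracket
  refine b (inj₁ pos) = record
    { lo = lo b ; hi = mid b ; y≤lo = y≤lo b ; lo≤hi = lo≤mid b
    ; hi≤B = ℚ.≤-trans (mid≤hi b) (hi≤B b) ; lo-fails = lo-fails b ; hi-pos = pos }
  refine b (inj₂ fail) = record
    { lo = mid b ; hi = hi b ; y≤lo = ℚ.≤-trans (y≤lo b) (lo≤mid b) ; lo≤hi = mid≤hi b
    ; hi≤B = hi≤B b ; lo-fails = fail ; hi-pos = hi-pos b }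

  refine-gap : ∀ b d → hi (refine b d) ℚ.- lo (refine b d) ≡ ½ ℚ.* (hi b ℚ.- lo b)
  refine-gap b (inj₁ _) = solve 2 (λ l h → con ½ :* (l :+ h) :- l := con ½ :* (h :- l)) refl (lo b) (hi b)
  refine-gap b (inj₂ _) = solve 2 (λ l h → h :- con ½ :* (l :+ h) := con ½ :* (h :- l)) refl (lo b) (hi b)

  refine-lo : ∀ b d → lo b ℚ.≤ lo (refine b d)
  refine-lo b (inj₁ _) = ℚ.≤-refl
  refine-lo b (inj₂ _) = lo≤mid b

  refine-hi : ∀ b d → hi (refine b d) ℚ.≤ hi b
  refine-hi b (inj₁ _) = mid≤hi b
  refine-hi b (inj₂ _) = ℚ.≤-refl

  bracket : ℕ → Bracket
  decide  : ∀ i → Positive (mid (bracket i)) V ⊎ Failing (mid (bracket i)) V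
  bracket zero    = initial
  bracket (suc i) = refine (bracket i) (decide i)
  decide i = positive-or-failing (mid (bracket i)) V

  gap : ∀ i → hi (bracket i) ℚ.- lo (bracket i) ≡ (B ℚ.- y) ℚ.* ½^ i
  gap zero    = sym (ℚ.*-identityʳ (B ℚ.- y))
  gap (suc i) = trans (refine-gap (bracket i) (decide i)) (trans (cong (½ ℚ.*_) (gap i))
    (solve 2 (λ d h → con ½ :* (d :* h) := d :* (con ½ :* h)) refl (B ℚ.- y) (½^ i)))

  nested : ∀ {i j} → i ℕ.≤′ j → lo (bracket i) ℚ.≤ lo (bracket j) × hi (bracket j) ℚ.≤ hi (bracket i)
  nested (ℕ.≤′-reflexive refl) = ℚ.≤-refl , ℚ.≤-refl
  nested (ℕ.≤′-step {j} le) = ℚ.≤-trans (proj₁ (nested le)) (refine-lo (bracket j) (decide j)) ,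
    ℚ.≤-trans (refine-hi (bracket j) (decide j)) (proj₂ (nested le))

  -- The upper ends are used because `Φ` is positive there, which makes the one-sided estimate
  -- `Φ-small` a bound on the absolute value.
  root : ℝ
  root = mkℝ (hi ∘ bracket) λ ε 0<ε → proj₁ (½^-small (B ℚ.- y) ε 0<ε) , λ m k N≤m N≤k →
    let N = proj₁ (½^-small (B ℚ.- y) ε 0<ε) in
    ℚ.≤-<-trans
      (∣-∣-between (ℚ.≤-trans (proj₁ (nested (ℕ.≤⇒≤′ N≤m))) (lo≤hi (bracket m))) (proj₂ (nested (ℕ.≤⇒≤′ N≤m)))
               (ℚ.≤-trans (proj₁ (nested (ℕ.≤⇒≤′ N≤k))) (lo≤hi (bracket k))) (proj₂ (nested (ℕ.≤⇒≤′ N≤k))))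
      (subst (ℚ._< ε) (sym (gap N)) (proj₂ (½^-small (B ℚ.- y) ε 0<ε) N ℕ.≤-refl))

  y≤root : ∀ i → y ℚ.≤ seq root i
  y≤root i = ℚ.≤-trans (y≤lo (bracket i)) (lo≤hi (bracket i))

  Φ-root : ∀ ε → 0ℚ ℚ.< ε → ∃ λ N → ∀ i → N ℕ.≤ i → ℚ.∣ Φ (seq root i) V ∣ ℚ.< ε
  Φ-root ε 0<ε = proj₁ small , λ i N≤i → begin-strict
    ℚ.∣ Φ (hi (bracket i)) V ∣
      ≡⟨ ℚ.0≤p⇒∣p∣≡p (ℚ.<⇒≤ (positive-self (hi-pos (bracket i)))) ⟩
    Φ (hi (bracket i)) V
      ≤⟨ Φ-small 1≤B V (ℚ.≤-trans 0≤y (y≤lo (bracket i))) (lo≤hi (bracket i)) (hi≤B (bracket i))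
           (lo-fails (bracket i)) (hi-pos (bracket i)) ⟩
    C ℚ.* (hi (bracket i) ℚ.- lo (bracket i))
      ≡⟨ trans (cong (C ℚ.*_) (gap i)) (sym (ℚ.*-assoc C (B ℚ.- y) (½^ i))) ⟩
    (C ℚ.* (B ℚ.- y)) ℚ.* ½^ i
      <⟨ proj₂ small i N≤i ⟩
    ε ∎
    where
    open ℚ.≤-Reasoning
    C = pow B (length V) ℚ.* lipschitz (length V)
    small = ½^-small (C ℚ.* (B ℚ.- y)) ε 0<ε

  abstract
    limit : ∃ λ ρ → (∀ i → y ℚ.≤ seq ρ i) ×
      (∀ ε → 0ℚ ℚ.< ε → ∃ λ N → ∀ i → N ℕ.≤ i → ℚ.∣ Φ (seq ρ i) V ∣ ℚ.< ε)
    limit = root , y≤root , Φ-root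

≈0-intro : ∀ x → (∀ ε → 0ℚ ℚ.< ε → ∃ λ N → ∀ i → N ℕ.≤ i → ℚ.∣ seq x i ∣ ℚ.< ε) → x ≈ 0ℝ
≈0-intro x small ε 0<ε = proj₁ (small ε 0<ε) , λ i N≤i →
  subst (λ z → ℚ.∣ z ∣ ℚ.< ε) (sym (ℚ.+-identityʳ (seq x i))) (proj₂ (small ε 0<ε) i N≤i)

small⇒root : ∀ {n} (G : Graph n) ρ →
  (∀ ε → 0ℚ ℚ.< ε → ∃ λ N → ∀ i → N ℕ.≤ i → ℚ.∣ Positivity.Φ G (seq ρ i) (allFin n) ∣ ℚ.< ε) →
  matchingPolynomial G ρ ≈ 0ℝ
small⇒root G ρ small = ≈0-intro (matchingPolynomial G ρ) λ ε 0<ε → proj₁ (small ε 0<ε) , λ i N≤i →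
  subst (λ z → ℚ.∣ z ∣ ℚ.< ε) (sym (Positivity.seq-matchingPolynomial G ρ i)) (proj₂ (small ε 0<ε) i N≤i)

failing⇒root : ∀ {n} (G : Graph n) {y} → 0ℚ ℚ.≤ y → Positivity.Failing G y (allFin n) →
  ∃ λ ρ → matchingPolynomial G ρ ≈ 0ℝ × (∀ i → y ℚ.≤ seq ρ i)
failing⇒root {n} G {y} 0≤y fail = ρ , small⇒root G ρ (proj₂ (proj₂ limit)) , proj₁ (proj₂ limit)
  where
  -- The upper end is `n + 1` instead of `n`, so that `1 ≤ B` holds also for the graph without
  -- vertices.
  positive-beyond : ∀ {x} → nat (suc (length (allFin n))) ℚ.≤ x → Positivity.Positive G x (allFin n)
  positive-beyond {x} B≤x = Positivity.positive-large G x (allFin n)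
    (ℚ.≤-trans (nat-mono (ℕ.n≤1+n (length (allFin n)))) B≤x)
  limit = Bisection.limit G (allFin n) (nat (suc (length (allFin n)))) (1≤nat-suc (length (allFin n)))
    positive-beyond y 0≤y fail
  ρ = proj₁ limit

-- A failure at `y` yields a root whose terms are all at least `y`, while maximality of `r` bounds
-- these terms eventually by `seq r j + η`. The margin `η` is there because `_≤_` on reals holds
-- termwise only up to an error.
positive-above-root : ∀ {n} (G : Graph n) {r} → IsLargestMatchingRoot G r → ∀ {y η N} → 0ℚ ℚ.≤ y → 0ℚ ℚ.< η →
  (∀ j → N ℕ.≤ j → seq r j ℚ.+ η ℚ.< y) → Positivity.Positive G y (allFin n)
positive-above-root {n} G {r} (_ , largest) {y} {η} {N} 0≤y 0<η above =
  by-cases (Positivity.positive-or-failing G y (allFin n))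
  where
  impossible : ¬ Positivity.Failing G y (allFin n)
  impossible fail = ℚ.<-irrefl refl (ℚ.≤-<-trans
    (ℚ.≤-trans (proj₂ (proj₂ ρ) j) (proj₂ ρ≤r j (ℕ.m≤n⊔m N (proj₁ ρ≤r))))
    (above j (ℕ.m≤m⊔n N (proj₁ ρ≤r))))
    where
    ρ = failing⇒root G 0≤y fail
    ρ≤r = largest (proj₁ ρ) (proj₁ (proj₂ ρ)) η 0<η
    j = N ℕ.⊔ proj₁ ρ≤r
  by-cases : Positivity.Positive G y (allFin n) ⊎ Positivity.Failing G y (allFin n) → Positivity.Positive G y (allFin n)
  by-cases (inj₁ pos)  = pos
  by-cases (inj₂ fail) = contradiction fail impossible

-- Grundy colourings

Chain : ℕ → ℚ → Set
Chain zero    r = 0ℚ ℚ.< r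
Chain (suc i) r = 0ℚ ℚ.< r × Chain i (r ℚ.- inv r)

GrundyColouring : ∀ {n} → Graph n → (Fin n → ℕ) → Set
GrundyColouring G col = ∀ v j → 1 ℕ.≤ j → j ℕ.< col v → ∃ λ u → Graph.Adj G v u × col u ≡ j

module GrundyChain {n : ℕ} (G : Graph n) (col : Fin n → ℕ) (grundy : GrundyColouring G col)
  (y : ℚ) (positive : Positivity.Positive G y (allFin n)) where

  open Graph G
  open Positivity G

  r : ℕ → ℚ
  r zero    = y
  r (suc c) = r c ℚ.- inv (r c)

  Live : List (Fin n) → Set
  Live S = ∃ λ R → allFin n ↭ R ++ S

  live-pos : ∀ {S} → Live S → 0ℚ ℚ.< Φ y S
  live-pos {S} (R , p) = positive R S p

  live-tail : ∀ {u S T} → S ↭ u ∷ T → Live S → Live T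
  live-tail {u} {S} {T} q (R , p) = u ∷ R , ↭-trans p (↭-trans (++⁺ˡ R q) (shift u R T))

  indicator : ∀ {P : Set} → Dec P → ℚ
  indicator (yes _) = 1ℚ
  indicator (no _)  = 0ℚ

  δ : ℕ → Fin n → ℚ
  δ k u = indicator (col u ℕ.≟ k)

  δ-nonNeg : ∀ k u → 0ℚ ℚ.≤ δ k u
  δ-nonNeg k u with col u ℕ.≟ k
  ... | yes _ = 0≤1
  ... | no _  = ℚ.≤-refl

  δ-1 : ∀ {k u} → col u ≡ k → δ k u ≡ 1ℚ
  δ-1 {k} {u} eq with col u ℕ.≟ k
  ... | yes _ = refl
  ... | no ne = contradiction eq ne

  δ-0 : ∀ {k u} → col u ≢ k → δ k u ≡ 0ℚ
  δ-0 {k} {u} ne with col u ℕ.≟ k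
  ... | yes eq = contradiction eq ne
  ... | no _   = refl

  -- The indicator of `1 ≤ col u ≤ m`, written as a sum over colours so that `star-sum` can add one
  -- colour class at a time.
  χ : ℕ → Fin n → ℚ
  χ zero    u = 0ℚ
  χ (suc m) u = χ m u ℚ.+ δ (suc m) u

  χ-0 : ∀ m u → m ℕ.< col u → χ m u ≡ 0ℚ
  χ-0 zero    u _ = refl
  χ-0 (suc m) u l = cong₂ ℚ._+_ (χ-0 m u (ℕ.<-trans (ℕ.n<1+n m) l)) (δ-0 (ℕ.<⇒≢ l ∘ sym))

  χ-≤1 : ∀ m u → χ m u ℚ.≤ 1ℚ
  χ-≤1 zero    u = 0≤1
  χ-≤1 (suc m) u with col u ℕ.≟ suc m
  ... | yes eq = ℚ.≤-reflexive (cong (ℚ._+ 1ℚ) (χ-0 m u (ℕ.≤-reflexive (sym eq))))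
  ... | no _   = subst (ℚ._≤ 1ℚ) (sym (ℚ.+-identityʳ (χ m u))) (χ-≤1 m u)

  star : Fin n → Fin n → List (Fin n) → ℚ
  star v u T = adjacency v u ℚ.* Φ y T

  star-nonNeg : ∀ v {S u T} → Live S → Pick u T S → 0ℚ ℚ.≤ star v u T
  star-nonNeg v live pk = *-nonNeg (adjacency-nonNeg v _) (ℚ.<⇒≤ (live-pos (live-tail (pick-↭ pk) live)))

  -- The subtree of decreasing colours below v in the path tree of G is the
  -- binomial tree, whose ratios Φ (v ∷ S) / Φ S are exactly r.
  ratio : ∀ c v S → Live (v ∷ S) → col v ≡ suc c → (∀ u → col u ℕ.≤ c → u ∈ S) →
    Φ y (v ∷ S) ℚ.≤ r c ℚ.* Φ y S
  -- One neighbour `u` per colour `j` from 1 to `m` suffices: `ratio` at `u` gives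
  -- `Φ(S − u) ≥ Φ(S) / r_{j−1}`, and the reciprocals `1/r_0 , … , 1/r_{m−1}` add up to `y − r m`.
  -- All other terms are nonnegative.
  star-sum : ∀ m c v S → m ℕ.≤ c → Live (v ∷ S) → col v ≡ suc c → (∀ u → col u ℕ.≤ c → u ∈ S) →
    (y ℚ.- r m) ℚ.* Φ y S ℚ.≤ Σpick (λ u T → χ m u ℚ.* star v u T) S

  ratio c v S live colv has = begin
    Φ y (v ∷ S)
      ≡⟨ Φ-∷ y v S ⟩
    y ℚ.* Φ y S ℚ.- Σpick (star v) S
      ≤⟨ ≤-by-diff (solve 4 (λ y r p s → r :* p :- (y :* p :- s) := s :- (y :- r) :* p) refl
           y (r c) (Φ y S) (Σpick (star v) S))
           (diff-nonNeg (ℚ.≤-trans (star-sum c c v S ℕ.≤-refl live colv has)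
             (Σpick-mono S λ {u} {T} pk → subst (χ c u ℚ.* star v u T ℚ.≤_) (ℚ.*-identityˡ (star v u T))
               (*-monoˡ (star-nonNeg v (live-tail refl live) pk) (χ-≤1 c u))))) ⟩
    r c ℚ.* Φ y S ∎
    where open ℚ.≤-Reasoning

  star-sum zero c v S _ live colv has = subst (ℚ._≤ Σpick (λ u T → 0ℚ ℚ.* star v u T) S)
    (solve 2 (λ y p → con 0ℚ := (y :- y) :* p) refl y (Φ y S))
    (Σpick-nonNeg S λ {u} {T} _ → ℚ.≤-reflexive (sym (ℚ.*-zeroˡ (star v u T))))
  star-sum (suc m) c v S m<c live colv has = begin
    (y ℚ.- (r m ℚ.- inv (r m))) ℚ.* Φ y S
      ≡⟨ solve 4 (λ y r i p → (y :- (r :- i)) :* p := (y :- r) :* p :+ i :* p) refl y (r m) (inv (r m)) (Φ y S) ⟩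
    (y ℚ.- r m) ℚ.* Φ y S ℚ.+ inv (r m) ℚ.* Φ y S
      ≤⟨ ℚ.+-mono-≤ (star-sum m c v S (ℕ.<⇒≤ m<c) live colv has) one-term ⟩
    Σpick (λ u T → χ m u ℚ.* star v u T) S ℚ.+ Σpick (λ u T → δ (suc m) u ℚ.* star v u T) S
      ≡⟨ sym (Σpick-+ _ _ S) ⟩
    Σpick (λ u T → χ m u ℚ.* star v u T ℚ.+ δ (suc m) u ℚ.* star v u T) S
      ≡⟨ Σpick-cong S (λ {u} {T} _ → sym (ℚ.*-distribʳ-+ (star v u T) (χ m u) (δ (suc m) u))) ⟩
    Σpick (λ u T → χ (suc m) u ℚ.* star v u T) S ∎
    where
    open ℚ.≤-Reasoning
    neighbour = grundy v (suc m) (ℕ.s≤s ℕ.z≤n) (ℕ.≤-trans (ℕ.s≤s m<c) (ℕ.≤-reflexive (sym colv)))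
    u = proj₁ neighbour
    v~u = proj₁ (proj₂ neighbour)
    colu = proj₂ (proj₂ neighbour)
    picked = ∈⇒pick (has u (ℕ.≤-trans (ℕ.≤-reflexive colu) m<c))
    T = proj₁ picked
    pk = proj₂ picked
    liveS : Live S
    liveS = live-tail refl live
    liveu∷T : Live (u ∷ T)
    liveu∷T = proj₁ liveS , ↭-trans (proj₂ liveS) (++⁺ˡ (proj₁ liveS) (pick-↭ pk))
    ΦS≤ : Φ y S ℚ.≤ r m ℚ.* Φ y T
    ΦS≤ = subst (ℚ._≤ r m ℚ.* Φ y T) (sym (Φ-perm y (pick-↭ pk)))
      -- The deleted `u` has colour `m + 1`, so every vertex of colour at most `m` survives in `T`.
      (ratio m u T liveu∷T colu λ x colx → pick-∈ pk (has x (ℕ.≤-trans colx (ℕ.<⇒≤ m<c)))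
        λ x≡u → ℕ.<⇒≱ (ℕ.n<1+n m) (subst (ℕ._≤ m) (trans (cong col x≡u) colu) colx))
    0<ΦT : 0ℚ ℚ.< Φ y T
    0<ΦT = live-pos (live-tail (pick-↭ pk) liveS)
    -- Positivity of `r m` is read off from the ratio bound itself, as `Φ` is positive on `S` and on
    -- `T`; only then can one divide by it.
    0<r : 0ℚ ℚ.< r m
    0<r = pos-cancelʳ (ℚ.<-≤-trans (live-pos liveS) ΦS≤) (ℚ.<⇒≤ 0<ΦT)
    one-term : inv (r m) ℚ.* Φ y S ℚ.≤ Σpick (λ u T → δ (suc m) u ℚ.* star v u T) S
    one-term = begin
      inv (r m) ℚ.* Φ y S
        ≤⟨ *-monoʳ (ℚ.<⇒≤ (inv-pos 0<r)) ΦS≤ ⟩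
      inv (r m) ℚ.* (r m ℚ.* Φ y T)
        ≡⟨ trans (solve 3 (λ i r p → i :* (r :* p) := (r :* i) :* p) refl (inv (r m)) (r m) (Φ y T))
             (cong (ℚ._* Φ y T) (*-inv 0<r)) ⟩
      1ℚ ℚ.* Φ y T
        ≡⟨ sym (trans (cong₂ (λ a b → a ℚ.* (b ℚ.* Φ y T)) (δ-1 {suc m} {u} colu) (adjacency-1 v~u)) (ℚ.*-identityˡ (1ℚ ℚ.* Φ y T))) ⟩
      δ (suc m) u ℚ.* star v u T
        ≤⟨ Σpick-≥term (λ {a} pk′ → *-nonNeg (δ-nonNeg (suc m) a) (star-nonNeg v liveS pk′)) pk ⟩
      Σpick (λ u T → δ (suc m) u ℚ.* star v u T) S ∎

  r-pos : ∀ c v → col v ≡ suc c → 0ℚ ℚ.< r c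
  r-pos c v colv = pos-cancelʳ (ℚ.<-≤-trans (live-pos live) (ratio c v T live colv has))
    (ℚ.<⇒≤ (live-pos (live-tail refl live)))
    where
    T = proj₁ (∈⇒pick (∈-allFin v))
    pk = proj₂ (∈⇒pick (∈-allFin v))
    live : Live (v ∷ T)
    live = [] , pick-↭ pk
    has : ∀ u → col u ℕ.≤ c → u ∈ T
    has u colu = pick-∈ pk (∈-allFin u) λ u≡v →
      ℕ.<⇒≱ (ℕ.n<1+n c) (subst (ℕ._≤ c) (trans (cong col u≡v) colv) colu)

  r-chain : ∀ i j → (∀ c → c ℕ.≤ j ℕ.+ i → 0ℚ ℚ.< r c) → Chain i (r j)
  r-chain zero    j pos = pos j (ℕ.m≤m+n j 0)
  r-chain (suc i) j pos = pos j (ℕ.m≤m+n j (suc i)) ,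
    r-chain i (suc j) (λ c l → pos c (ℕ.≤-trans l (ℕ.≤-reflexive (sym (ℕ.+-suc j i)))))

  chain : ∀ m v → col v ≡ suc m → Chain m y
  chain m v colv = r-chain m 0 λ c c≤m → by-cases c (ℕ.m≤n⇒m<n∨m≡n c≤m)
    where
    by-cases : ∀ c → c ℕ.< m ⊎ c ≡ m → 0ℚ ℚ.< r c
    by-cases c (inj₂ refl) = r-pos c v colv
    by-cases c (inj₁ c<m)  =
      let u , _ , colu = grundy v (suc c) (ℕ.s≤s ℕ.z≤n) (ℕ.≤-trans (ℕ.s≤s c<m) (ℕ.≤-reflexive (sym colv)))
      in r-pos c u colu

-- The descent r ↦ r − 1/r

-- Brings equations such as `r · inv r ≡ 1`, which the ring solver cannot see, into a difference
-- certificate: any multiple of `p − q` may be added as a nonnegative term.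
vanishing : ∀ {p q} → p ≡ q → ∀ c → 0ℚ ℚ.≤ c ℚ.* (p ℚ.- q)
vanishing {p} {q} refl c = ℚ.≤-reflexive (solve 2 (λ c p → con 0ℚ := c :* (p :- p)) refl c p)

harmonic : ℕ → ℚ
harmonic zero    = 0ℚ
harmonic (suc n) = harmonic n ℚ.+ inv (nat (suc n))

-- r² falls by 2 − 1/r² at each step, and i steps before the end r² ≥ i.
chain-bound : ∀ i r → Chain i r → nat i ℚ.≤ r ℚ.* r × nat i ℚ.+ nat i ℚ.≤ r ℚ.* r ℚ.+ harmonic i
chain-bound zero    r _ = square-nonNeg r , +-nonNeg (square-nonNeg r) ℚ.≤-refl
chain-bound (suc i) r (0<r , ch) = i<rr , bound
  where
  t = inv r
  s = r ℚ.- t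
  IH = chain-bound i s ch
  0<s : ∀ i {s} → Chain i s → 0ℚ ℚ.< s
  0<s zero    p       = p
  0<s (suc _) (p , _) = p
  0≤t : 0ℚ ℚ.≤ t
  0≤t = ℚ.<⇒≤ (inv-pos 0<r)
  rt≡1 : r ℚ.* t ≡ 1ℚ
  rt≡1 = *-inv 0<r
  -- As `s = r − t` is positive, `t ≤ r`, hence `t² ≤ r t = 1`.
  tt≤1 : t ℚ.* t ℚ.≤ 1ℚ
  tt≤1 = subst (t ℚ.* t ℚ.≤_) rt≡1 (*-monoˡ {t} {r} 0≤t
    (≤-by-diff {d = s} refl (ℚ.<⇒≤ (0<s i ch))))
  i<rr : nat (suc i) ℚ.≤ r ℚ.* r
  i<rr = ≤-by-diff
    (solve 3 (λ r t i → r :* r :- (con 1ℚ :+ i) :=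
      (((r :- t) :* (r :- t) :- i) :+ (con 1ℚ :- t :* t)) :+ con 2ℚ :* (r :* t :- con 1ℚ)) refl r t (nat i))
    (+-nonNeg (+-nonNeg (diff-nonNeg (proj₁ IH)) (diff-nonNeg tt≤1)) (vanishing rt≡1 2ℚ))
  -- The first component, `r² ≥ i + 1`, turns the loss `1/r²` into the next harmonic term.
  tt≤inv : t ℚ.* t ℚ.≤ inv (nat (suc i))
  tt≤inv = inv-lower (nat-pos i) (ℚ.≤-trans (*-monoˡ (*-nonNeg 0≤t 0≤t) i<rr) (ℚ.≤-reflexive
    (trans (solve 2 (λ r t → (r :* r) :* (t :* t) := (r :* t) :* (r :* t)) refl r t) (cong₂ ℚ._*_ rt≡1 rt≡1))))
  bound : nat (suc i) ℚ.+ nat (suc i) ℚ.≤ r ℚ.* r ℚ.+ (harmonic i ℚ.+ inv (nat (suc i)))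
  bound = ≤-by-diff
    (solve 5 (λ r t i h u → (r :* r :+ (h :+ u)) :- ((con 1ℚ :+ i) :+ (con 1ℚ :+ i)) :=
      ((((r :- t) :* (r :- t) :+ h) :- (i :+ i)) :+ (u :- t :* t)) :+ con 2ℚ :* (r :* t :- con 1ℚ)) refl
      r t (nat i) (harmonic i) (inv (nat (suc i))))
    (+-nonNeg (+-nonNeg (diff-nonNeg (proj₂ IH)) (diff-nonNeg tt≤inv)) (vanishing rt≡1 2ℚ))

harmonic-+ : ∀ n k → harmonic (k ℕ.+ n) ℚ.≤ harmonic n ℚ.+ nat k ℚ.* inv (nat (suc n))
harmonic-+ n zero    = ℚ.≤-reflexive (solve 2 (λ h u → h := h :+ con 0ℚ :* u) refl (harmonic n) (inv (nat (suc n))))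
harmonic-+ n (suc k) = ≤-by-diff
  (solve 5 (λ h k u h′ u′ → (h :+ (con 1ℚ :+ k) :* u) :- (h′ :+ u′) := ((h :+ k :* u) :- h′) :+ (u :- u′)) refl
    (harmonic n) (nat k) (inv (nat (suc n))) (harmonic (k ℕ.+ n)) (inv (nat (suc (k ℕ.+ n)))))
  (+-nonNeg (diff-nonNeg (harmonic-+ n k)) (diff-nonNeg (inv-upper (nat-pos (k ℕ.+ n))
    (subst (ℚ._≤ nat (suc (k ℕ.+ n)) ℚ.* inv (nat (suc n))) (*-inv (nat-pos n))
      (*-monoˡ (ℚ.<⇒≤ (inv-pos (nat-pos n))) (nat-mono (ℕ.s≤s (ℕ.m≤n+m n k))))))))

harmonic-mono : ∀ {m n} → m ℕ.≤′ n → harmonic m ℚ.≤ harmonic n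
harmonic-mono (ℕ.≤′-reflexive refl) = ℚ.≤-refl
harmonic-mono (ℕ.≤′-step {n} le) = ℚ.≤-trans (harmonic-mono le)
  (≤-by-diff (solve 2 (λ h u → (h :+ u) :- h := u) refl (harmonic n) (inv (nat (suc n)))) (ℚ.<⇒≤ (inv-pos (nat-pos n))))

-- For `h = ⌊m/2⌋`, the terms from `h + 1` to `2h + 1` number `h + 1`, and each is at most
-- `1/(h + 1)`. Halving `m` thus costs at most 1.
harmonic-log : ∀ j m → m ℕ.< 2 ℕ.^ j → harmonic m ℚ.≤ nat j
harmonic-log zero    zero    _ = ℚ.≤-refl
harmonic-log zero    (suc m) (ℕ.s≤s ())
harmonic-log (suc j) m       m<2^ = begin
  harmonic m
    ≤⟨ harmonic-mono (ℕ.≤⇒≤′ m≤) ⟩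
  harmonic (suc h ℕ.+ h)
    ≤⟨ harmonic-+ h (suc h) ⟩
  harmonic h ℚ.+ nat (suc h) ℚ.* inv (nat (suc h))
    ≡⟨ trans (cong (harmonic h ℚ.+_) (*-inv (nat-pos h))) (ℚ.+-comm (harmonic h) 1ℚ) ⟩
  1ℚ ℚ.+ harmonic h
    ≤⟨ ℚ.+-monoʳ-≤ 1ℚ (harmonic-log j h (ℕ.m<n*o⇒m/o<n (ℕ.≤-trans m<2^ (ℕ.≤-reflexive (ℕ.*-comm 2 (2 ℕ.^ j)))))) ⟩
  nat (suc j) ∎
  where
  open ℚ.≤-Reasoning
  h = m ℕ./ 2
  m≤ : m ℕ.≤ suc h ℕ.+ h
  m≤ = ℕ.≤-trans (ℕ.≤-reflexive (ℕ.m≡m%n+[m/n]*n m 2))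
    (ℕ.≤-trans (ℕ.+-monoˡ-≤ (h ℕ.* 2) (ℕ.s≤s⁻¹ (ℕ.m%n<n m 2)))
      (ℕ.≤-reflexive (cong suc (trans (ℕ.*-comm h 2) (cong (h ℕ.+_) (ℕ.+-identityʳ h))))))

m<16^m : ∀ m → m ℕ.< 16 ℕ.^ m
m<16^m zero    = ℕ.s≤s ℕ.z≤n
m<16^m (suc m) = ℕ.≤-trans (ℕ.+-mono-≤ (ℕ.≤-trans (ℕ.s≤s ℕ.z≤n) (m<16^m m)) (m<16^m m))
  (ℕ.+-monoʳ-≤ (16 ℕ.^ m) (ℕ.m≤m+n (16 ℕ.^ m) (14 ℕ.* 16 ℕ.^ m)))

log₁₆ : ∀ k m → 1 ℕ.≤ m → m ℕ.< 16 ℕ.^ k → ∃ λ i → 16 ℕ.^ i ℕ.≤ m × m ℕ.< 16 ℕ.^ suc i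
log₁₆ zero    m 1≤m m<1 = contradiction m<1 (ℕ.≤⇒≯ 1≤m)
log₁₆ (suc k) m 1≤m m<  with ℕ._≤?_ (16 ℕ.^ k) m
... | yes le = k , le , m<
... | no  gt = log₁₆ k m 1≤m (ℕ.≰⇒> gt)

nat-* : ∀ m n → nat (m ℕ.* n) ≡ nat m ℚ.* nat n
nat-* zero    n = sym (ℚ.*-zeroˡ (nat n))
nat-* (suc m) n = trans (nat-+ n (m ℕ.* n)) (trans (cong (nat n ℚ.+_) (nat-* m n))
  (solve 2 (λ m n → n :+ m :* n := (con 1ℚ :+ m) :* n) refl (nat m) (nat n)))

nat-16^ : ∀ i → nat (16 ℕ.^ i) ≡ (2^ i ℚ.* 2^ i) ℚ.* (2^ i ℚ.* 2^ i)
nat-16^ zero    = refl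
nat-16^ (suc i) = trans (nat-* 16 (16 ℕ.^ i)) (trans (cong (nat 16 ℚ.*_) (nat-16^ i))
  (solve 1 (λ p → con (nat 16) :* ((p :* p) :* (p :* p)) :=
    ((con 2ℚ :* p) :* (con 2ℚ :* p)) :* ((con 2ℚ :* p) :* (con 2ℚ :* p))) refl (2^ i)))

-- The i-th summand of f, that is 2ⁱ / (4ⁱ + q).
summand : ℕ → ℚ → ℚ
summand i q = inv (2^ i ℚ.+ ½^ i ℚ.* q)

denominator-pos : ∀ i {q} → 0ℚ ℚ.≤ q → 0ℚ ℚ.< 2^ i ℚ.+ ½^ i ℚ.* q
denominator-pos i 0≤q = +-pos (2^-pos i) (*-nonNeg (ℚ.<⇒≤ (½^-pos i)) 0≤q)

summand-pos : ∀ i {q} → 0ℚ ℚ.≤ q → 0ℚ ℚ.< summand i q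
summand-pos i 0≤q = inv-pos (denominator-pos i 0≤q)

-- When `4ⁱ ≤ q`, the denominator `4ⁱ + q` is at most `2q`.
summand-large : ∀ i {q} → 2^ i ℚ.* 2^ i ℚ.≤ q → 2^ i ℚ.≤ (q ℚ.+ q) ℚ.* summand i q
summand-large i {q} 4^i≤q = begin
  p
    ≡⟨ sym (trans (ℚ.*-assoc p D (inv D)) (trans (cong (p ℚ.*_) (*-inv (denominator-pos i 0≤q))) (ℚ.*-identityʳ p))) ⟩
  (p ℚ.* D) ℚ.* inv D
    ≤⟨ *-monoˡ {p ℚ.* D} {q ℚ.+ q} (ℚ.<⇒≤ (summand-pos i 0≤q)) (≤-by-diff
         (solve 3 (λ p h q → (q :+ q) :- p :* (p :+ h :* q) := (q :- p :* p) :+ (:- q) :* (p :* h :- con 1ℚ)) refl p (½^ i) q)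
         (+-nonNeg (diff-nonNeg 4^i≤q) (vanishing (2^*½^ i) (ℚ.- q)))) ⟩
  (q ℚ.+ q) ℚ.* inv D ∎
  where
  open ℚ.≤-Reasoning
  p = 2^ i
  D = p ℚ.+ ½^ i ℚ.* q
  0≤q : 0ℚ ℚ.≤ q
  0≤q = ℚ.≤-trans (*-nonNeg (ℚ.<⇒≤ (2^-pos i)) (ℚ.<⇒≤ (2^-pos i))) 4^i≤q

-- The index `i` depends on `m` only, not on `y`. In the application `y` varies with the
-- approximation of `μ₁`, and a single truncation point of the series must serve all of these `y`.
chain-summand : ∀ m → ∃ λ i → ∀ y g → 0ℚ ℚ.≤ y → Chain m y → 4ℚ ℚ.* summand i y ℚ.≤ g →
  nat m ℚ.+ nat m ℚ.≤ (y ℚ.+ g) ℚ.* (y ℚ.+ g)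
chain-summand zero    = 0 , λ y g _ _ _ → square-nonNeg (y ℚ.+ g)
chain-summand m@(suc m′) = i , bound
  where
  scale = log₁₆ m m (ℕ.s≤s ℕ.z≤n) (m<16^m m)
  i = proj₁ scale
  p = 2^ i
  -- `m < 16ⁱ⁺¹ = 2^(4(i + 1))` gives `H_m ≤ 4(i + 1) ≤ 4 · 2ⁱ`, the origin of the factor 4 in the
  -- error function.
  harmonic≤ : harmonic m ℚ.≤ 4ℚ ℚ.* p
  harmonic≤ = ℚ.≤-trans (harmonic-log (4 ℕ.* suc i) m
      (ℕ.≤-trans (proj₂ (proj₂ scale)) (ℕ.≤-reflexive (ℕ.^-*-assoc 2 4 (suc i)))))
    (subst (ℚ._≤ 4ℚ ℚ.* p) (sym (nat-* 4 (suc i))) (*-monoʳ (nat-nonNeg 4) (1+i≤2^i i)))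
  bound : ∀ y g → 0ℚ ℚ.≤ y → Chain m y → 4ℚ ℚ.* summand i y ℚ.≤ g →
    nat m ℚ.+ nat m ℚ.≤ (y ℚ.+ g) ℚ.* (y ℚ.+ g)
  bound y g 0≤y ch le = ≤-by-diff
    (solve 6 (λ y g k h s p → (y :+ g) :* (y :+ g) :- (k :+ k) :=
      ((((y :* y :+ h) :- (k :+ k)) :+ (con 4ℚ :* p :- h)) :+ (y :+ y) :* (g :- con 4ℚ :* s))
        :+ (con 4ℚ :* ((y :+ y) :* s :- p) :+ g :* g)) refl y g (nat m) (harmonic m) (summand i y) p)
    (+-nonNeg (+-nonNeg (+-nonNeg (diff-nonNeg (proj₂ ch-bound)) (diff-nonNeg harmonic≤))
        (*-nonNeg (+-nonNeg 0≤y 0≤y) (diff-nonNeg le)))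
      (+-nonNeg (*-nonNeg (nat-nonNeg 4) (diff-nonNeg (summand-large i pp≤y))) (square-nonNeg g)))
    where
    ch-bound = chain-bound m y ch
    -- Base 16 is the fourth power of 2: from `16ⁱ ≤ m ≤ y²` follows `4ⁱ ≤ y`, as `summand-large`
    -- requires.
    pp≤y : p ℚ.* p ℚ.≤ y
    pp≤y = square-cancel-≤ 0≤y (subst (ℚ._≤ y ℚ.* y) (nat-16^ i)
      (ℚ.≤-trans (nat-mono (proj₁ (proj₂ scale))) (proj₁ ch-bound)))

-- The error function

partialSum : ℕ → ℚ → ℚ
partialSum zero    q = 0ℚ
partialSum (suc n) q = partialSum n q ℚ.+ summand n q

-- Uniform in `q`, so the series converges geometrically. The bound `2ⁱ / q` of `summand-≤2^/`
-- complements it for the early summands when `q` is large; the two cross at `4ⁱ = q`.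
summand-≤½^ : ∀ i {q} → 0ℚ ℚ.≤ q → summand i q ℚ.≤ ½^ i
summand-≤½^ i {q} 0≤q = inv-upper (denominator-pos i 0≤q) (≤-by-diff
  (solve 3 (λ p h q → (p :+ h :* q) :* h :- con 1ℚ := (h :* h) :* q :+ con 1ℚ :* (p :* h :- con 1ℚ)) refl (2^ i) (½^ i) q)
  (+-nonNeg (*-nonNeg (square-nonNeg (½^ i)) 0≤q) (vanishing (2^*½^ i) 1ℚ)))

summand-≤2^/ : ∀ i {q} → 0ℚ ℚ.< q → summand i q ℚ.≤ 2^ i ℚ.* inv q
summand-≤2^/ i {q} 0<q = inv-upper (denominator-pos i (ℚ.<⇒≤ 0<q)) (≤-by-diff
  (solve 4 (λ p h q u → (p :+ h :* q) :* (p :* u) :- con 1ℚ :=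
    ((p :* p) :* u :+ (q :* u) :* (p :* h :- con 1ℚ)) :+ con 1ℚ :* (q :* u :- con 1ℚ)) refl (2^ i) (½^ i) q (inv q))
  (+-nonNeg (+-nonNeg (*-nonNeg (square-nonNeg (2^ i)) (ℚ.<⇒≤ (inv-pos 0<q)))
    (vanishing (2^*½^ i) (q ℚ.* inv q))) (vanishing (*-inv 0<q) 1ℚ)))

summand-lipschitz : ∀ i {p q} → 0ℚ ℚ.≤ p → 0ℚ ℚ.≤ q →
  ℚ.∣ summand i p ℚ.- summand i q ∣ ℚ.≤ ½^ i ℚ.* ℚ.∣ p ℚ.- q ∣
summand-lipschitz i {p} {q} 0≤p 0≤q = begin
  ℚ.∣ a ℚ.- b ∣
    ≡⟨ trans (cong ℚ.∣_∣ difference) (trans (ℚ.∣p*q∣≡∣p∣*∣q∣ (½^ i ℚ.* (a ℚ.* b)) (q ℚ.- p))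
         (cong₂ ℚ._*_ (ℚ.0≤p⇒∣p∣≡p (*-nonNeg 0≤h 0≤ab)) (∣p-q∣≡∣q-p∣ q p))) ⟩
  (½^ i ℚ.* (a ℚ.* b)) ℚ.* ℚ.∣ p ℚ.- q ∣
    ≤⟨ *-monoˡ (ℚ.0≤∣p∣ (p ℚ.- q)) (*-monoʳ 0≤h (*-mono (ℚ.<⇒≤ (summand-pos i 0≤p)) 0≤1 (≤1 0≤p) (≤1 0≤q))) ⟩
  (½^ i ℚ.* 1ℚ) ℚ.* ℚ.∣ p ℚ.- q ∣
    ≡⟨ cong (ℚ._* ℚ.∣ p ℚ.- q ∣) (ℚ.*-identityʳ (½^ i)) ⟩
  ½^ i ℚ.* ℚ.∣ p ℚ.- q ∣ ∎
  where
  open ℚ.≤-Reasoning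
  a = summand i p
  b = summand i q
  0≤h : 0ℚ ℚ.≤ ½^ i
  0≤h = ℚ.<⇒≤ (½^-pos i)
  0≤ab : 0ℚ ℚ.≤ a ℚ.* b
  0≤ab = *-nonNeg (ℚ.<⇒≤ (summand-pos i 0≤p)) (ℚ.<⇒≤ (summand-pos i 0≤q))
  ≤1 : ∀ {q} → 0ℚ ℚ.≤ q → summand i q ℚ.≤ 1ℚ
  ≤1 0≤q = ℚ.≤-trans (summand-≤½^ i 0≤q) (½^≤1 i)
  P = 2^ i ℚ.+ ½^ i ℚ.* p
  Q = 2^ i ℚ.+ ½^ i ℚ.* q
  -- This is `1/P − 1/Q = (Q − P) / (P Q)`.
  difference : a ℚ.- b ≡ (½^ i ℚ.* (a ℚ.* b)) ℚ.* (q ℚ.- p)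
  difference = begin-equality
    a ℚ.- b
      ≡⟨ sym (cong₂ ℚ._-_ (ℚ.*-identityʳ a) (ℚ.*-identityʳ b)) ⟩
    a ℚ.* 1ℚ ℚ.- b ℚ.* 1ℚ
      ≡⟨ sym (cong₂ (λ s t → a ℚ.* s ℚ.- b ℚ.* t) (*-inv (denominator-pos i 0≤q)) (*-inv (denominator-pos i 0≤p))) ⟩
    a ℚ.* (Q ℚ.* b) ℚ.- b ℚ.* (P ℚ.* a)
      ≡⟨ solve 6 (λ a b x h p q → a :* ((x :+ h :* q) :* b) :- b :* ((x :+ h :* p) :* a) := (h :* (a :* b)) :* (q :- p)) refl
           a b (2^ i) (½^ i) p q ⟩
    (½^ i ℚ.* (a ℚ.* b)) ℚ.* (q ℚ.- p) ∎

-- `2 · ½^ n` is the full geometric tail that dominates the summands from `n` on. Hence the partial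
-- sums increase while the partial sums plus tail decrease, and the two enclose the limit.
partialSum-step : ∀ {m n q} → 0ℚ ℚ.≤ q → m ℕ.≤′ n →
  partialSum m q ℚ.≤ partialSum n q × partialSum n q ℚ.+ 2ℚ ℚ.* ½^ n ℚ.≤ partialSum m q ℚ.+ 2ℚ ℚ.* ½^ m
partialSum-step 0≤q (ℕ.≤′-reflexive refl) = ℚ.≤-refl , ℚ.≤-refl
partialSum-step {m} {_} {q} 0≤q (ℕ.≤′-step {n} le) =
  ℚ.≤-trans (proj₁ IH) (≤-by-diff (solve 2 (λ s t → (s :+ t) :- s := t) refl (partialSum n q) (summand n q)) (ℚ.<⇒≤ (summand-pos n 0≤q))) ,
  ℚ.≤-trans (≤-by-diff (solve 3 (λ s t h → (s :+ con 2ℚ :* h) :- ((s :+ t) :+ con 2ℚ :* (con ½ :* h)) := h :- t) refl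
      (partialSum n q) (summand n q) (½^ n)) (diff-nonNeg (summand-≤½^ n 0≤q)))
    (proj₂ IH)
  where IH = partialSum-step 0≤q le

partialSum-tail : ∀ {N n q} → 0ℚ ℚ.≤ q → N ℕ.≤ n → partialSum n q ℚ.≤ partialSum N q ℚ.+ 2ℚ ℚ.* ½^ N
partialSum-tail {N} {n} {q} 0≤q N≤n = ℚ.≤-trans
  (≤-by-diff (solve 2 (λ s h → (s :+ con 2ℚ :* h) :- s := con 2ℚ :* h) refl (partialSum n q) (½^ n))
    (*-nonNeg (nat-nonNeg 2) (ℚ.<⇒≤ (½^-pos n))))
  (proj₂ (partialSum-step 0≤q (ℕ.≤⇒≤′ N≤n)))

partialSum-nonNeg : ∀ n {q} → 0ℚ ℚ.≤ q → 0ℚ ℚ.≤ partialSum n q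
partialSum-nonNeg n 0≤q = proj₁ (partialSum-step {0} {n} 0≤q (ℕ.≤⇒≤′ ℕ.z≤n))

summand-≤partialSum : ∀ {i n q} → 0ℚ ℚ.≤ q → i ℕ.< n → summand i q ℚ.≤ partialSum n q
summand-≤partialSum {i} {n} {q} 0≤q i<n = ℚ.≤-trans
  (≤-by-diff (solve 2 (λ s t → (s :+ t) :- t := s) refl (partialSum i q) (summand i q)) (partialSum-nonNeg i 0≤q))
  (proj₁ (partialSum-step 0≤q (ℕ.≤⇒≤′ i<n)))

partialSum-cauchy : ∀ {N m n q} → 0ℚ ℚ.≤ q → N ℕ.≤ m → N ℕ.≤ n →
  ℚ.∣ partialSum m q ℚ.- partialSum n q ∣ ℚ.≤ 2ℚ ℚ.* ½^ N
partialSum-cauchy {N} {m} {n} {q} 0≤q N≤m N≤n = subst (ℚ.∣ partialSum m q ℚ.- partialSum n q ∣ ℚ.≤_)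
  (solve 2 (λ s h → (s :+ h) :- s := h) refl (partialSum N q) (2ℚ ℚ.* ½^ N))
  (∣-∣-between (proj₁ (partialSum-step 0≤q (ℕ.≤⇒≤′ N≤m))) (partialSum-tail 0≤q N≤m)
               (proj₁ (partialSum-step 0≤q (ℕ.≤⇒≤′ N≤n))) (partialSum-tail 0≤q N≤n))

partialSum-lipschitz : ∀ n {p q} → 0ℚ ℚ.≤ p → 0ℚ ℚ.≤ q →
  ℚ.∣ partialSum n p ℚ.- partialSum n q ∣ ℚ.≤ 2ℚ ℚ.* ℚ.∣ p ℚ.- q ∣
partialSum-lipschitz n {p} {q} 0≤p 0≤q = ℚ.≤-trans (sharp n) (*-monoˡ {2ℚ ℚ.- 2ℚ ℚ.* ½^ n} {2ℚ} (ℚ.0≤∣p∣ (p ℚ.- q))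
  (≤-by-diff (solve 1 (λ h → con 2ℚ :- (con 2ℚ :- con 2ℚ :* h) := con 2ℚ :* h) refl (½^ n))
    (*-nonNeg (nat-nonNeg 2) (ℚ.<⇒≤ (½^-pos n)))))
  where
  open ℚ.≤-Reasoning
  -- The constant `2 − 2 · ½^ n` is the sum of `½^ i` over `i < n`, the Lipschitz constants of the
  -- summands.
  sharp : ∀ n → ℚ.∣ partialSum n p ℚ.- partialSum n q ∣ ℚ.≤ (2ℚ ℚ.- 2ℚ ℚ.* ½^ n) ℚ.* ℚ.∣ p ℚ.- q ∣
  sharp zero    = ℚ.≤-reflexive (solve 1 (λ d → con 0ℚ := (con 2ℚ :- con 2ℚ :* con 1ℚ) :* d) refl ℚ.∣ p ℚ.- q ∣)
  sharp (suc n) = begin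
    ℚ.∣ (partialSum n p ℚ.+ summand n p) ℚ.- (partialSum n q ℚ.+ summand n q) ∣
      ≡⟨ cong ℚ.∣_∣ (solve 4 (λ a b c d → (a :+ b) :- (c :+ d) := (a :- c) :+ (b :- d)) refl
           (partialSum n p) (summand n p) (partialSum n q) (summand n q)) ⟩
    ℚ.∣ (partialSum n p ℚ.- partialSum n q) ℚ.+ (summand n p ℚ.- summand n q) ∣
      ≤⟨ ℚ.∣p+q∣≤∣p∣+∣q∣ (partialSum n p ℚ.- partialSum n q) (summand n p ℚ.- summand n q) ⟩
    ℚ.∣ partialSum n p ℚ.- partialSum n q ∣ ℚ.+ ℚ.∣ summand n p ℚ.- summand n q ∣
      ≤⟨ ℚ.+-mono-≤ (sharp n) (summand-lipschitz n 0≤p 0≤q) ⟩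
    (2ℚ ℚ.- 2ℚ ℚ.* ½^ n) ℚ.* ℚ.∣ p ℚ.- q ∣ ℚ.+ ½^ n ℚ.* ℚ.∣ p ℚ.- q ∣
      ≡⟨ solve 2 (λ h d → (con 2ℚ :- con 2ℚ :* h) :* d :+ h :* d := (con 2ℚ :- con 2ℚ :* (con ½ :* h)) :* d) refl
           (½^ n) ℚ.∣ p ℚ.- q ∣ ⟩
    (2ℚ ℚ.- 2ℚ ℚ.* ½^ (suc n)) ℚ.* ℚ.∣ p ℚ.- q ∣ ∎

partialSum-≤2^/ : ∀ n {q} → 0ℚ ℚ.< q → partialSum n q ℚ.≤ 2^ n ℚ.* inv q
partialSum-≤2^/ zero    {q} 0<q = *-nonNeg 0≤1 (ℚ.<⇒≤ (inv-pos 0<q))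
partialSum-≤2^/ (suc n) {q} 0<q = subst (partialSum (suc n) q ℚ.≤_)
  (solve 2 (λ p u → p :* u :+ p :* u := (con 2ℚ :* p) :* u) refl (2^ n) (inv q))
  (ℚ.+-mono-≤ (partialSum-≤2^/ n 0<q) (summand-≤2^/ n 0<q))

-- Splitting at `N`: the head is at most `2^ N / q ≤ ½^ N` because `4^N ≤ q`, and the tail is at
-- most `2 · ½^ N`.
partialSum-small : ∀ N n {q} → 2^ N ℚ.* 2^ N ℚ.≤ q → partialSum n q ℚ.≤ nat 3 ℚ.* ½^ N
partialSum-small N n {q} 4^N≤q = begin
  partialSum n q
    ≤⟨ proj₁ (partialSum-step 0≤q (ℕ.≤⇒≤′ (ℕ.m≤m⊔n n N))) ⟩
  partialSum (n ℕ.⊔ N) q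
    ≤⟨ partialSum-tail 0≤q (ℕ.m≤n⊔m n N) ⟩
  partialSum N q ℚ.+ 2ℚ ℚ.* ½^ N
    ≤⟨ ℚ.+-monoˡ-≤ (2ℚ ℚ.* ½^ N) (ℚ.≤-trans (partialSum-≤2^/ N 0<q) 2^/q≤½^) ⟩
  ½^ N ℚ.+ 2ℚ ℚ.* ½^ N
    ≡⟨ solve 1 (λ h → h :+ con 2ℚ :* h := con (nat 3) :* h) refl (½^ N) ⟩
  nat 3 ℚ.* ½^ N ∎
  where
  open ℚ.≤-Reasoning
  0<q : 0ℚ ℚ.< q
  0<q = ℚ.<-≤-trans (*-pos (2^-pos N) (2^-pos N)) 4^N≤q
  0≤q : 0ℚ ℚ.≤ q
  0≤q = ℚ.<⇒≤ 0<q
  2^/q≤½^ : 2^ N ℚ.* inv q ℚ.≤ ½^ N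
  2^/q≤½^ = *-cancelˡ (2^-pos N) (subst₂ ℚ._≤_ (ℚ.*-assoc (2^ N) (2^ N) (inv q)) (trans (*-inv 0<q) (sym (2^*½^ N)))
    (*-monoˡ (ℚ.<⇒≤ (inv-pos 0<q)) 4^N≤q))

-- Approximations of a nonnegative real may be negative, where the denominators could vanish; the
-- absolute value keeps every summand defined and positive.
error : ℕ → ℚ → ℚ
error n q = 4ℚ ℚ.* partialSum n ℚ.∣ q ∣

error-nonNeg : ∀ n q → 0ℚ ℚ.≤ error n q
error-nonNeg n q = *-nonNeg (nat-nonNeg 4) (partialSum-nonNeg n (ℚ.0≤∣p∣ q))

∣4*∣ : ∀ p q → ℚ.∣ 4ℚ ℚ.* p ℚ.- 4ℚ ℚ.* q ∣ ≡ 4ℚ ℚ.* ℚ.∣ p ℚ.- q ∣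
∣4*∣ p q = trans (cong ℚ.∣_∣ (solve 2 (λ p q → con 4ℚ :* p :- con 4ℚ :* q := con 4ℚ :* (p :- q)) refl p q))
  (ℚ.∣p*q∣≡∣p∣*∣q∣ 4ℚ (p ℚ.- q))

error-lipschitz : ∀ n p q → ℚ.∣ error n p ℚ.- error n q ∣ ℚ.≤ 8ℚ ℚ.* ℚ.∣ p ℚ.- q ∣
error-lipschitz n p q = begin
  ℚ.∣ error n p ℚ.- error n q ∣
    ≡⟨ ∣4*∣ (partialSum n ℚ.∣ p ∣) (partialSum n ℚ.∣ q ∣) ⟩
  4ℚ ℚ.* ℚ.∣ partialSum n ℚ.∣ p ∣ ℚ.- partialSum n ℚ.∣ q ∣ ∣
    ≤⟨ *-monoʳ (nat-nonNeg 4) (ℚ.≤-trans (partialSum-lipschitz n (ℚ.0≤∣p∣ p) (ℚ.0≤∣p∣ q))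
         (*-monoʳ (nat-nonNeg 2) (∣∣p∣-∣q∣∣≤∣p-q∣ p q))) ⟩
  4ℚ ℚ.* (2ℚ ℚ.* ℚ.∣ p ℚ.- q ∣)
    ≡⟨ sym (ℚ.*-assoc 4ℚ 2ℚ ℚ.∣ p ℚ.- q ∣) ⟩
  8ℚ ℚ.* ℚ.∣ p ℚ.- q ∣ ∎
  where open ℚ.≤-Reasoning

error-cauchy : ∀ {N m n} q → N ℕ.≤ m → N ℕ.≤ n → ℚ.∣ error m q ℚ.- error n q ∣ ℚ.≤ 8ℚ ℚ.* ½^ N
error-cauchy {N} {m} {n} q N≤m N≤n = begin
  ℚ.∣ error m q ℚ.- error n q ∣
    ≡⟨ ∣4*∣ (partialSum m ℚ.∣ q ∣) (partialSum n ℚ.∣ q ∣) ⟩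
  4ℚ ℚ.* ℚ.∣ partialSum m ℚ.∣ q ∣ ℚ.- partialSum n ℚ.∣ q ∣ ∣
    ≤⟨ *-monoʳ (nat-nonNeg 4) (partialSum-cauchy (ℚ.0≤∣p∣ q) N≤m N≤n) ⟩
  4ℚ ℚ.* (2ℚ ℚ.* ½^ N)
    ≡⟨ sym (ℚ.*-assoc 4ℚ 2ℚ (½^ N)) ⟩
  8ℚ ℚ.* ½^ N ∎
  where open ℚ.≤-Reasoning

sixteenth : ∀ {ε} → 0ℚ ℚ.< ε → 0ℚ ℚ.< ½^ 4 ℚ.* ε
sixteenth 0<ε = *-pos (½^-pos 4) 0<ε

8*-small : ∀ ε {d} → d ℚ.< ½^ 4 ℚ.* ε → 8ℚ ℚ.* d ℚ.< ½ ℚ.* ε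
8*-small ε {d} d< = subst (8ℚ ℚ.* d ℚ.<_)
  (solve 1 (λ e → con 8ℚ :* (con (½^ 4) :* e) := con ½ :* e) refl ε)
  (ℚ.*-monoʳ-<-pos 8ℚ d<)

-- The diagonal sequence: truncation and argument are refined together. A difference of two terms
-- splits into a change of truncation and a change of argument, each below `ε/2`; the Lipschitz
-- constant 8, uniform in the truncation, asks for `ε/16` in the argument.
errorℝ : ℝ → ℝ
errorℝ x = mkℝ (λ n → error n (seq x n)) λ ε 0<ε →
  let η = ½^ 4 ℚ.* ε
      M , tail  = ½^-small 8ℚ (½ ℚ.* ε) (*-pos (ℚ.positive⁻¹ ½) 0<ε)
      N , close = cauchy x η (sixteenth 0<ε)
  in M ℕ.⊔ N , λ m n m≥ n≥ → subst
    (ℚ.∣ error m (seq x m) ℚ.- error n (seq x n) ∣ ℚ.<_)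
    (solve 1 (λ e → con ½ :* e :+ con ½ :* e := e) refl ε)
    (ℚ.≤-<-trans (triangle (error m (seq x m)) (error n (seq x m)) (error n (seq x n)))
      (ℚ.+-mono-<
        (ℚ.≤-<-trans (error-cauchy (seq x m) (ℕ.m⊔n≤o⇒m≤o M N m≥) (ℕ.m⊔n≤o⇒m≤o M N n≥)) (tail M ℕ.≤-refl))
        (ℚ.≤-<-trans (error-lipschitz n (seq x m) (seq x n))
          (8*-small ε (close m n (ℕ.m⊔n≤o⇒n≤o M N m≥) (ℕ.m⊔n≤o⇒n≤o M N n≥))))))

errorℝ-cong : ∀ {x y} → x ≈ y → errorℝ x ≈ errorℝ y
errorℝ-cong {x} {y} x≈y ε 0<ε = proj₁ close , λ n n≥ → ℚ.<-trans
  (ℚ.≤-<-trans (error-lipschitz n (seq x n) (seq y n)) (8*-small ε (proj₂ close n n≥)))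
  (<-by-diff (solve 1 (λ e → e :- con ½ :* e := con ½ :* e) refl ε) (*-pos (ℚ.positive⁻¹ ½) 0<ε))
  where close = x≈y (½^ 4 ℚ.* ε) (sixteenth 0<ε)

errorℝ-vanishes : VanishesAtInfinity (errorℝ ∘ proj₁)
-- The bound `K + 1 ≤ x` holds on terms only up to an error. Taking that error to be 1 leaves terms
-- that are eventually at least `K`.
errorℝ-vanishes ε (e , 0<e , N₀ , e≤ε) = fromℚ (K ℚ.+ 1ℚ) , λ (x , _) K≤x →
  let N₁ , large = K≤x 1ℚ 0<1 in
  ½ ℚ.* e , *-pos (ℚ.positive⁻¹ ½) 0<e , N₀ ℕ.⊔ N₁ , λ n n≥ →
    ℚ.≤-trans
      (tiny n (seq x n) (≤-by-diff (solve 2 (λ a k → a :- k := (a :+ con 1ℚ) :- (k :+ con 1ℚ)) refl (seq x n) K)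
        (diff-nonNeg (large n (ℕ.m⊔n≤o⇒n≤o N₀ N₁ n≥)))))
      (subst (ℚ._≤ seq ε n) (ℚ.+-identityˡ e) (e≤ε n (ℕ.m⊔n≤o⇒m≤o N₀ N₁ n≥)))
  where
  -- 12 is the factor 4 of `error` times the factor 3 of `partialSum-small`.
  small = ½^-small (nat 12) (½ ℚ.* e) (*-pos (ℚ.positive⁻¹ ½) 0<e)
  M = proj₁ small
  K = 2^ M ℚ.* 2^ M
  tiny : ∀ n q → K ℚ.≤ q → ℚ.∣ error n q ∣ ℚ.+ ½ ℚ.* e ℚ.≤ e
  tiny n q K≤q = begin
    ℚ.∣ error n q ∣ ℚ.+ ½ ℚ.* e
      ≡⟨ cong (ℚ._+ ½ ℚ.* e) (ℚ.0≤p⇒∣p∣≡p (error-nonNeg n q)) ⟩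
    error n q ℚ.+ ½ ℚ.* e
      ≤⟨ ℚ.+-monoˡ-≤ (½ ℚ.* e) (*-monoʳ (nat-nonNeg 4) (partialSum-small M n (ℚ.≤-trans K≤q (p≤∣p∣ q)))) ⟩
    4ℚ ℚ.* (nat 3 ℚ.* ½^ M) ℚ.+ ½ ℚ.* e
      ≤⟨ ℚ.+-monoˡ-≤ (½ ℚ.* e) (ℚ.≤-trans (ℚ.≤-reflexive (sym (ℚ.*-assoc 4ℚ (nat 3) (½^ M))))
           (ℚ.<⇒≤ (proj₂ small M ℕ.≤-refl))) ⟩
    ½ ℚ.* e ℚ.+ ½ ℚ.* e
      ≡⟨ solve 1 (λ e → con ½ :* e :+ con ½ :* e := e) refl e ⟩
    e ∎
    where open ℚ.≤-Reasoning

-- First-fit colourings are Grundy colourings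

-- Holds also when the fuel runs out, since by then every value tested was found in `cs`.
searchUnused-spec : ∀ cs k c → c ℕ.≤ searchUnused cs k c × (∀ j → c ℕ.≤ j → j ℕ.< searchUnused cs k c → j ∈ cs)
searchUnused-spec cs zero    c = ℕ.≤-refl , λ j c≤j j<c → contradiction c≤j (ℕ.<⇒≱ j<c)
searchUnused-spec cs (suc k) c with member? ℕ._≟_ c cs
... | no _     = ℕ.≤-refl , λ j c≤j j<c → contradiction c≤j (ℕ.<⇒≱ j<c)
... | yes c∈cs = ℕ.≤-trans (ℕ.n≤1+n c) (proj₁ IH) , λ j c≤j j< → by-cases j j< (ℕ.m≤n⇒m<n∨m≡n c≤j)
  where
  IH = searchUnused-spec cs k (suc c)
  by-cases : ∀ j → j ℕ.< searchUnused cs k (suc c) → c ℕ.< j ⊎ c ≡ j → j ∈ cs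
  by-cases j j< (inj₁ c<j)  = proj₂ IH j c<j j<
  by-cases j j< (inj₂ refl) = c∈cs

lookup-injective : ∀ {A : Set} {xs : List A} → Unique xs → ∀ {i j} → List.lookup xs i ≡ List.lookup xs j → i ≡ j
lookup-injective (_  ∷ _)  {Fin.zero}  {Fin.zero}  _ = refl
lookup-injective {xs = _ ∷ xs} (x∉ ∷ _) {Fin.zero}  {Fin.suc j} e = contradiction e (All.lookup x∉ (∈-lookup {xs = xs} j))
lookup-injective {xs = _ ∷ xs} (x∉ ∷ _) {Fin.suc i} {Fin.zero}  e = contradiction (sym e) (All.lookup x∉ (∈-lookup {xs = xs} i))
lookup-injective (_ ∷ xs!) {Fin.suc i} {Fin.suc j} e = cong Fin.suc (lookup-injective xs! e)

unique-bounded : ∀ {k xs} → Unique xs → All (ℕ._< k) xs → length xs ℕ.≤ k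
unique-bounded {k} {xs} xs! xs<k = Fin.injective⇒≤ {f = f} λ {i} {j} e → lookup-injective xs!
  (trans (sym (Fin.toℕ-fromℕ< (bound i))) (trans (cong Fin.toℕ e) (Fin.toℕ-fromℕ< (bound j))))
  where
  bound : ∀ i → List.lookup xs i ℕ.< k
  bound i = All.lookup xs<k (∈-lookup {xs = xs} i)
  f : Fin (length xs) → Fin k
  f i = Fin.fromℕ< (bound i)

some-or-all : ∀ k (xs : List ℕ) → (∃ λ c → c ∈ xs × k ℕ.≤ c) ⊎ All (ℕ._< k) xs
some-or-all k []       = inj₂ []
some-or-all k (x ∷ xs) with k ℕ.≤? x | some-or-all k xs
... | yes k≤x | _                    = inj₁ (x , here refl , k≤x)
... | no _    | inj₁ (c , c∈ , k≤c)  = inj₁ (c , there c∈ , k≤c)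
... | no k≰x  | inj₂ all             = inj₂ (ℕ.≰⇒> k≰x ∷ all)

-- Pigeonhole: were all entries below `length xs`, then `0 ∷ xs` would consist of `length xs + 1`
-- distinct numbers below `length xs`.
large-element : ∀ xs → Unique xs → All (1 ℕ.≤_) xs → 1 ℕ.≤ length xs → ∃ λ c → c ∈ xs × length xs ℕ.≤ c
large-element xs xs! 1≤xs 1≤l with some-or-all (length xs) xs
... | inj₁ found = found
... | inj₂ small = contradiction
  (unique-bounded (All.map ℕ.<⇒≢ 1≤xs ∷ xs!) (1≤l ∷ small)) ℕ.1+n≰n

module FirstFit {n : ℕ} (G : Graph n) where

  open Graph G

  Coloured : Set
  Coloured = List (Fin n × ℕ)

  Good : Coloured → Set
  Good L = ∀ {v c} → (v , c) ∈ L → 1 ℕ.≤ c × (∀ j → 1 ℕ.≤ j → j ℕ.< c → ∃ λ u → (u , j) ∈ L × Adj v u)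

  firstFitFrom-good : ∀ L xs → Good L → Good (firstFitFrom G L xs)
  firstFitFrom-good L []       good = good
  firstFitFrom-good L (x ∷ xs) good = firstFitFrom-good _ xs good′
    where
    cs = neighbourColours G x L
    spec = searchUnused-spec cs (length cs) 1
    good′ : Good ((x , smallestUnused cs) ∷ L)
    good′ (there m) = proj₁ (good m) , λ j 1≤j j<c →
      let u , u∈ , a = proj₂ (good m) j 1≤j j<c in u , there u∈ , a
    good′ (here refl) = proj₁ spec , λ j 1≤j j<c →
      let (u , _) , u∈ , j≡ = ∈-map⁻ proj₂ (proj₂ spec j 1≤j j<c)
          u∈L , a           = ∈-filter⁻ (λ (y , _) → adj? x y) u∈
      in u , there (subst (λ k → (u , k) ∈ L) (sym j≡) u∈L) , a

  firstFitFrom-keys : ∀ L xs → Unique (map proj₁ L) → Unique xs → All (λ x → All (x ≢_) (map proj₁ L)) xs →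
    Unique (map proj₁ (firstFitFrom G L xs))
  firstFitFrom-keys L []       L! _          _              = L!
  firstFitFrom-keys L (x ∷ xs) L! (x∉ ∷ xs!) (x∉L ∷ fresh) = firstFitFrom-keys _ xs (x∉L ∷ L!) xs!
    (All.zipWith (λ (x≢y , y∉L) → (λ y≡x → x≢y (sym y≡x)) ∷ y∉L) (x∉ , fresh))

  -- The default 0 marks an uncoloured vertex, on which `GrundyColouring` imposes no condition.
  colourIn : Coloured → Fin n → ℕ
  colourIn []            v = 0
  colourIn ((u , c) ∷ L) v with u Fin.≟ v
  ... | yes _ = c
  ... | no _  = colourIn L v

  colourIn-∈ : ∀ L v → 1 ℕ.≤ colourIn L v → (v , colourIn L v) ∈ L
  colourIn-∈ ((u , c) ∷ L) v 1≤ with u Fin.≟ v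
  ... | yes refl = here refl
  ... | no _     = there (colourIn-∈ L v 1≤)

  ∈-colourIn : ∀ {L v c} → Unique (map proj₁ L) → (v , c) ∈ L → colourIn L v ≡ c
  ∈-colourIn {(u , c) ∷ L} {v} (u∉ ∷ L!) m with u Fin.≟ v
  ∈-colourIn (u∉ ∷ L!) (here refl) | yes _    = refl
  ∈-colourIn (u∉ ∷ L!) (here refl) | no u≢u   = contradiction refl u≢u
  ∈-colourIn (u∉ ∷ L!) (there m)   | yes refl = contradiction refl (All.lookup u∉ (∈-map⁺ proj₁ m))
  ∈-colourIn (u∉ ∷ L!) (there m)   | no _     = ∈-colourIn L! m

  grundy-vertex : ∀ xs → Unique xs → 1 ℕ.≤ coloursUsed G xs →
    ∃ λ col → GrundyColouring G col × ∃ λ v → coloursUsed G xs ℕ.≤ col v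
  grundy-vertex xs xs! 1≤k = colourIn L , grundy , v , ℕ.≤-trans k≤c (ℕ.≤-reflexive (sym (∈-colourIn L! v∈L)))
    where
    L = firstFit G xs
    L! : Unique (map proj₁ L)
    L! = firstFitFrom-keys [] xs [] xs! (All.universal (λ _ → []) xs)
    good : Good L
    good = firstFitFrom-good [] xs λ ()
    grundy : GrundyColouring G (colourIn L)
    grundy v j 1≤j j< =
      let u , u∈ , a = proj₂ (good (colourIn-∈ L v (ℕ.≤-trans 1≤j (ℕ.<⇒≤ j<)))) j 1≤j j<
      in u , a , ∈-colourIn L! u∈
    colours = map proj₂ L
    D = deduplicate ℕ._≟_ colours
    D-pos : All (1 ℕ.≤_) D
    D-pos = All.tabulate λ c∈D →
      let (u , _) , u∈ , c≡ = ∈-map⁻ proj₂ (∈-deduplicate⁻ ℕ._≟_ colours c∈D)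
      in ℕ.≤-trans (proj₁ (good u∈)) (ℕ.≤-reflexive (sym c≡))
    large = large-element D (DecUnique.deduplicate-! ℕ._≟_ colours) D-pos 1≤k
    c = proj₁ large
    k≤c = proj₂ (proj₂ large)
    entry = ∈-map⁻ proj₂ (∈-deduplicate⁻ ℕ._≟_ colours (proj₁ (proj₂ large)))
    v = proj₁ (proj₁ entry)
    v∈L : (v , c) ∈ L
    v∈L = subst (λ k → (v , k) ∈ L) (sym (proj₂ (proj₂ entry))) (proj₁ (proj₂ entry))

  Γ-attained : Γ G ≡ 0 ⊎ ∃ λ col → GrundyColouring G col × ∃ λ v → Γ G ℕ.≤ col v
  Γ-attained = by-cases (argmax-sel id 0 (map (coloursUsed G) (orderings n))) (Γ G ℕ.≟ 0)
    where
    by-cases : Γ G ≡ 0 ⊎ Γ G ∈ map (coloursUsed G) (orderings n) → Dec (Γ G ≡ 0) →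
      Γ G ≡ 0 ⊎ ∃ λ col → GrundyColouring G col × ∃ λ v → Γ G ℕ.≤ col v
    by-cases (inj₁ Γ≡0) _         = inj₁ Γ≡0
    by-cases (inj₂ _)  (yes Γ≡0)  = inj₁ Γ≡0
    by-cases (inj₂ Γ∈) (no Γ≢0)   =
      let xs , xs∈ , Γ≡ = ∈-map⁻ (coloursUsed G) Γ∈
          _ , xs!       = ∈-filter⁻ (unique? Fin._≟_) {xs = words (allFin n) n} xs∈
          col , grundy , v , le = grundy-vertex xs xs! (ℕ.≤-trans (ℕ.n≢0⇒n>0 Γ≢0) (ℕ.≤-reflexive Γ≡))
      in inj₂ (col , grundy , v , ℕ.≤-trans (ℕ.≤-reflexive Γ≡) le)

-- Comparing u² with w² when |u − w| ≤ e: unless w² already exceeds a, the size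
-- of w is bounded in terms of a, which makes the choice of e uniform.
tolerance : ℚ → ℚ → ℚ
tolerance a ε = ε ℚ.* inv ((1ℚ ℚ.+ 2ℚ ℚ.* (a ℚ.+ 1ℚ)) ℚ.+ ε)

module Tolerance {a ε : ℚ} (0≤a : 0ℚ ℚ.≤ a) (0<ε : 0ℚ ℚ.< ε) where

  Q D e : ℚ
  Q = a ℚ.+ 1ℚ
  D = (1ℚ ℚ.+ 2ℚ ℚ.* Q) ℚ.+ ε
  e = tolerance a ε

  0≤Q : 0ℚ ℚ.≤ Q
  0≤Q = +-nonNeg 0≤a 0≤1

  0≤1+2Q : 0ℚ ℚ.≤ 1ℚ ℚ.+ 2ℚ ℚ.* Q
  0≤1+2Q = +-nonNeg 0≤1 (*-nonNeg (nat-nonNeg 2) 0≤Q)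

  0<D : 0ℚ ℚ.< D
  0<D = ℚ.+-mono-≤-< 0≤1+2Q 0<ε

  0<e : 0ℚ ℚ.< e
  0<e = *-pos 0<ε (inv-pos 0<D)

  eD≡ε : e ℚ.* D ≡ ε
  eD≡ε = trans (solve 3 (λ e i d → (e :* i) :* d := e :* (d :* i)) refl ε (inv D) D)
    (trans (cong (ε ℚ.*_) (*-inv 0<D)) (ℚ.*-identityʳ ε))

  e≤1 : e ℚ.≤ 1ℚ
  e≤1 = *-cancelˡ 0<D (subst₂ ℚ._≤_ (sym (trans (ℚ.*-comm D e) eD≡ε)) (sym (ℚ.*-identityʳ D))
    (≤-by-diff (solve 2 (λ x e → (x :+ e) :- e := x) refl (1ℚ ℚ.+ 2ℚ ℚ.* Q) ε) 0≤1+2Q))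

  e[1+2Q]≤ε : e ℚ.* (1ℚ ℚ.+ 2ℚ ℚ.* Q) ℚ.≤ ε
  e[1+2Q]≤ε = subst (e ℚ.* (1ℚ ℚ.+ 2ℚ ℚ.* Q) ℚ.≤_) eD≡ε (*-monoʳ (ℚ.<⇒≤ 0<e)
    (≤-by-diff (solve 2 (λ x e → (x :+ e) :- x := e) refl (1ℚ ℚ.+ 2ℚ ℚ.* Q) ε) (ℚ.<⇒≤ 0<ε)))

  square-close : ∀ u w → a ℚ.≤ u ℚ.* u → ℚ.∣ u ℚ.- w ∣ ℚ.≤ e → a ℚ.≤ w ℚ.* w ℚ.+ ε
  square-close u w a≤uu close with ℚ.≤-total a (w ℚ.* w)
  ... | inj₁ a≤ww = ℚ.≤-trans a≤ww (≤-by-diff (solve 2 (λ x e → (x :+ e) :- x := e) refl (w ℚ.* w) ε) (ℚ.<⇒≤ 0<ε))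
  ... | inj₂ ww≤a = begin
    a
      ≤⟨ a≤uu ⟩
    u ℚ.* u
      ≡⟨ solve 2 (λ u w → u :* u := w :* w :+ ((u :- w) :* (u :- w) :+ con 2ℚ :* (w :* (u :- w)))) refl u w ⟩
    w ℚ.* w ℚ.+ ((u ℚ.- w) ℚ.* (u ℚ.- w) ℚ.+ 2ℚ ℚ.* (w ℚ.* (u ℚ.- w)))
      ≤⟨ ℚ.+-monoʳ-≤ (w ℚ.* w) (ℚ.+-mono-≤ (product (u ℚ.- w) ∣u-w∣≤1) (*-monoʳ (nat-nonNeg 2) (product w ∣w∣≤Q))) ⟩
    w ℚ.* w ℚ.+ (1ℚ ℚ.* e ℚ.+ 2ℚ ℚ.* (Q ℚ.* e))
      ≡⟨ cong (w ℚ.* w ℚ.+_) (solve 2 (λ q e → con 1ℚ :* e :+ con 2ℚ :* (q :* e) := e :* (con 1ℚ :+ con 2ℚ :* q)) refl Q e) ⟩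
    w ℚ.* w ℚ.+ e ℚ.* (1ℚ ℚ.+ 2ℚ ℚ.* Q)
      ≤⟨ ℚ.+-monoʳ-≤ (w ℚ.* w) e[1+2Q]≤ε ⟩
    w ℚ.* w ℚ.+ ε ∎
    where
    open ℚ.≤-Reasoning
    ∣u-w∣≤1 : ℚ.∣ u ℚ.- w ∣ ℚ.≤ 1ℚ
    ∣u-w∣≤1 = ℚ.≤-trans close e≤1
    ∣w∣≤Q : ℚ.∣ w ∣ ℚ.≤ Q
    -- `Q = a + 1` serves as a rational upper bound for the square root of `a`.
    ∣w∣≤Q = square-cancel-≤ 0≤Q (subst (ℚ._≤ Q ℚ.* Q)
      (trans (sym (ℚ.0≤p⇒∣p∣≡p (square-nonNeg w))) (ℚ.∣p*q∣≡∣p∣*∣q∣ w w))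
      (ℚ.≤-trans ww≤a (≤-by-diff (solve 1 (λ a → (a :+ con 1ℚ) :* (a :+ con 1ℚ) :- a := (a :* a :+ a) :+ con 1ℚ) refl a)
        (+-nonNeg (+-nonNeg (square-nonNeg a) 0≤a) 0≤1))))
    product : ∀ p {c} → ℚ.∣ p ∣ ℚ.≤ c → p ℚ.* (u ℚ.- w) ℚ.≤ c ℚ.* e
    product p {c} p≤c = ℚ.≤-trans (p≤∣p∣ (p ℚ.* (u ℚ.- w))) (subst (ℚ._≤ c ℚ.* e) (sym (ℚ.∣p*q∣≡∣p∣*∣q∣ p (u ℚ.- w)))
      (*-mono (ℚ.0≤∣p∣ p) (ℚ.<⇒≤ 0<e) p≤c close))

-- The chain is built at the rational point `y = seq μ k + δ`, which lies above `μ` by a definite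
-- margin, and the inequality is then moved back to `seq μ k`. The map `q ↦ q + error k q` has
-- Lipschitz constant `1 + 8`, hence `δ = e / 9`.
grundy-bound : ∀ {n} (G : Graph n) {μ} → IsLargestMatchingRoot G μ →
  ∀ {col} → GrundyColouring G col → ∀ m v → col v ≡ suc m → ∀ ε → 0ℚ ℚ.< ε →
  ∃ λ N → ∀ k → N ℕ.≤ k → nat m ℚ.+ nat m ℚ.≤
    (seq μ k ℚ.+ error k (seq μ k)) ℚ.* (seq μ k ℚ.+ error k (seq μ k)) ℚ.+ ε
-- The threshold `suc i` ensures that the `k`-th partial sum already contains the summand `i` on
-- which the estimate rests.
grundy-bound G {μ} isLargest {col} grundy m v colv ε 0<ε = (N₁ ℕ.⊔ N₂) ℕ.⊔ suc i , bound
  where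
  open Tolerance {nat m ℚ.+ nat m} (+-nonNeg (nat-nonNeg m) (nat-nonNeg m)) 0<ε using (e; 0<e; square-close)
  δ = inv 9ℚ ℚ.* e
  0<δ : 0ℚ ℚ.< δ
  0<δ = *-pos (inv-pos (nat-pos 8)) 0<e
  9δ≡e : 9ℚ ℚ.* δ ≡ e
  9δ≡e = trans (sym (ℚ.*-assoc 9ℚ (inv 9ℚ) e)) (trans (cong (ℚ._* e) (*-inv (nat-pos 8))) (ℚ.*-identityˡ e))
  0<½δ : 0ℚ ℚ.< ½ ℚ.* δ
  0<½δ = *-pos (ℚ.positive⁻¹ ½) 0<δ
  near = cauchy μ (½ ℚ.* δ) 0<½δ
  nonNeg = largestMatchingRoot-nonNegative G isLargest δ 0<δ
  N₁ = proj₁ near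
  N₂ = proj₁ nonNeg
  i = proj₁ (chain-summand m)
  bound : ∀ k → (N₁ ℕ.⊔ N₂) ℕ.⊔ suc i ℕ.≤ k → nat m ℚ.+ nat m ℚ.≤
    (seq μ k ℚ.+ error k (seq μ k)) ℚ.* (seq μ k ℚ.+ error k (seq μ k)) ℚ.+ ε
  bound k k≥ = square-close u w 2m≤uu close
    where
    x = seq μ k
    y = x ℚ.+ δ
    u = y ℚ.+ error k y
    w = x ℚ.+ error k x
    k≥N = ℕ.m⊔n≤o⇒m≤o (N₁ ℕ.⊔ N₂) (suc i) k≥
    0≤y : 0ℚ ℚ.≤ y
    0≤y = proj₂ nonNeg k (ℕ.m⊔n≤o⇒n≤o N₁ N₂ k≥N)
    -- One half of `δ` absorbs the oscillation of `μ` beyond `N₁`; the other half remains as the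
    -- margin.
    above : ∀ j → N₁ ℕ.≤ j → seq μ j ℚ.+ ½ ℚ.* δ ℚ.< y
    above j j≥ = <-by-diff
      (solve 3 (λ x z d → (x :+ d) :- (z :+ con ½ :* d) := con ½ :* d :- (z :- x)) refl x (seq μ j) δ)
      (diff-pos (ℚ.≤-<-trans (p≤∣p∣ (seq μ j ℚ.- x)) (proj₂ near j k j≥ (ℕ.m⊔n≤o⇒m≤o N₁ N₂ k≥N))))
    chain : Chain m y
    chain = GrundyChain.chain G col grundy y (positive-above-root G {μ} isLargest {N = N₁} 0≤y 0<½δ above) m v colv
    2m≤uu : nat m ℚ.+ nat m ℚ.≤ u ℚ.* u
    2m≤uu = proj₂ (chain-summand m) y (error k y) 0≤y chain (*-monoʳ (nat-nonNeg 4)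
      (subst (λ q → summand i y ℚ.≤ partialSum k q) (sym (ℚ.0≤p⇒∣p∣≡p 0≤y))
        (summand-≤partialSum 0≤y (ℕ.m⊔n≤o⇒n≤o (N₁ ℕ.⊔ N₂) (suc i) k≥))))
    ∣y-x∣≡δ : ℚ.∣ y ℚ.- x ∣ ≡ δ
    ∣y-x∣≡δ = trans (cong ℚ.∣_∣ (solve 2 (λ x d → (x :+ d) :- x := d) refl x δ)) (ℚ.0≤p⇒∣p∣≡p (ℚ.<⇒≤ 0<δ))
    close : ℚ.∣ u ℚ.- w ∣ ℚ.≤ e
    close = begin
      ℚ.∣ u ℚ.- w ∣
        ≡⟨ cong ℚ.∣_∣ (solve 4 (λ a b c d → (a :+ b) :- (c :+ d) := (a :- c) :+ (b :- d)) refl y (error k y) x (error k x)) ⟩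
      ℚ.∣ (y ℚ.- x) ℚ.+ (error k y ℚ.- error k x) ∣
        ≤⟨ ℚ.∣p+q∣≤∣p∣+∣q∣ (y ℚ.- x) (error k y ℚ.- error k x) ⟩
      ℚ.∣ y ℚ.- x ∣ ℚ.+ ℚ.∣ error k y ℚ.- error k x ∣
        ≤⟨ ℚ.+-monoʳ-≤ ℚ.∣ y ℚ.- x ∣ (error-lipschitz k y x) ⟩
      ℚ.∣ y ℚ.- x ∣ ℚ.+ 8ℚ ℚ.* ℚ.∣ y ℚ.- x ∣
        ≡⟨ trans (cong (λ d → d ℚ.+ 8ℚ ℚ.* d) ∣y-x∣≡δ) (solve 1 (λ d → d :+ con 8ℚ :* d := con 9ℚ :* d) refl δ) ⟩
      9ℚ ℚ.* δ
        ≡⟨ 9δ≡e ⟩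
      e ∎
      where open ℚ.≤-Reasoning

-- The bound on the Grundy number

half-square : ∀ {g m} w ε → 0ℚ ℚ.≤ ε → g ℚ.≤ 1ℚ ℚ.+ m → m ℚ.+ m ℚ.≤ w ℚ.* w ℚ.+ ε →
  g ℚ.≤ (½ ℚ.* (w ℚ.* (w ℚ.* 1ℚ)) ℚ.+ 1ℚ) ℚ.+ ε
half-square {g} {m} w ε 0≤ε g≤ 2m≤ = ≤-by-diff
  (solve 4 (λ g m w e → ((con ½ :* (w :* (w :* con 1ℚ)) :+ con 1ℚ) :+ e) :- g :=
    (con ½ :* ((w :* w :+ e) :- (m :+ m)) :+ ((con 1ℚ :+ m) :- g)) :+ con ½ :* e) refl g m w ε)
  (+-nonNeg (+-nonNeg (*-nonNeg 0≤½ (diff-nonNeg 2m≤)) (diff-nonNeg g≤)) (*-nonNeg 0≤½ 0≤ε))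
  where
  0≤½ : 0ℚ ℚ.≤ ½
  0≤½ = ℚ.nonNegative⁻¹ ½

Γ-bound : ∀ {n} (G : Graph n) {μ} → IsLargestMatchingRoot G μ →
  fromℕ (Γ G) ≤ fromℚ ½ * (μ + errorℝ μ) ^ 2 + 1ℝ
Γ-bound G {μ} isLargest ε 0<ε = by-cases (FirstFit.Γ-attained G)
  where
  w : ℕ → ℚ
  w k = seq μ k ℚ.+ error k (seq μ k)
  Goal : Set
  Goal = ∃ λ N → ∀ k → N ℕ.≤ k → (ℤ.+ Γ G) ℚ./ 1 ℚ.≤ (½ ℚ.* (w k ℚ.* (w k ℚ.* 1ℚ)) ℚ.+ 1ℚ) ℚ.+ ε
  Γ≤nat : ∀ {c} → Γ G ℕ.≤ c → (ℤ.+ Γ G) ℚ./ 1 ℚ.≤ nat c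
  Γ≤nat Γ≤c = ℚ.≤-trans (ℚ.≤-reflexive (/1≡nat (Γ G))) (nat-mono Γ≤c)
  trivial : Γ G ℕ.≤ 0 → Goal
  trivial Γ≤0 = 0 , λ k _ → half-square {m = 0ℚ} (w k) ε (ℚ.<⇒≤ 0<ε) (ℚ.≤-trans (Γ≤nat Γ≤0) 0≤1)
    (+-nonNeg (square-nonNeg (w k)) (ℚ.<⇒≤ 0<ε))
  by-colour : ∀ {col} → GrundyColouring G col → ∀ v c → col v ≡ c → Γ G ℕ.≤ c → Goal
  by-colour grundy v zero    colv Γ≤c = trivial Γ≤c
  by-colour grundy v (suc m) colv Γ≤c = proj₁ bound , λ k k≥ →
    half-square {m = nat m} (w k) ε (ℚ.<⇒≤ 0<ε) (Γ≤nat Γ≤c) (proj₂ bound k k≥)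
    where bound = grundy-bound G {μ} isLargest grundy m v colv ε 0<ε
  by-cases : Γ G ≡ 0 ⊎ (∃ λ col → GrundyColouring G col × ∃ λ v → Γ G ℕ.≤ col v) → Goal
  by-cases (inj₁ Γ≡0)                      = trivial (ℕ.≤-reflexive Γ≡0)
  by-cases (inj₂ (col , grundy , v , Γ≤c)) = by-colour grundy v (col v) refl Γ≤c

theorem1 : Σ (ℝ≥0 → ℝ) λ f →
    Congruent _≈₊_ _≈_ f ×
    VanishesAtInfinity f ×
    (∀ {n : ℕ} (G : Graph n) (μ₁ : ℝ) (isLargest : IsLargestMatchingRoot G μ₁) →
    fromℕ (Γ G) ≤ fromℚ ½ * (μ₁ + f (μ₁ , largestMatchingRoot-nonNegative G isLargest)) ^ 2 + 1ℝ)
theorem1 = (λ (x , _) → errorℝ x) , (λ {x} {y} → errorℝ-cong {proj₁ x} {proj₁ y}) , errorℝ-vanishes ,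
  λ G μ₁ isLargest → Γ-bound G {μ₁} isLargest
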